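{- Let $k,a,b,\Delta$ be positive integers with $a\leqslant b$ coprime, let $\chi=(k-1)+a/b$, and let $\mu,\rho'\in(0,1]$. There exists $\rho_0>0$ such that for every $\rho\in(0,\rho_0]$ there is $\xi_0>0$ such that for every $\xi\in(0,\xi_0]$ there is $n_0$ such that for all $n\geqslant n_0$ and all $\ell,t\in\mathbb{N}$: if $G$ is a $\mu$-robust $(\chi,\rho;t,\ell)$-tiling framework on $n$ vertices and $H\in\mathcal{B}((1-\rho')n,\xi n,\Delta)\cap\mathcal{J}(\chi)$, then $H\subseteq G$.
   Context: Here $B_\chi$ denotes the complete $k$-partite graph with one part of size $a$ and $k-1$ parts of size $b$. $\mathcal{B}(n,w,\Delta)$ is the family of graphs on at most $n$ vertices with maximum degree at most $\Delta$ all of whose connected components have at most $w$ vertices. $\mathcal{J}(\chi)$ is the family of graphs $H$ with $\chi_{\mathrm{cr}}(H)\leqslant\chi$, where for a graph $F$ with $k'=\chi(F)$, $\alpha(F)$ is the minimum over proper $k'$-colourings of the proportion of vertices in a smallest colour class and $\chi_{\mathrm{cr}}(F)=(k'-1)+\frac{\alpha(F)(k'-1)}{1-\alpha(F)}$. A fractional $F$-tiling of $G$ is $\omega:\mathrm{Hom}(F;G)\to[0,1]$ with $\sum_\theta\omega(\theta)|\theta^{ -1}(v)|\leqslant1$ for all $v$; weight $v(F)\sum_\theta\omega(\theta)$; $(1-\rho)$-perfect if weight $\geqslant(1-\rho)v(G)$. $K_k(G)$ is the $k$-graph of $k$-cliques of $G$. Tight components of a $k$-graph $J$: subhypergraphs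 whose edge sets are components of the graph on $E(J)$ with $e\sim f$ iff $|e\cap f|=k-1$. Loose components: unions of tight components forming components of the graph on tight components where two are adjacent iff their vertex sets meet. $J$ is $(t,\ell)$-connected if some vertex-spanning subgraph has at most $t$ tight and at most $\ell$ loose components. $v$ and edge $f\not\ni v$ are linked if some edge $e\ni v$ has $|e\cap f|=k-1$; $J$ is linked if every vertex is linked to an edge. $G$ is a $(\chi,\rho;t,\ell)$-tiling framework if it has a $(1-\rho)$-perfect fractional $B_\chi$-tiling and $K_{\lceil\chi\rceil}(G)$ is $(t,\ell)$-connected and linked. An $(\varepsilon,d)$-approximation of $G$ is a subgraph $G'$ with $\deg_{G'}(v)\geqslant\deg_G(v)-d\,v(G)$ for $v\in V(G')$ and $v(G')\geqslant(1-\varepsilon)v(G)$; $G$ is a $\mu$-robust $(\chi,\rho;t,\ell)$-tiling framework if every $(\mu,\mu)$-approximation of $G$ is a $(\chi,\rho;t,\ell)$-tiling framework.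
   Formalization: The parameters μ, ρ', ρ, ξ (and ρ₀, ξ₀) and the weights ω of the fractional tilings are taken rational instead of real. -}

module Defs where

open import Data.Bool using (Bool; true; false; if_then_else_; _∧_; not)
open import Data.Nat as ℕ using (ℕ; zero; suc; _∸_)
open import Data.Integer using (+_)
open import Data.Fin as Fin using (Fin; splitAt; remQuot)
open import Data.Fin.Subset as Sub using (Subset; _∈_; _∉_; _∩_; ∣_∣)
open import Data.List as List using (List; []; _∷_; length; map; concatMap; filter; foldr; allFin)
open import Data.List.Membership.Propositional as LM using ()
open import Data.List.Relation.Unary.Unique.Propositional using (Unique)
open import Data.List.Relation.Unary.All using (All)
open import Data.Maybe using (Maybe; just; nothing)
open import Data.Product using (Σ; ∃; _×_; _,_; proj₁; proj₂)
open import Data.Sum using (_⊎_; inj₁; inj₂)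
open import Data.Rational as ℚ using (ℚ; 0ℚ; 1ℚ; _+_; _*_; _-_; _⊓_; _≤_; _<_; _÷_)
open import Data.Rational.Properties using () renaming (_≟_ to _≟ℚ_)
open import Function using (_∘_)
open import Function.Definitions using (Injective)
open import Relation.Binary.PropositionalEquality using (_≡_; _≢_)
open import Relation.Binary.Construct.Closure.ReflexiveTransitive using (Star)
open import Relation.Nullary using (yes; no; ¬_)
open import Relation.Nullary.Decidable using (⌊_⌋)

ℕ→ℚ : ℕ → ℚ
ℕ→ℚ n = + n ℚ./ 1

-- division with the convention p / 0 = 0 (only used in degenerate cases)
_÷₀_ : ℚ → ℚ → ℚ
p ÷₀ q with q ≟ℚ 0ℚ
... | yes _ = 0ℚ
... | no q≢0 = _÷_ p q {{ℚ.≢-nonZero q≢0}}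

minimumℚ : ℚ → List ℚ → ℚ
minimumℚ d [] = d
minimumℚ d (x ∷ xs) = foldr _⊓_ x xs

record Graph (n : ℕ) : Set where
  field
    adj   : Fin n → Fin n → Bool
    sym   : ∀ u v → adj u v ≡ adj v u
    irrefl : ∀ v → adj v v ≡ false
open Graph public

count : ∀ {n} → (Fin n → Bool) → ℕ
count {n} p = length (filter (λ i → p i Data.Bool.≟ true) (allFin n))
  where import Data.Bool

allB : ∀ {n} → (Fin n → Bool) → Bool
allB {n} p = foldr (λ i r → p i ∧ r) true (allFin n)

deg : ∀ {n} → Graph n → Fin n → ℕ
deg G v = count (adj G v)

cons : ∀ {m n} → Fin n → (Fin m → Fin n) → (Fin (suc m) → Fin n)
cons i f Fin.zero = i
cons i f (Fin.suc j) = f j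

allMaps : ∀ m n → List (Fin m → Fin n)
allMaps zero n = (λ ()) ∷ []
allMaps (suc m) n = concatMap (λ f → map (λ i → cons i f) (allFin n)) (allMaps m n)

eqFinB : ∀ {n} → Fin n → Fin n → Bool
eqFinB i j = ⌊ i Fin.≟ j ⌋

isHomB : ∀ {m n} → Graph m → Graph n → (Fin m → Fin n) → Bool
isHomB F G θ = allB (λ u → allB (λ v → if adj F u v then adj G (θ u) (θ v) else true))

sumℚ : List ℚ → ℚ
sumℚ = foldr _+_ 0ℚ

-- B_χ : complete k-partite graph with one part of size a and k-1 parts of size b.
-- Vertex set Fin (a + (k-1) b); the first a vertices form the special part,
-- the rest are split into k-1 blocks of b vertices.

partB : ∀ k a b → Fin (a ℕ.+ (k ∸ 1) ℕ.* b) → Maybe (Fin (k ∸ 1))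
partB k a b x with splitAt a x
... | inj₁ _ = nothing
... | inj₂ y = just (proj₁ (remQuot b y))

eqPartB : ∀ {k} → Maybe (Fin k) → Maybe (Fin k) → Bool
eqPartB nothing nothing = true
eqPartB nothing (just _) = false
eqPartB (just _) nothing = false
eqPartB (just i) (just j) = eqFinB i j

eqPartB-refl : ∀ {k} (p : Maybe (Fin k)) → eqPartB p p ≡ true
eqPartB-refl nothing = Relation.Binary.PropositionalEquality.refl
eqPartB-refl (just i) with i Fin.≟ i
... | yes _ = Relation.Binary.PropositionalEquality.refl
... | no ¬p = Data.Empty.⊥-elim (¬p Relation.Binary.PropositionalEquality.refl)
  where import Data.Empty

eqPartB-sym : ∀ {k} (p q : Maybe (Fin k)) → eqPartB p q ≡ eqPartB q p
eqPartB-sym nothing nothing = Relation.Binary.PropositionalEquality.refl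
eqPartB-sym nothing (just _) = Relation.Binary.PropositionalEquality.refl
eqPartB-sym (just _) nothing = Relation.Binary.PropositionalEquality.refl
eqPartB-sym (just i) (just j) with i Fin.≟ j | j Fin.≟ i
... | yes _ | yes _ = Relation.Binary.PropositionalEquality.refl
... | no _ | no _ = Relation.Binary.PropositionalEquality.refl
... | yes p | no q = Data.Empty.⊥-elim (q (Relation.Binary.PropositionalEquality.sym p))
  where import Data.Empty
... | no p | yes q = Data.Empty.⊥-elim (p (Relation.Binary.PropositionalEquality.sym q))
  where import Data.Empty

Bχ : ∀ k a b → Graph (a ℕ.+ (k ∸ 1) ℕ.* b)
Bχ k a b = record
  { adj = λ u v → not (eqPartB (partB k a b u) (partB k a b v))
  ; sym = λ u v → Relation.Binary.PropositionalEquality.cong not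
                    (eqPartB-sym (partB k a b u) (partB k a b v))
  ; irrefl = λ v → Relation.Binary.PropositionalEquality.cong not
                    (eqPartB-refl (partB k a b v))
  }

-- ω : Hom(F;G) → [0,1], represented as a function on all maps Fin m → Fin n
-- (its values on non-homomorphisms are ignored).
preimageSize : ∀ {m n} → (Fin m → Fin n) → Fin n → ℕ
preimageSize θ v = count (λ u → eqFinB (θ u) v)

homs : ∀ {m n} → Graph m → Graph n → List (Fin m → Fin n)
homs {m} {n} F G = filter (λ θ → isHomB F G θ Data.Bool.≟ true) (allMaps m n)
  where import Data.Bool

record FractionalTiling {m n} (F : Graph m) (G : Graph n) : Set where
  field
    ω      : (Fin m → Fin n) → ℚ
    ω-nonneg : ∀ θ → 0ℚ ≤ ω θ
    ω-le1    : ∀ θ → ω θ ≤ 1ℚ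
    vertex-bound : ∀ v → sumℚ (map (λ θ → ω θ * ℕ→ℚ (preimageSize θ v)) (homs F G)) ≤ 1ℚ
open FractionalTiling public

tilingWeight : ∀ {m n} {F : Graph m} {G : Graph n} → FractionalTiling F G → ℚ
tilingWeight {m} {n} {F} {G} T = ℕ→ℚ m * sumℚ (map (ω T) (homs F G))

HasPerfectFracTiling : ∀ {m n} → ℚ → Graph m → Graph n → Set
HasPerfectFracTiling {m} {n} ρ F G =
  Σ (FractionalTiling F G) λ T → (1ℚ - ρ) * ℕ→ℚ n ≤ tilingWeight T

-- The clique k-graph K_k(G): vertex set Fin n, edges = k-cliques (as subsets)

IsClique : ∀ {n} → Graph n → ℕ → Subset n → Set
IsClique G k e = ∣ e ∣ ≡ k × (∀ u v → u ∈ e → v ∈ e → u ≢ v → adj G u v ≡ true)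

module _ {n : ℕ} (G : Graph n) (k : ℕ) where

  record SubKGraph : Set where
    field
      edges : List (Subset n)
      edges-cliques : All (IsClique G k) edges
  open SubKGraph public

  VertexSpanning : SubKGraph → Set
  VertexSpanning S = ∀ (v : Fin n) → Σ (Subset n) λ e → (e LM.∈ edges S) × (v ∈ e)

  TightAdj : SubKGraph → Subset n → Subset n → Set
  TightAdj S e f = (e LM.∈ edges S) × (f LM.∈ edges S) × (∣ e ∩ f ∣ ≡ k ∸ 1)

  TightConn : SubKGraph → Subset n → Subset n → Set
  TightConn S = Star (TightAdj S)

  -- the tight components of e and f are adjacent (their vertex sets meet)
  LooseAdj : SubKGraph → Subset n → Subset n → Set
  LooseAdj S e f = Σ (Subset n) λ e' → Σ (Subset n) λ f' → Σ (Fin n) λ v →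
    TightConn S e e' × TightConn S f f' × v ∈ e' × v ∈ f'

  LooseConn : SubKGraph → Subset n → Subset n → Set
  LooseConn S = Star (LooseAdj S)

  AtMostComponents : SubKGraph → (Subset n → Subset n → Set) → ℕ → Set
  AtMostComponents S Conn c = Σ (List (Subset n)) λ reps →
    (length reps ℕ.≤ c) × All (λ r → r LM.∈ edges S) reps ×
    (∀ e → e LM.∈ edges S → Σ (Subset n) λ r → (r LM.∈ reps) × Conn e r)

  TLConnected : ℕ → ℕ → Set
  TLConnected t ℓ = Σ SubKGraph λ S → VertexSpanning S ×
    AtMostComponents S (TightConn S) t × AtMostComponents S (LooseConn S) ℓ

  Linked : Set
  Linked = ∀ (v : Fin n) → Σ (Subset n) λ f → Σ (Subset n) λ e →
    IsClique G k f × IsClique G k e × v ∉ f × v ∈ e × ∣ e ∩ f ∣ ≡ k ∸ 1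

-- Tiling frameworks. Here χ = (k-1) + a/b with 1 ≤ a ≤ b, so ⌈χ⌉ = k.

TilingFramework : ∀ {n} (k a b : ℕ) (ρ : ℚ) (t ℓ : ℕ) → Graph n → Set
TilingFramework k a b ρ t ℓ G =
  HasPerfectFracTiling ρ (Bχ k a b) G × TLConnected G k t ℓ × Linked G k

record SubgraphOf {m n} (G' : Graph m) (G : Graph n) : Set where
  field
    emb : Fin m → Fin n
    emb-inj : Injective _≡_ _≡_ emb
    emb-edge : ∀ u v → adj G' u v ≡ true → adj G (emb u) (emb v) ≡ true
open SubgraphOf public

IsApproximation : ∀ {m n} → ℚ → ℚ → (G' : Graph m) (G : Graph n) → SubgraphOf G' G → Set
IsApproximation {m} {n} ε d G' G s =
  (∀ v → ℕ→ℚ (deg G (emb s v)) - d * ℕ→ℚ n ≤ ℕ→ℚ (deg G' v)) ×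
  ((1ℚ - ε) * ℕ→ℚ n ≤ ℕ→ℚ m)

RobustTilingFramework : ∀ {n} (μ : ℚ) (k a b : ℕ) (ρ : ℚ) (t ℓ : ℕ) → Graph n → Set
RobustTilingFramework {n} μ k a b ρ t ℓ G =
  ∀ (m : ℕ) (G' : Graph m) (s : SubgraphOf G' G) →
    IsApproximation μ μ G' G s → TilingFramework k a b ρ t ℓ G'

Reach : ∀ {m} → Graph m → Fin m → Fin m → Set
Reach H = Star (λ u v → adj H u v ≡ true)

InB : ∀ {m} → ℚ → ℚ → ℕ → Graph m → Set
InB {m} N w Δ H =
  (ℕ→ℚ m ≤ N) × (∀ v → deg H v ℕ.≤ Δ) ×
  -- every connected component has at most w vertices
  (∀ v (L : List (Fin m)) → Unique L → All (Reach H v) L → ℕ→ℚ (length L) ≤ w)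

ProperColouring : ∀ {m} → Graph m → (c : ℕ) → (Fin m → Fin c) → Set
ProperColouring H c col = ∀ u v → adj H u v ≡ true → col u ≢ col v

isProperB : ∀ {m} → Graph m → (c : ℕ) → (Fin m → Fin c) → Bool
isProperB H c col = allB (λ u → allB (λ v → if adj H u v then not (eqFinB (col u) (col v)) else true))

IsChromaticNumber : ∀ {m} → Graph m → ℕ → Set
IsChromaticNumber H c =
  Σ _ (ProperColouring H c) × (∀ j → j ℕ.< c → ∀ col → ¬ ProperColouring H j col)

smallestClassProportion : ∀ {m} (c : ℕ) → (Fin m → Fin c) → ℚ
smallestClassProportion {m} c col =
  minimumℚ 0ℚ (map (λ i → ℕ→ℚ (count (λ u → eqFinB (col u) i)) ÷₀ ℕ→ℚ m) (allFin c))

-- α(H), given c = χ(H): minimum over proper c-colourings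
alphaH : ∀ {m} → Graph m → ℕ → ℚ
alphaH {m} H c = minimumℚ 0ℚ
  (map (smallestClassProportion c)
       (filter (λ col → isProperB H c col Data.Bool.≟ true) (allMaps m c)))
  where import Data.Bool

-- χ_cr(H) = (c-1) + α(c-1)/(1-α), given c = χ(H)
chiCr : ∀ {m} → Graph m → ℕ → ℚ
chiCr H c = (ℕ→ℚ c - 1ℚ) + ((alphaH H c * (ℕ→ℚ c - 1ℚ)) ÷₀ (1ℚ - alphaH H c))

InJ : ∀ {m} → ℚ → Graph m → Set
InJ χ H = Σ ℕ λ c → IsChromaticNumber H c × chiCr H c ≤ χ

_⊆G_ : ∀ {m n} → Graph m → Graph n → Set
H ⊆G G = SubgraphOf H G

-- A one-sided regularity lemma suffices. Call a pair of clusters irregular if it contains a large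
-- subrectangle of density below 1/D, and repeatedly refine the partition by such subrectangles,
-- giving up their edges: the area given up grows by a fixed proportion of n² in every round, so
-- after boundedly many rounds few edges of G lie in irregular pairs (no energy increment is needed).
-- Deleting these edges, the edges at small clusters and the few vertices that lose too much degree
-- leaves a (μ,μ)-approximation of G, which has an almost perfect fractional B_χ-tiling by robustness.
--
-- Each copy of B_χ in the tiling, with a choice of one vertex per part, sends the colours of H to
-- pairwise regular clusters. Since some k-colouring of H has a colour class of proportion at most
-- a/(a + (k−1)b), averaging over suitable permutations of the colours loads the parts of B_χ in the
-- ratio a : b : … : b, so sending each component of H through a random weighted choice fills every
-- cluster only partially on average. Choosing one component at a time so that the sum of squared
-- deviations stays below its mean makes the actual loads close to the expected ones, as components
-- are small. The components are then embedded greedily one after another: a component is tiny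
-- compared with the free part of each cluster, and lower regularity keeps all candidate sets large.

{-# OPTIONS --safe #-}
module Submission where

-- The tiling is taken in the cleaned graph itself and not in a reduced graph on the clusters: a
-- homomorphism of B_χ followed by the partition assigns clusters to parts, and adding up the vertex
-- bound over a cluster limits its load by its size. So clusters may have any sizes, several parts
-- may share a cluster, and a cluster may be regular with itself. Lower bounds on density suffice
-- because a greedy embedding only needs candidate sets that do not shrink too fast. The slack is
-- shared out in units of 1/(4R), where 1/R is at most μ and ρ′. H has at most (1 - 1/R)n vertices;
-- cleaning costs at most n/(4R) vertices and n/(4R) in each remaining degree; the tiling misses at
-- most a 1/(4R) fraction; actual loads exceed expected ones by at most 1/(4R) of a cluster; and
-- 1/(4R) of every used cluster stays free for the greedy step. Densities, weights and means are
-- kept as natural numbers, with denominators multiplied out and negative terms moved across, so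
-- that ring identities settle the arithmetic. Rationals occur only where the hypotheses are
-- translated.

-- Finite sums of natural numbers, indicators and enumeration of subsets

module Summation where

  open import Defs using (count; eqFinB)
  open import Data.Bool using (Bool; true; false; _∧_)
  open import Data.Nat
  open import Data.Nat.Properties
  open import Data.Fin as Fin using (Fin; _↑ˡ_; _↑ʳ_; combine)
  import Data.Fin.Properties as Finₚ
  open import Data.List as List using (List; length; filter)
  open import Data.Product using (∃; _,_)
  open import Function using (_∘_; id)
  open import Relation.Nullary using (yes; no)
  open import Relation.Nullary.Decidable using (dec-true; dec-false; isYes≗does)
  open import Relation.Binary.PropositionalEquality
  import Algebra.Properties.Semiring.Sum +-*-semiring as Sumₚ
  open import Algebra.Properties.CommutativeSemigroup *-commutativeSemigroup public
    using () renaming (x∙yz≈y∙xz to *-swap)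

  ⟦_⟧ : Bool → ℕ
  ⟦ true ⟧ = 1
  ⟦ false ⟧ = 0

  ⟦⟧≤1 : ∀ b → ⟦ b ⟧ ≤ 1
  ⟦⟧≤1 true = ≤-refl
  ⟦⟧≤1 false = z≤n

  ⟦⟧-∧ : ∀ b c → ⟦ b ∧ c ⟧ ≡ ⟦ b ⟧ * ⟦ c ⟧
  ⟦⟧-∧ true true = refl
  ⟦⟧-∧ true false = refl
  ⟦⟧-∧ false c = refl

  eqFinB-refl : ∀ {n} (i : Fin n) → eqFinB i i ≡ true
  eqFinB-refl i = trans (isYes≗does (i Fin.≟ i)) (dec-true (i Fin.≟ i) refl)

  eqFinB⇒≡ : ∀ {n} (i j : Fin n) → eqFinB i j ≡ true → i ≡ j
  eqFinB⇒≡ i j e with i Fin.≟ j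
  ... | yes p = p

  ≢⇒eqFinB : ∀ {n} (i j : Fin n) → i ≢ j → eqFinB i j ≡ false
  ≢⇒eqFinB i j ne = trans (isYes≗does (i Fin.≟ j)) (dec-false (i Fin.≟ j) ne)

  eqFinB-suc : ∀ {n} (i j : Fin n) → eqFinB (Fin.suc i) (Fin.suc j) ≡ eqFinB i j
  eqFinB-suc i j with i Fin.≟ j
  ... | yes _ = refl
  ... | no _ = refl

  opaque
    -- Opacity lets the length implicit in sum be inferred by unification.
    sum : ∀ {n} → (Fin n → ℕ) → ℕ
    sum = Sumₚ.sum

    sum-cong : ∀ {n} {f g : Fin n → ℕ} → (∀ i → f i ≡ g i) → sum f ≡ sum g
    sum-cong h = Sumₚ.sum-cong-≗ h

    sum-+ : ∀ {n} (f g : Fin n → ℕ) → sum (λ i → f i + g i) ≡ sum f + sum g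
    sum-+ = Sumₚ.∑-distrib-+

    sum-comm : ∀ {m n} (f : Fin m → Fin n → ℕ) → sum (λ i → sum (f i)) ≡ sum (λ j → sum (λ i → f i j))
    sum-comm = Sumₚ.∑-comm

    *-sumˡ : ∀ {n} c (f : Fin n → ℕ) → c * sum f ≡ sum (λ i → c * f i)
    *-sumˡ = Sumₚ.*-distribˡ-sum

    *-sumʳ : ∀ {n} c (f : Fin n → ℕ) → sum f * c ≡ sum (λ i → f i * c)
    *-sumʳ = Sumₚ.*-distribʳ-sum

    sum-suc : ∀ {n} (f : Fin (suc n) → ℕ) → sum f ≡ f Fin.zero + sum (f ∘ Fin.suc)
    sum-suc f = refl

    sum-mono-≤ : ∀ {n} {f g : Fin n → ℕ} → (∀ i → f i ≤ g i) → sum f ≤ sum g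
    sum-mono-≤ {zero} h = z≤n
    sum-mono-≤ {suc n} h = +-mono-≤ (h Fin.zero) (sum-mono-≤ (h ∘ Fin.suc))

    sum-const : ∀ n c → sum {n} (λ _ → c) ≡ n * c
    sum-const zero c = refl
    sum-const (suc n) c = cong (c +_) (sum-const n c)

    sum-zero : ∀ {n} {f : Fin n → ℕ} → (∀ i → f i ≡ 0) → sum f ≡ 0
    sum-zero {zero} h = refl
    sum-zero {suc n} h = cong₂ _+_ (h Fin.zero) (sum-zero (h ∘ Fin.suc))

    term≤sum : ∀ {n} (f : Fin n → ℕ) i → f i ≤ sum f
    term≤sum f Fin.zero = m≤m+n _ _
    term≤sum f (Fin.suc i) = ≤-trans (term≤sum (f ∘ Fin.suc) i) (m≤n+m _ _)

    sum<⇒∃< : ∀ {n} (f g : Fin n → ℕ) → sum f < sum g → ∃ λ i → f i < g i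
    sum<⇒∃< {suc n} f g lt with f Fin.zero <? g Fin.zero
    ... | yes p = Fin.zero , p
    ... | no p with sum<⇒∃< (f ∘ Fin.suc) (g ∘ Fin.suc)
                      (≰⇒> λ q → <⇒≱ lt (+-mono-≤ (≮⇒≥ p) q))
    ... | i , q = Fin.suc i , q

    sum-δ : ∀ {n} (j : Fin n) (f : Fin n → ℕ) → sum (λ i → ⟦ eqFinB j i ⟧ * f i) ≡ f j
    sum-δ {suc n} Fin.zero f =
      trans (cong₂ _+_ (trans (cong (λ b → ⟦ b ⟧ * f Fin.zero) (eqFinB-refl {suc n} Fin.zero)) (*-identityˡ _))
                       (sum-zero {n} λ i → refl))
            (+-identityʳ _)
    sum-δ (Fin.suc j) f = trans
      (sum-cong λ i → cong (λ b → ⟦ b ⟧ * f (Fin.suc i)) (eqFinB-suc j i))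
      (sum-δ j (f ∘ Fin.suc))

  sum-δ₁ : ∀ {n} (j : Fin n) → sum (λ i → ⟦ eqFinB j i ⟧) ≡ 1
  sum-δ₁ j = trans (sum-cong λ i → sym (*-identityʳ _)) (sum-δ j (λ _ → 1))

  sum-fibres : ∀ {n M} (p : Fin n → Fin M) (f : Fin n → ℕ) →
    sum f ≡ sum (λ i → sum (λ u → ⟦ eqFinB (p u) i ⟧ * f u))
  sum-fibres p f = trans
    (sum-cong λ u → sym (sum-δ (p u) (λ _ → f u)))
    (sum-comm λ u i → ⟦ eqFinB (p u) i ⟧ * f u)

  opaque
    unfolding sum

    sum-injective≤1 : ∀ {n N} (g : Fin n → Fin N) → (∀ r s → g r ≡ g s → r ≡ s) →
      ∀ P → sum (λ r → ⟦ eqFinB (g r) P ⟧) ≤ 1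
    sum-injective≤1 {zero} g inj P = z≤n
    sum-injective≤1 {suc n} g inj P with g Fin.zero Fin.≟ P
    ... | yes refl = ≤-reflexive (cong suc (sum-zero {n} λ r →
            cong ⟦_⟧ (≢⇒eqFinB _ _ λ e → Finₚ.0≢1+n (sym (inj _ _ e)))))
    ... | no _ = sum-injective≤1 (g ∘ Fin.suc) (λ r s e → Finₚ.suc-injective (inj _ _ e)) P

    sum-++ : ∀ m {n} (f : Fin (m + n) → ℕ) → sum f ≡ sum (λ i → f (i ↑ˡ n)) + sum (λ j → f (m ↑ʳ j))
    sum-++ zero f = refl
    sum-++ (suc m) f = trans (cong (f Fin.zero +_) (sum-++ m (f ∘ Fin.suc))) (sym (+-assoc (f Fin.zero) _ _))

    sum-combine : ∀ m {n} (f : Fin (m * n) → ℕ) → sum f ≡ sum {m} (λ i → sum {n} (λ j → f (combine i j)))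
    sum-combine zero f = refl
    sum-combine (suc m) {n} f = trans (sum-++ n f)
      (cong (sum (λ j → f (j ↑ˡ m * n)) +_) (sum-combine m (λ j → f (n ↑ʳ j))))

    length-filter-tabulate : ∀ {n} {A : Set} (p : A → Bool) (g : Fin n → A) →
      length (filter (λ x → p x Data.Bool.≟ true) (List.tabulate g)) ≡ sum (λ i → ⟦ p (g i) ⟧)
    length-filter-tabulate {zero} p g = refl
    length-filter-tabulate {suc n} p g with p (g Fin.zero)
    ... | true = cong suc (length-filter-tabulate p (g ∘ Fin.suc))
    ... | false = length-filter-tabulate p (g ∘ Fin.suc)

    count≡sum : ∀ {n} (p : Fin n → Bool) → count p ≡ sum (λ i → ⟦ p i ⟧)
    count≡sum p = length-filter-tabulate p id

    -- Recursion on the Boolean keeps `⟦ b ⟧ + s` in the index, so that `enum` has the sum itself as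
    -- its length and needs no casts.
    consIf : ∀ {n s} (b : Bool) → (Fin s → Fin n) → Fin (⟦ b ⟧ + s) → Fin (suc n)
    consIf true g Fin.zero = Fin.zero
    consIf true g (Fin.suc y) = Fin.suc (g y)
    consIf false g y = Fin.suc (g y)

    enum : ∀ {n} (p : Fin n → Bool) → Fin (sum (λ i → ⟦ p i ⟧)) → Fin n
    enum {suc n} p = consIf (p Fin.zero) (enum (p ∘ Fin.suc))

    enum-sat : ∀ {n} (p : Fin n → Bool) x → p (enum p x) ≡ true
    enum-sat {suc n} p = go (p Fin.zero) refl
      where
      go : ∀ b → p Fin.zero ≡ b → ∀ x → p (consIf b (enum (p ∘ Fin.suc)) x) ≡ true
      go true e Fin.zero = e
      go true e (Fin.suc x) = enum-sat (p ∘ Fin.suc) x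
      go false e x = enum-sat (p ∘ Fin.suc) x

    consIf-injective : ∀ {n s} b (g : Fin s → Fin n) → (∀ x y → g x ≡ g y → x ≡ y) →
      ∀ x y → consIf b g x ≡ consIf b g y → x ≡ y
    consIf-injective true g inj Fin.zero Fin.zero e = refl
    consIf-injective true g inj (Fin.suc x) (Fin.suc y) e = cong Fin.suc (inj x y (Finₚ.suc-injective e))
    consIf-injective false g inj x y e = inj x y (Finₚ.suc-injective e)

    enum-injective : ∀ {n} (p : Fin n → Bool) x y → enum p x ≡ enum p y → x ≡ y
    enum-injective {suc n} p = consIf-injective (p Fin.zero) _ (enum-injective (p ∘ Fin.suc))

    sum-consIf : ∀ {n s} b (g : Fin s → Fin n) (f : Fin (suc n) → ℕ) →
      sum (λ x → f (consIf b g x)) ≡ ⟦ b ⟧ * f Fin.zero + sum (λ y → f (Fin.suc (g y)))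
    sum-consIf true g f = cong (_+ sum (λ y → f (Fin.suc (g y)))) (sym (*-identityˡ (f Fin.zero)))
    sum-consIf false g f = refl

    sum-enum : ∀ {n} (p : Fin n → Bool) (f : Fin n → ℕ) →
      sum (λ x → f (enum p x)) ≡ sum (λ u → ⟦ p u ⟧ * f u)
    sum-enum {zero} p f = refl
    sum-enum {suc n} p f = trans (sum-consIf (p Fin.zero) _ f)
      (cong (⟦ p Fin.zero ⟧ * f Fin.zero +_) (sum-enum (p ∘ Fin.suc) (f ∘ Fin.suc)))

-- One-sided regularity lemma

module Regularity where

  open Summation
  open import Defs using (Graph; adj; eqFinB)
  open import Data.Bool using (Bool; true; false; _∧_; _∨_; not)
  open import Data.Nat
  open import Data.Nat.Properties
  open import Data.Nat.Tactic.RingSolver using (solve-∀)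
  open import Data.Fin as Fin using (Fin; remQuot; combine; funToFin; finToFun)
  open import Data.Fin.Properties as Finₚ using (remQuot-combine; finToFun-funToFin)
  open import Data.Fin.Subset using (Subset)
  open import Data.Fin.Subset.Properties using (anySubset?)
  open import Data.Vec as Vec using (lookup; tabulate)
  open import Data.Vec.Properties using (lookup∘tabulate)
  open import Data.Product using (∃; _×_; _,_; proj₁; proj₂)
  open import Data.Empty using (⊥-elim)
  open import Function using (_∘_)
  open import Relation.Nullary using (yes; no; ¬_; Dec)
  open import Relation.Nullary.Decidable using (⌊_⌋; _×-dec_)
  open import Relation.Binary.PropositionalEquality

  sum² : ∀ {n} → (Fin n → Fin n → ℕ) → ℕ
  sum² f = sum λ u → sum λ v → f u v

  sum²-cong : ∀ {n} {f g : Fin n → Fin n → ℕ} → (∀ u v → f u v ≡ g u v) → sum² f ≡ sum² g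
  sum²-cong h = sum-cong λ u → sum-cong (h u)

  sum²-mono : ∀ {n} {f g : Fin n → Fin n → ℕ} → (∀ u v → f u v ≤ g u v) → sum² f ≤ sum² g
  sum²-mono h = sum-mono-≤ λ u → sum-mono-≤ (h u)

  sum²-+ : ∀ {n} (f g : Fin n → Fin n → ℕ) → sum² (λ u v → f u v + g u v) ≡ sum² f + sum² g
  sum²-+ f g = trans (sum-cong λ u → sum-+ (f u) (g u)) (sum-+ _ _)

  *-sum² : ∀ {n} c (f : Fin n → Fin n → ℕ) → c * sum² f ≡ sum² (λ u v → c * f u v)
  *-sum² c f = trans (*-sumˡ c _) (sum-cong λ u → *-sumˡ c (f u))

  sum²-const : ∀ {n} c → sum² {n} (λ _ _ → c) ≡ n * n * c
  sum²-const {n} c = trans (sum-cong {n} λ u → sum-const n c) (trans (sum-const n (n * c)) (sym (*-assoc n n c)))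

  sum*sum : ∀ {m n} (f : Fin m → ℕ) (g : Fin n → ℕ) → sum f * sum g ≡ sum (λ u → sum (λ v → f u * g v))
  sum*sum f g = trans (*-sumʳ (sum g) f) (sum-cong λ u → *-sumˡ (f u) g)

  size : ∀ {n} → (Fin n → Bool) → ℕ
  size A = sum (⟦_⟧ ∘ A)

  sum-cells : ∀ {n M} (p : Fin n → Fin M) (f : Fin n → Fin n → ℕ) →
    sum² f ≡ sum² (λ i j → sum² λ u v → ⟦ eqFinB (p u) i ⟧ * (⟦ eqFinB (p v) j ⟧ * f u v))
  sum-cells p f = begin
    sum² f
      ≡⟨ sum-cong (λ u → sum-fibres p (f u)) ⟩
    sum (λ u → sum (λ j → sum (λ v → g j u v)))
      ≡⟨ sum-fibres p (λ u → sum (λ j → sum (λ v → g j u v))) ⟩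
    sum (λ i → sum (λ u → χ i u * sum (λ j → sum (g j u))))
      ≡⟨ sum-cong (λ i → sum-cong λ u → *-sumˡ (χ i u) _) ⟩
    sum (λ i → sum (λ u → sum (λ j → χ i u * sum (g j u))))
      ≡⟨ sum-cong (λ i → sum-comm λ u j → χ i u * sum (g j u)) ⟩
    sum (λ i → sum (λ j → sum (λ u → χ i u * sum (g j u))))
      ≡⟨ sum-cong (λ i → sum-cong λ j → sum-cong λ u → *-sumˡ (χ i u) (g j u)) ⟩
    sum² (λ i j → sum² λ u v → χ i u * g j u v) ∎
    where
    open ≡-Reasoning
    χ : _ → _ → ℕ
    χ i u = ⟦ eqFinB (p u) i ⟧
    g : _ → _ → _ → ℕ
    g j u v = ⟦ eqFinB (p v) j ⟧ * f u v

  -- Every pair of vertices lies in exactly one pair of cells. The comparison has to be made cell by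
  -- cell because on an irregular pair it holds only in total, not pointwise.
  cellwise : ∀ {n M} (p : Fin n → Fin M) {f g : Fin n → Fin n → ℕ} →
    (∀ i j → sum² (λ u v → ⟦ eqFinB (p u) i ⟧ * (⟦ eqFinB (p v) j ⟧ * f u v))
           ≤ sum² (λ u v → ⟦ eqFinB (p u) i ⟧ * (⟦ eqFinB (p v) j ⟧ * g u v))) →
    sum² f ≤ sum² g
  cellwise p {f} {g} h = subst₂ _≤_ (sym (sum-cells p f)) (sym (sum-cells p g)) (sum²-mono h)

  on-cell : ∀ {n M} (p : Fin n → Fin M) i j {f g : Fin n → Fin n → ℕ} →
    (∀ u v → p u ≡ i → p v ≡ j → f u v ≤ g u v) →
    ∀ u v → ⟦ eqFinB (p u) i ⟧ * (⟦ eqFinB (p v) j ⟧ * f u v) ≤ ⟦ eqFinB (p u) i ⟧ * (⟦ eqFinB (p v) j ⟧ * g u v)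
  on-cell p i j h u v with eqFinB (p u) i in a | eqFinB (p v) j in b
  ... | false | _ = z≤n
  ... | true | false = z≤n
  ... | true | true = +-monoˡ-≤ 0 (+-monoˡ-≤ 0 (h u v (eqFinB⇒≡ _ _ a) (eqFinB⇒≡ _ _ b)))

  -- Refining a partition into M cells by two subsets of each cell for every other cell.
  step : ℕ → ℕ
  step M = M * (2 ^ M * 2 ^ M)

  iterStep : ℕ → ℕ → ℕ
  iterStep zero M = M
  iterStep (suc f) M = iterStep f (step M)

  M≤step : ∀ M → M ≤ step M
  M≤step M = m≤m*n M (2 ^ M * 2 ^ M) ⦃ m*n≢0 (2 ^ M) (2 ^ M) ⦃ m^n≢0 2 M ⦄ ⦃ m^n≢0 2 M ⦄ ⦄

  M≤iterStep : ∀ f M → M ≤ iterStep f M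
  M≤iterStep zero M = ≤-refl
  M≤iterStep (suc f) M = ≤-trans (M≤step M) (M≤iterStep f (step M))

  bit : Bool → Fin 2
  bit false = Fin.zero
  bit true = Fin.suc Fin.zero

  unbit : Fin 2 → Bool
  unbit Fin.zero = false
  unbit (Fin.suc _) = true

  unbit-bit : ∀ b → unbit (bit b) ≡ b
  unbit-bit false = refl
  unbit-bit true = refl

  module _ {M : ℕ} where

    encode : Fin M → (Fin M → Bool) → (Fin M → Bool) → Fin (step M)
    encode i α β = combine i (combine (funToFin (bit ∘ α)) (funToFin (bit ∘ β)))

    cellOf : Fin (step M) → Fin M
    cellOf x = proj₁ (remQuot (2 ^ M * 2 ^ M) x)

    codes : Fin (step M) → Fin (2 ^ M) × Fin (2 ^ M)
    codes x = remQuot (2 ^ M) (proj₂ (remQuot {M} (2 ^ M * 2 ^ M) x))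

    leftBit rightBit : Fin (step M) → Fin M → Bool
    leftBit x j = unbit (finToFun (proj₁ (codes x)) j)
    rightBit x j = unbit (finToFun (proj₂ (codes x)) j)

    module _ (i : Fin M) (α β : Fin M → Bool) where

      cellOf-encode : cellOf (encode i α β) ≡ i
      cellOf-encode = cong proj₁ (remQuot-combine i _)

      codes-encode : codes (encode i α β) ≡ (funToFin (bit ∘ α) , funToFin (bit ∘ β))
      codes-encode = trans (cong (remQuot (2 ^ M) ∘ proj₂) (remQuot-combine i _)) (remQuot-combine (funToFin (bit ∘ α)) _)

      leftBit-encode : ∀ j → leftBit (encode i α β) j ≡ α j
      leftBit-encode j = trans (cong (λ c → unbit (finToFun (proj₁ c) j)) codes-encode)
        (trans (cong unbit (finToFun-funToFin (bit ∘ α) j)) (unbit-bit (α j)))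

      rightBit-encode : ∀ j → rightBit (encode i α β) j ≡ β j
      rightBit-encode j = trans (cong (λ c → unbit (finToFun (proj₂ c) j)) codes-encode)
        (trans (cong unbit (finToFun-funToFin (bit ∘ β) j)) (unbit-bit (β j)))

  module OneSided {n : ℕ} (G : Graph n) (D E : ℕ) where

    edges : (Fin n → Bool) → (Fin n → Bool) → ℕ
    edges A B = sum² λ u v → ⟦ A u ⟧ * (⟦ B v ⟧ * ⟦ adj G u v ⟧)

    Sparse : (V W A B : Fin n → Bool) → Set
    Sparse V W A B = size V ≤ E * size A × size W ≤ E * size B × D * edges A B < size A * size B

    cell : ∀ {M} → (Fin n → Fin M) → Fin M → Fin n → Bool
    cell p i u = eqFinB (p u) i

    cut : ∀ {M} → (Fin n → Fin M) → Fin M → (Fin n → Bool) → Fin n → Bool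
    cut p i A u = cell p i u ∧ A u

    -- The witnesses are vectors rather than Boolean functions, so that exhaustive search over the
    -- finitely many subsets decides irregularity.
    Irregular : ∀ {M} → (Fin n → Fin M) → Fin M → Fin M → Set
    Irregular p i j = ∃ λ (S : Subset n) → ∃ λ (T : Subset n) →
      Sparse (cell p i) (cell p j) (cut p i (lookup S)) (cut p j (lookup T))

    opaque
      irregular? : ∀ {M} (p : Fin n → Fin M) i j → Dec (Irregular p i j)
      irregular? p i j = anySubset? λ S → anySubset? λ T → (_ ≤? _) ×-dec (_ ≤? _) ×-dec (_ <? _)

    ¬irregular⇒dense : ∀ {M} (p : Fin n → Fin M) i j → ¬ Irregular p i j → ∀ (A B : Fin n → Bool) →
      size (cell p i) ≤ E * size (cut p i A) → size (cell p j) ≤ E * size (cut p j B) →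
      size (cut p i A) * size (cut p j B) ≤ D * edges (cut p i A) (cut p j B)
    ¬irregular⇒dense p i j reg A B a b = ≮⇒≥ λ lt → reg (tabulate A , tabulate B ,
      subst (λ s → _ ≤ E * s) (size-≗ (cutA i A)) a , subst (λ s → _ ≤ E * s) (size-≗ (cutA j B)) b ,
      subst₂ (λ x y → D * x < y)
        (sum²-cong λ u v → cong₂ (λ x y → ⟦ x ⟧ * (⟦ y ⟧ * ⟦ adj G u v ⟧)) (cutA i A u) (cutA j B v))
        (cong₂ _*_ (size-≗ (cutA i A)) (size-≗ (cutA j B))) lt)
      where
      cutA : ∀ i A u → cut p i A u ≡ cut p i (lookup (tabulate A)) u
      cutA i A u = cong (cell p i u ∧_) (sym (lookup∘tabulate A u))
      size-≗ : ∀ {A B : Fin n → Bool} → (∀ u → A u ≡ B u) → size A ≡ size B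
      size-≗ h = sum-cong (cong ⟦_⟧ ∘ h)

    edgesIn : (Fin n → Fin n → Bool) → ℕ
    edgesIn R = sum² λ u v → ⟦ R u v ⟧ * ⟦ adj G u v ⟧

    area : (Fin n → Fin n → Bool) → ℕ
    area R = sum² λ u v → ⟦ R u v ⟧

    area≤n² : ∀ R → area R ≤ n * n
    area≤n² R = ≤-trans (sum²-mono λ u v → ⟦⟧≤1 (R u v)) (≤-reflexive (trans (sum²-const 1) (*-identityʳ _)))

    pull : ∀ {M} → (Fin n → Fin M) → (Fin M → Fin M → Bool) → Fin n → Fin n → Bool
    pull p d u v = d (p u) (p v)

    irregularPairs : ∀ {M} → (Fin n → Fin M) → Fin n → Fin n → Bool
    irregularPairs p = pull p λ i j → ⌊ irregular? p i j ⌋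

    module Refine {M : ℕ} (p : Fin n → Fin M) (d : Fin M → Fin M → Bool) where

      -- d marks the pairs of cells already declared sparse in an earlier round; their edges are given up.
      data Status (i j : Fin M) : (α β : Fin n → Bool) → Set where
        declared : d i j ≡ true → Status i j (λ _ → false) (λ _ → false)
        regular : d i j ≡ false → ⌊ irregular? p i j ⌋ ≡ false → Status i j (λ _ → false) (λ _ → false)
        irregular : ∀ {α β} → d i j ≡ false → ⌊ irregular? p i j ⌋ ≡ true →
          Sparse (cell p i) (cell p j) (cut p i α) (cut p j β) → Status i j α β

      opaque
        witness : ∀ i j → ∃ λ α → ∃ λ β → Status i j α β
        witness i j with d i j in deq | irregular? p i j in ieq
        ... | true | _ = _ , _ , declared deq
        ... | false | no _ = _ , _ , regular deq (cong ⌊_⌋ ieq)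
        ... | false | yes (S , T , sp) = _ , _ , irregular deq (cong ⌊_⌋ ieq) sp

      α β : Fin M → Fin M → Fin n → Bool
      α i j = proj₁ (witness i j)
      β i j = proj₁ (proj₂ (witness i j))

      status : ∀ i j → Status i j (α i j) (β i j)
      status i j = proj₂ (proj₂ (witness i j))

      p′ : Fin n → Fin (step M)
      p′ u = encode (p u) (λ j → α (p u) j u) (λ i → β i (p u) u)

      -- A declaration must depend on the new cells alone. The bits stored in the two codes tell
      -- whether a pair of new cells lies inside the witness rectangle of its pair of old cells.
      d′ : Fin (step M) → Fin (step M) → Bool
      d′ x y = d (cellOf {M} x) (cellOf {M} y) ∨ (leftBit {M} x (cellOf {M} y) ∧ rightBit {M} y (cellOf {M} x))

      new : Fin n → Fin n → Bool
      new u v = d (p u) (p v) ∨ (α (p u) (p v) u ∧ β (p u) (p v) v)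

      pull-d′ : ∀ u v → pull p′ d′ u v ≡ new u v
      pull-d′ u v = cong₂ _∨_ (cong₂ d cu cv) (cong₂ _∧_
        (trans (cong (leftBit {M} (p′ u)) cv) (leftBit-encode (p u) _ _ (p v)))
        (trans (cong (rightBit {M} (p′ v)) cu) (rightBit-encode (p v) _ _ (p u))))
        where
        cu : cellOf {M} (p′ u) ≡ p u
        cu = cellOf-encode (p u) _ _
        cv : cellOf {M} (p′ v) ≡ p v
        cv = cellOf-encode (p v) _ _

      new-in : ∀ {i j u v} → p u ≡ i → p v ≡ j → new u v ≡ d i j ∨ (α i j u ∧ β i j v)
      new-in refl refl = refl

      open ≤-Reasoning

      module _ {i j : Fin M} where

        χ : Fin n → Fin n → ℕ → ℕ
        χ u v x = ⟦ cell p i u ⟧ * (⟦ cell p j v ⟧ * x)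

        rect : ∀ (A B : Fin n → Bool) (w : Fin n → Fin n → ℕ) →
          sum² (λ u v → χ u v (⟦ A u ∧ B v ⟧ * w u v)) ≡ sum² (λ u v → ⟦ cut p i A u ⟧ * (⟦ cut p j B v ⟧ * w u v))
        rect A B w = sum²-cong λ u v → lem (cell p i u) (cell p j v) (A u) (B v) (w u v)
          where
          lem : ∀ a b c d w → ⟦ a ⟧ * (⟦ b ⟧ * (⟦ c ∧ d ⟧ * w)) ≡ ⟦ a ∧ c ⟧ * (⟦ b ∧ d ⟧ * w)
          lem a b c d w rewrite ⟦⟧-∧ c d | ⟦⟧-∧ a c | ⟦⟧-∧ b d = ring ⟦ a ⟧ ⟦ b ⟧ ⟦ c ⟧ ⟦ d ⟧ w
            where
            ring : ∀ a b c d w → a * (b * (c * d * w)) ≡ a * c * (b * d * w)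
            ring = solve-∀

        rectArea : ∀ A B → sum² (λ u v → χ u v ⟦ A u ∧ B v ⟧) ≡ size (cut p i A) * size (cut p j B)
        rectArea A B = trans (sum²-cong λ u v → cong (χ u v) (sym (*-identityʳ ⟦ A u ∧ B v ⟧)))
          (trans (rect A B (λ _ _ → 1))
          (trans (sum²-cong λ u v → cong (⟦ cut p i A u ⟧ *_) (*-identityʳ ⟦ cut p j B v ⟧))
                 (sym (sum*sum (⟦_⟧ ∘ cut p i A) (⟦_⟧ ∘ cut p j B)))))

        χ-sum² : ∀ c (f : Fin n → Fin n → ℕ) → sum² (λ u v → χ u v (c * f u v)) ≡ c * sum² (λ u v → χ u v (f u v))
        χ-sum² c f = trans (sum²-cong λ u v → ring ⟦ cell p i u ⟧ ⟦ cell p j v ⟧ c (f u v)) (sym (*-sum² c _))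
          where
          ring : ∀ a b c x → a * (b * (c * x)) ≡ c * (a * (b * x))
          ring = solve-∀

      -- Without subtraction: the newly declared part has edge density at most 1/`D`. Pairs that are
      -- `declared` or `regular` contribute equally to both sides; an `irregular` pair gains exactly
      -- its witness rectangle, which is sparse.
      density-step : D * edgesIn new + area (pull p d) ≤ area new + D * edgesIn (pull p d)
      density-step = begin
        D * edgesIn new + area (pull p d)
          ≡⟨ cong (_+ area (pull p d)) (*-sum² D _) ⟩
        sum² (λ u v → D * (⟦ new u v ⟧ * ⟦ adj G u v ⟧)) + area (pull p d)
          ≡⟨ sum²-+ _ _ ⟨
        sum² (λ u v → D * (⟦ new u v ⟧ * ⟦ adj G u v ⟧) + ⟦ pull p d u v ⟧)
          ≤⟨ cellwise p (λ i j → onCell i j (status i j)) ⟩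
        sum² (λ u v → ⟦ new u v ⟧ + D * (⟦ pull p d u v ⟧ * ⟦ adj G u v ⟧))
          ≡⟨ sum²-+ _ _ ⟩
        area new + sum² (λ u v → D * (⟦ pull p d u v ⟧ * ⟦ adj G u v ⟧))
          ≡⟨ cong (area new +_) (*-sum² D _) ⟨
        area new + D * edgesIn (pull p d) ∎
        where
        lhs rhs : Fin n → Fin n → ℕ
        lhs u v = D * (⟦ new u v ⟧ * ⟦ adj G u v ⟧) + ⟦ pull p d u v ⟧
        rhs u v = ⟦ new u v ⟧ + D * (⟦ pull p d u v ⟧ * ⟦ adj G u v ⟧)
        onCell : ∀ i j → Status i j (α i j) (β i j) →
          sum² (λ u v → χ {i} {j} u v (lhs u v)) ≤ sum² (λ u v → χ {i} {j} u v (rhs u v))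
        onCell i j st = go (α i j) (β i j) (λ u v pu pv → new-in {i} {j} {u} {v} pu pv) st
          where
          go : ∀ A B → (∀ u v → p u ≡ i → p v ≡ j → new u v ≡ d i j ∨ (A u ∧ B v)) → Status i j A B →
            sum² (λ u v → χ {i} {j} u v (lhs u v)) ≤ sum² (λ u v → χ {i} {j} u v (rhs u v))
          go A B eq (declared t) = sum²-mono (on-cell p i j λ u v pu pv → ptwise (trans (eq u v pu pv) (cong (_∨ _) t)) (trans (cong₂ d pu pv) t))
            where
            ptwise : ∀ {x y w} → x ≡ true → y ≡ true → D * (⟦ x ⟧ * w) + ⟦ y ⟧ ≤ ⟦ x ⟧ + D * (⟦ y ⟧ * w)
            ptwise refl refl = ≤-reflexive (+-comm _ 1)
          go A B eq (regular f _) = sum²-mono (on-cell p i j λ u v pu pv → ptwise (trans (eq u v pu pv) (cong (_∨ _) f)) (trans (cong₂ d pu pv) f))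
            where
            ptwise : ∀ {x y w} → x ≡ false → y ≡ false → D * (⟦ x ⟧ * w) + ⟦ y ⟧ ≤ ⟦ x ⟧ + D * (⟦ y ⟧ * w)
            ptwise refl refl = ≤-reflexive (+-identityʳ _)
          go A B eq (irregular f _ (_ , _ , sp)) = begin
            sum² (λ u v → χ {i} {j} u v (lhs u v))
              ≤⟨ sum²-mono (on-cell p i j λ u v pu pv → left (trans (eq u v pu pv) (cong (_∨ (A u ∧ B v)) f)) (trans (cong₂ d pu pv) f)) ⟩
            sum² (λ u v → χ {i} {j} u v (D * (⟦ A u ∧ B v ⟧ * ⟦ adj G u v ⟧)))
              ≡⟨ χ-sum² {i} {j} D _ ⟩
            D * sum² (λ u v → χ {i} {j} u v (⟦ A u ∧ B v ⟧ * ⟦ adj G u v ⟧))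
              ≡⟨ cong (D *_) (rect {i} {j} A B (λ u v → ⟦ adj G u v ⟧)) ⟩
            D * edges (cut p i A) (cut p j B)
              ≤⟨ <⇒≤ sp ⟩
            size (cut p i A) * size (cut p j B)
              ≡⟨ rectArea {i} {j} A B ⟨
            sum² (λ u v → χ {i} {j} u v ⟦ A u ∧ B v ⟧)
              ≤⟨ sum²-mono (on-cell p i j λ u v pu pv → right (trans (eq u v pu pv) (cong (_∨ (A u ∧ B v)) f))) ⟩
            sum² (λ u v → χ {i} {j} u v (rhs u v)) ∎
            where
            left : ∀ {x y z w} → x ≡ z → y ≡ false → D * (⟦ x ⟧ * w) + ⟦ y ⟧ ≤ D * (⟦ z ⟧ * w)
            left refl refl = ≤-reflexive (+-identityʳ _)
            right : ∀ {x z w} → x ≡ z → ⟦ z ⟧ ≤ ⟦ x ⟧ + w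
            right refl = m≤m+n _ _

      undeclared : Fin n → Fin n → Bool
      undeclared = pull p λ i j → not (d i j) ∧ ⌊ irregular? p i j ⌋

      -- Both sides of a witness rectangle have at least a 1/`E` share of their cells, so declaring
      -- it gains at least a 1/`E`² share of every irregular pair that was still undeclared.
      area-step : E * E * area (pull p d) + area undeclared ≤ E * E * area new
      area-step = begin
        E * E * area (pull p d) + area undeclared
          ≡⟨ cong (_+ area undeclared) (*-sum² (E * E) _) ⟩
        sum² (λ u v → E * E * ⟦ pull p d u v ⟧) + area undeclared
          ≡⟨ sum²-+ _ _ ⟨
        sum² lhs
          ≤⟨ cellwise p (λ i j → onCell i j (status i j)) ⟩
        sum² rhs
          ≡⟨ *-sum² (E * E) _ ⟨
        E * E * area new ∎
        where
        lhs rhs : Fin n → Fin n → ℕ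
        lhs u v = E * E * ⟦ pull p d u v ⟧ + ⟦ undeclared u v ⟧
        rhs u v = E * E * ⟦ new u v ⟧
        onCell : ∀ i j → Status i j (α i j) (β i j) →
          sum² (λ u v → χ {i} {j} u v (lhs u v)) ≤ sum² (λ u v → χ {i} {j} u v (rhs u v))
        onCell i j st = go (α i j) (β i j) (λ u v pu pv → new-in {i} {j} {u} {v} pu pv) st
          where
          und : ∀ {u v} x y → d i j ≡ x → ⌊ irregular? p i j ⌋ ≡ y → p u ≡ i → p v ≡ j → undeclared u v ≡ not x ∧ y
          und x y refl refl refl refl = refl
          go : ∀ A B → (∀ u v → p u ≡ i → p v ≡ j → new u v ≡ d i j ∨ (A u ∧ B v)) → Status i j A B →
            sum² (λ u v → χ {i} {j} u v (lhs u v)) ≤ sum² (λ u v → χ {i} {j} u v (rhs u v))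
          go A B eq (declared t) = sum²-mono (on-cell p i j λ u v pu pv →
              ptwise (trans (eq u v pu pv) (cong (_∨ _) t)) (trans (cong₂ d pu pv) t) (und true _ t refl pu pv))
            where
            ptwise : ∀ {x y z} → x ≡ true → y ≡ true → z ≡ false → E * E * ⟦ y ⟧ + ⟦ z ⟧ ≤ E * E * ⟦ x ⟧
            ptwise refl refl refl = ≤-reflexive (+-identityʳ _)
          go A B eq (regular f r) = sum²-mono (on-cell p i j λ u v pu pv →
              ptwise (trans (eq u v pu pv) (cong (_∨ _) f)) (trans (cong₂ d pu pv) f) (und false false f r pu pv))
            where
            ptwise : ∀ {x y z} → x ≡ false → y ≡ false → z ≡ false → E * E * ⟦ y ⟧ + ⟦ z ⟧ ≤ E * E * ⟦ x ⟧
            ptwise refl refl refl = ≤-reflexive (+-identityʳ _)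
          go A B eq (irregular f r (a , b , _)) = begin
            sum² (λ u v → χ {i} {j} u v (lhs u v))
              ≤⟨ sum²-mono (on-cell p i j λ u v pu pv → left (undeclared u v) (trans (cong₂ d pu pv) f)) ⟩
            sum² (λ u v → χ {i} {j} u v 1)
              ≡⟨ sum²-cong (λ u v → cong (⟦ cell p i u ⟧ *_) (*-identityʳ _)) ⟩
            sum² (λ u v → ⟦ cell p i u ⟧ * ⟦ cell p j v ⟧)
              ≡⟨ sum*sum (⟦_⟧ ∘ cell p i) (⟦_⟧ ∘ cell p j) ⟨
            size (cell p i) * size (cell p j)
              ≤⟨ *-mono-≤ a b ⟩
            E * size (cut p i A) * (E * size (cut p j B))
              ≡⟨ ring E (size (cut p i A)) (size (cut p j B)) ⟩
            E * E * (size (cut p i A) * size (cut p j B))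
              ≡⟨ cong (E * E *_) (rectArea {i} {j} A B) ⟨
            E * E * sum² (λ u v → χ {i} {j} u v ⟦ A u ∧ B v ⟧)
              ≡⟨ χ-sum² {i} {j} (E * E) _ ⟨
            sum² (λ u v → χ {i} {j} u v (E * E * ⟦ A u ∧ B v ⟧))
              ≤⟨ sum²-mono (on-cell p i j λ u v pu pv → ≤-reflexive (cong (λ b → E * E * ⟦ b ⟧) (sym (trans (eq u v pu pv) (cong (_∨ (A u ∧ B v)) f))))) ⟩
            sum² (λ u v → χ {i} {j} u v (rhs u v)) ∎
            where
            ring : ∀ e x y → e * x * (e * y) ≡ e * e * (x * y)
            ring = solve-∀
            left : ∀ {y} z → y ≡ false → E * E * ⟦ y ⟧ + ⟦ z ⟧ ≤ 1
            left z refl = ≤-trans (≤-reflexive (cong (_+ ⟦ z ⟧) (*-zeroʳ (E * E)))) (⟦⟧≤1 z)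

    FewIrregular : ℕ → Set
    FewIrregular Mmax = ∃ λ M → M ≤ Mmax × ∃ λ (p : Fin n → Fin M) → D * edgesIn (irregularPairs p) ≤ 2 * (n * n)

    -- The declared cells d carry edge density at most 1/D; their area grows by n²/(DE²) with every refinement.
    refine : 1 ≤ n → ∀ fuel {M} (p : Fin n → Fin M) (d : Fin M → Fin M → Bool) →
      D * edgesIn (pull p d) ≤ area (pull p d) →
      suc (D * (E * E)) * (n * n) ≤ D * (E * E) * area (pull p d) + fuel * (n * n) →
      FewIrregular (iterStep fuel M)
    -- With the fuel used up, the invariant would make the declared area exceed n².
    refine 1≤n zero p d sparse big = ⊥-elim (<⇒≱ (*-mono-≤ 1≤n 1≤n)
      (+-cancelʳ-≤ (D * (E * E) * (n * n)) (n * n) 0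
        (≤-trans big (≤-trans (≤-reflexive (+-identityʳ _)) (*-monoʳ-≤ (D * (E * E)) (area≤n² _))))))
    -- Refinement stops once the undeclared irregular pairs cover at most n²/`D`. An edge in an
    -- irregular pair is then either declared, and there are at most n²/`D` of these by sparsity, or
    -- undeclared; hence the factor 2 in `FewIrregular`.
    refine 1≤n (suc fuel) {M} p d sparse big with D * area (Refine.undeclared p d) ≤? n * n
    ... | yes few = M , M≤iterStep (suc fuel) M , p , (begin
      D * edgesIn (irregularPairs p)
        ≤⟨ *-monoʳ-≤ D (sum²-mono λ u v → lem (d (p u) (p v)) ⌊ irregular? p (p u) (p v) ⌋ (adj G u v)) ⟩
      D * sum² (λ u v → ⟦ pull p d u v ⟧ * ⟦ adj G u v ⟧ + ⟦ undeclared u v ⟧)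
        ≡⟨ cong (D *_) (sum²-+ _ _) ⟩
      D * (edgesIn (pull p d) + area undeclared)
        ≡⟨ *-distribˡ-+ D _ _ ⟩
      D * edgesIn (pull p d) + D * area undeclared
        ≤⟨ +-mono-≤ (≤-trans sparse (area≤n² _)) few ⟩
      n * n + n * n
        ≡⟨ cong (n * n +_) (+-identityʳ _) ⟨
      2 * (n * n) ∎)
      where
      open Refine p d
      open ≤-Reasoning
      lem : ∀ x y z → ⟦ y ⟧ * ⟦ z ⟧ ≤ ⟦ x ⟧ * ⟦ z ⟧ + ⟦ not x ∧ y ⟧
      lem true false z = z≤n
      lem true true z = m≤m+n _ _
      lem false false z = z≤n
      lem false true false = z≤n
      lem false true true = ≤-refl
    ... | no many = refine 1≤n fuel p′ d′ sparse′ big′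
      where
      open Refine p d
      open ≤-Reasoning
      area-d′ : area (pull p′ d′) ≡ area new
      area-d′ = sum²-cong λ u v → cong ⟦_⟧ (pull-d′ u v)
      edges-d′ : edgesIn (pull p′ d′) ≡ edgesIn new
      edges-d′ = sum²-cong λ u v → cong (λ b → ⟦ b ⟧ * ⟦ adj G u v ⟧) (pull-d′ u v)
      sparse′ : D * edgesIn (pull p′ d′) ≤ area (pull p′ d′)
      sparse′ = subst₂ (λ x y → D * x ≤ y) (sym edges-d′) (sym area-d′)
        (+-cancelʳ-≤ (area (pull p d)) _ _ (≤-trans density-step (+-monoʳ-≤ (area new) sparse)))
      big′ : suc (D * (E * E)) * (n * n) ≤ D * (E * E) * area (pull p′ d′) + fuel * (n * n)
      big′ = begin
        suc (D * (E * E)) * (n * n)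
          ≤⟨ big ⟩
        D * (E * E) * area (pull p d) + (n * n + fuel * (n * n))
          ≤⟨ +-monoʳ-≤ (D * (E * E) * area (pull p d)) (+-monoˡ-≤ (fuel * (n * n)) (<⇒≤ (≰⇒> many))) ⟩
        D * (E * E) * area (pull p d) + (D * area undeclared + fuel * (n * n))
          ≡⟨ ring D (E * E) (area (pull p d)) (area undeclared) (fuel * (n * n)) ⟩
        D * (E * E * area (pull p d) + area undeclared) + fuel * (n * n)
          ≤⟨ +-monoˡ-≤ (fuel * (n * n)) (*-monoʳ-≤ D area-step) ⟩
        D * (E * E * area new) + fuel * (n * n)
          ≡⟨ cong (_+ fuel * (n * n)) (*-assoc D (E * E) (area new)) ⟨
        D * (E * E) * area new + fuel * (n * n)
          ≡⟨ cong (λ x → D * (E * E) * x + fuel * (n * n)) area-d′ ⟨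
        D * (E * E) * area (pull p′ d′) + fuel * (n * n) ∎
        where
        ring : ∀ D E a u f → D * E * a + (D * u + f) ≡ D * (E * a + u) + f
        ring = solve-∀

    fewIrregular : 1 ≤ n → FewIrregular (iterStep (suc (D * (E * E))) 1)
    fewIrregular 1≤n = refine 1≤n (suc (D * (E * E))) {1} (λ _ → Fin.zero) (λ _ _ → false)
      (≤-trans (≤-reflexive (trans (cong (D *_) none) (*-zeroʳ D))) z≤n) (m≤n+m (suc (D * (E * E)) * (n * n)) (D * (E * E) * area (λ _ _ → false)))
      where
      none : edgesIn (λ _ _ → false) ≡ 0
      none = sum-zero {n} λ u → sum-zero {n} λ v → refl

-- Deleting irregular pairs, small clusters and damaged vertices

module Cleaning where

  open Summation
  open Regularity
  open import Defs using (Graph; adj; deg; SubgraphOf; emb)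
  open import Data.Bool using (Bool; true; false; _∧_; not)
  open import Data.Bool.Properties using (∧-comm)
  open import Data.Nat
  open import Data.Nat.Properties
  open import Data.Nat.Tactic.RingSolver using (solve-∀)
  open import Data.Fin as Fin using (Fin)
  open import Data.Product using (_×_; _,_; proj₁; proj₂)
  open import Relation.Nullary using (yes; no; ¬_; Dec)
  open import Relation.Nullary.Decidable using (⌊_⌋)
  open import Relation.Binary.PropositionalEquality

  ⌊⌋-true : ∀ {P : Set} (d : Dec P) → ⌊ d ⌋ ≡ true → P
  ⌊⌋-true (yes p) _ = p

  ⌊⌋-false : ∀ {P : Set} (d : Dec P) → ⌊ d ⌋ ≡ false → ¬ P
  ⌊⌋-false (no p) _ = p

  ∧-true : ∀ a b → a ∧ b ≡ true → a ≡ true × b ≡ true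
  ∧-true true true e = refl , refl

  not-true : ∀ a → not a ≡ true → a ≡ false
  not-true false e = refl

  module Clean {n : ℕ} (G : Graph n) (D E Mmax R : ℕ) (D≡ : D ≡ 48 * R * (8 * R)) (1≤R : 1 ≤ R) (1≤n : 1 ≤ n)
    {M : ℕ} (M≤ : M ≤ Mmax) (p : Fin n → Fin M)
    (few : D * OneSided.edgesIn G D E (OneSided.irregularPairs G D E p) ≤ 2 * (n * n)) where

    open OneSided G D E

    -- The threshold refers to `Mmax` and not to the actual number `M` of cells, since the bound on
    -- component sizes must be fixed before the partition is known.
    Big : Fin M → Set
    Big i = n ≤ Mmax * (D * size (cell p i))

    irr : Fin M → Fin M → Bool
    irr i j = ⌊ irregular? p i j ⌋

    big : Fin M → Bool
    big i = ⌊ n ≤? Mmax * (D * size (cell p i)) ⌋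

    -- Irregularity is excluded in both orders, which makes symmetry immediate; `reduced` has to be
    -- an undirected graph.
    good : Fin M → Fin M → Bool
    good i j = (not (irr i j) ∧ not (irr j i)) ∧ (big i ∧ big j)

    Good : Fin M → Fin M → Set
    Good i j = ¬ Irregular p i j × ¬ Irregular p j i × Big i × Big j

    good⇒Good : ∀ i j → good i j ≡ true → Good i j
    good⇒Good i j e with ∧-true _ _ e
    ... | a , b with ∧-true _ _ a | ∧-true _ _ b
    ... | c , c′ | d , d′ = ⌊⌋-false (irregular? p i j) (not-true _ c) , ⌊⌋-false (irregular? p j i) (not-true _ c′) ,
                             ⌊⌋-true (_ ≤? _) d , ⌊⌋-true (_ ≤? _) d′

    good-sym : ∀ i j → good i j ≡ good j i
    good-sym i j = cong₂ _∧_ (∧-comm (not (irr i j)) _) (∧-comm (big i) _)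

    dropped : Fin n → Fin n → Bool
    dropped u v = adj G u v ∧ not (good (p u) (p v))

    loss : Fin n → ℕ
    loss u = sum λ v → ⟦ dropped u v ⟧

    small : Fin n → ℕ
    small u = ⟦ not (big (p u)) ⟧

    open ≤-Reasoning

    1≤Mmax : 1 ≤ Mmax
    1≤Mmax = ≤-trans (nonempty M (p (Fin.fromℕ< 1≤n))) M≤
      where
      nonempty : ∀ M → Fin M → 1 ≤ M
      nonempty (suc _) _ = s≤s z≤n

    few-small : D * sum small ≤ n
    few-small = *-cancelˡ-≤ Mmax ⦃ >-nonZero 1≤Mmax ⦄ (begin
      Mmax * (D * sum small)
        ≡⟨ cong (λ x → Mmax * (D * x)) (sum-fibres p small) ⟩
      Mmax * (D * sum (λ i → sum λ u → ⟦ cell p i u ⟧ * small u))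
        ≡⟨ cong (Mmax *_) (*-sumˡ D _) ⟩
      Mmax * sum (λ i → D * sum λ u → ⟦ cell p i u ⟧ * small u)
        ≡⟨ *-sumˡ Mmax _ ⟩
      sum (λ i → Mmax * (D * sum λ u → ⟦ cell p i u ⟧ * small u))
        ≤⟨ sum-mono-≤ onCell ⟩
      sum (λ (_ : Fin M) → n)
        ≡⟨ sum-const M n ⟩
      M * n
        ≤⟨ *-monoˡ-≤ n M≤ ⟩
      Mmax * n ∎)
      where
      inCell : ∀ i u → ⟦ cell p i u ⟧ * small u ≡ ⟦ not (big i) ⟧ * ⟦ cell p i u ⟧
      inCell i u with p u Fin.≟ i
      ... | yes refl = trans (*-identityˡ _) (sym (*-identityʳ _))
      ... | no _ = sym (*-zeroʳ ⟦ not (big i) ⟧)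
      onCell : ∀ i → Mmax * (D * sum (λ u → ⟦ cell p i u ⟧ * small u)) ≤ n
      onCell i = ≤-trans (≤-reflexive (cong (λ x → Mmax * (D * x))
          (trans (sum-cong (inCell i)) (sym (*-sumˡ ⟦ not (big i) ⟧ _))))) (go (n ≤? Mmax * (D * size (cell p i))))
        where
        go : (d : Dec (Big i)) → Mmax * (D * (⟦ not ⌊ d ⌋ ⟧ * size (cell p i))) ≤ n
        go (yes _) = ≤-trans (≤-reflexive (trans (cong (Mmax *_) (*-zeroʳ D)) (*-zeroʳ Mmax))) z≤n
        go (no q) = ≤-trans (≤-reflexive (cong (λ x → Mmax * (D * x)) (*-identityˡ _))) (<⇒≤ (≰⇒> q))

    -- The 6 is 2 + 2 for edges in irregular pairs, read in both orders, and 1 + 1 for pairs whose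
    -- first or second vertex lies in a small cell.
    few-dropped : D * sum loss ≤ 6 * (n * n)
    few-dropped = begin
      D * sum² (λ u v → ⟦ dropped u v ⟧)
        ≤⟨ *-monoʳ-≤ D (sum²-mono λ u v → bound u v) ⟩
      D * sum² (λ u v → (I u v + I v u) + (small u + small v))
        ≡⟨ cong (D *_) (trans (sum²-+ _ _) (cong₂ _+_ (sum²-+ _ _) (sum²-+ _ _))) ⟩
      D * ((sum² I + sum² (λ u v → I v u)) + (sum² (λ u v → small u) + sum² (λ u v → small v)))
        ≡⟨ cong (D *_) (cong₂ _+_ (cong (sum² I +_) (sum-comm (λ u v → I v u)))
             (cong₂ _+_ (trans (sum-cong λ u → sum-const n (small u)) (sym (*-sumˡ n small))) (sum-const n (sum small)))) ⟩
      D * ((sum² I + sum² I) + (n * sum small + n * sum small))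
        ≡⟨ ring D (sum² I) n (sum small) ⟩
      2 * (D * sum² I) + 2 * (n * (D * sum small))
        ≤⟨ +-mono-≤ (*-monoʳ-≤ 2 few) (*-monoʳ-≤ 2 (*-monoʳ-≤ n few-small)) ⟩
      2 * (2 * (n * n)) + 2 * (n * n)
        ≡⟨ ring′ (n * n) ⟩
      6 * (n * n) ∎
      where
      I : Fin n → Fin n → ℕ
      I u v = ⟦ irr (p u) (p v) ⟧ * ⟦ adj G u v ⟧
      ring : ∀ d i n s → d * ((i + i) + (n * s + n * s)) ≡ 2 * (d * i) + 2 * (n * (d * s))
      ring = solve-∀
      ring′ : ∀ x → 2 * (2 * x) + 2 * x ≡ 6 * x
      ring′ = solve-∀
      bool : ∀ a b c d e → ⟦ a ∧ not ((not b ∧ not c) ∧ (d ∧ e)) ⟧ ≤ (⟦ b ⟧ * ⟦ a ⟧ + ⟦ c ⟧ * ⟦ a ⟧) + (⟦ not d ⟧ + ⟦ not e ⟧)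
      bool false b c d e = z≤n
      bool true true c d e = s≤s z≤n
      bool true false true d e = s≤s z≤n
      bool true false false false e = s≤s z≤n
      bool true false false true false = s≤s z≤n
      bool true false false true true = z≤n
      bound : ∀ u v → ⟦ dropped u v ⟧ ≤ (I u v + I v u) + (small u + small v)
      bound u v = subst (λ b → ⟦ dropped u v ⟧ ≤ (I u v + ⟦ irr (p v) (p u) ⟧ * ⟦ b ⟧) + (small u + small v))
        (Graph.sym G u v) (bool (adj G u v) (irr (p u) (p v)) (irr (p v) (p u)) (big (p u)) (big (p v)))

    keep : Fin n → Bool
    keep u = ⌊ 8 * R * loss u ≤? n ⌋

    bad : ℕ
    bad = sum λ u → ⟦ not (keep u) ⟧

    -- Markov's inequality: the total loss is at most 6n²/`D`, and `D` is 6(8`R`)², so at most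
    -- n/(8`R`) vertices lose more than n/(8`R`). The value of `D` is chosen for this.
    few-bad : 8 * R * bad ≤ n
    few-bad = *-cancelˡ-≤ (48 * R * n) ⦃ m*n≢0 (48 * R) n ⦃ m*n≢0 48 R ⦃ _ ⦄ ⦃ >-nonZero 1≤R ⦄ ⦄ ⦃ >-nonZero 1≤n ⦄ ⦄ (begin
      48 * R * n * (8 * R * bad)
        ≡⟨ ring R n bad ⟩
      48 * R * (8 * R) * (n * bad)
        ≡⟨ cong (_* (n * bad)) D≡ ⟨
      D * (n * bad)
        ≡⟨ cong (D *_) (*-sumˡ n _) ⟩
      D * sum (λ u → n * ⟦ not (keep u) ⟧)
        ≤⟨ *-monoʳ-≤ D (sum-mono-≤ λ u → markov u (8 * R * loss u ≤? n)) ⟩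
      D * sum (λ u → 8 * R * loss u)
        ≡⟨ cong (D *_) (*-sumˡ (8 * R) loss) ⟨
      D * (8 * R * sum loss)
        ≡⟨ ring′ D R (sum loss) ⟩
      8 * R * (D * sum loss)
        ≤⟨ *-monoʳ-≤ (8 * R) few-dropped ⟩
      8 * R * (6 * (n * n))
        ≡⟨ ring″ R n ⟩
      48 * R * n * n ∎)
      where
      ring : ∀ R n b → 48 * R * n * (8 * R * b) ≡ 48 * R * (8 * R) * (n * b)
      ring = solve-∀
      ring′ : ∀ D R s → D * (8 * R * s) ≡ 8 * R * (D * s)
      ring′ = solve-∀
      ring″ : ∀ R n → 8 * R * (6 * (n * n)) ≡ 48 * R * n * n
      ring″ = solve-∀
      markov : ∀ u → (d : Dec (8 * R * loss u ≤ n)) → n * ⟦ not ⌊ d ⌋ ⟧ ≤ 8 * R * loss u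
      markov u (yes _) = ≤-trans (≤-reflexive (*-zeroʳ n)) z≤n
      markov u (no q) = ≤-trans (≤-reflexive (*-identityʳ n)) (<⇒≤ (≰⇒> q))

    kept : ℕ
    kept = sum λ u → ⟦ keep u ⟧

    reduced : Graph kept
    reduced = record
      { adj = λ x y → adj G (enum keep x) (enum keep y) ∧ good (p (enum keep x)) (p (enum keep y))
      ; sym = λ x y → cong₂ _∧_ (Graph.sym G _ _) (good-sym (p (enum keep x)) (p (enum keep y)))
      ; irrefl = λ x → cong (_∧ good (p (enum keep x)) (p (enum keep x))) (Graph.irrefl G _)
      }

    reduced⊆ : SubgraphOf reduced G
    reduced⊆ = record
      { emb = enum keep
      ; emb-inj = λ {x} {y} → enum-injective keep x y
      ; emb-edge = λ x y e → proj₁ (∧-true (adj G (enum keep x) (enum keep y)) _ e)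
      }

    reduced-good : ∀ x y → adj reduced x y ≡ true → Good (p (enum keep x)) (p (enum keep y))
    reduced-good x y e = good⇒Good _ _ (proj₂ (∧-true (adj G (enum keep x) (enum keep y)) _ e))

    kept-large : 4 * R * n ≤ 4 * R * kept + n
    kept-large = begin
      4 * R * n
        ≡⟨ cong (4 * R *_) (trans (sym (*-identityʳ n)) (sym (sum-const n 1))) ⟩
      4 * R * sum (λ (u : Fin n) → 1)
        ≡⟨ cong (4 * R *_) (trans (sum-cong λ u → split (keep u)) (sum-+ _ _)) ⟩
      4 * R * (kept + bad)
        ≡⟨ *-distribˡ-+ (4 * R) kept bad ⟩
      4 * R * kept + 4 * R * bad
        ≤⟨ +-monoʳ-≤ (4 * R * kept) (≤-trans (*-monoˡ-≤ bad (*-monoˡ-≤ R (s≤s {3} {7} (s≤s (s≤s (s≤s z≤n)))))) few-bad) ⟩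
      4 * R * kept + n ∎
      where
      split : ∀ b → 1 ≡ ⟦ b ⟧ + ⟦ not b ⟧
      split true = refl
      split false = refl

    -- A kept vertex loses at most n/(8`R`) edges by dropping and at most n/(8`R`) neighbours by
    -- deletion of bad vertices.
    degree-kept : ∀ x → 4 * R * deg G (enum keep x) ≤ 4 * R * deg reduced x + n
    degree-kept x = begin
      4 * R * deg G u
        ≡⟨ cong (4 * R *_) (count≡sum (adj G u)) ⟩
      4 * R * sum (λ v → ⟦ adj G u v ⟧)
        ≤⟨ *-monoʳ-≤ (4 * R) (sum-mono-≤ λ v → bool (adj G u v) (good (p u) (p v)) (keep v)) ⟩
      4 * R * sum (λ v → (⟦ keep v ⟧ * ⟦ adj G u v ∧ good (p u) (p v) ⟧) + (⟦ dropped u v ⟧ + ⟦ not (keep v) ⟧))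
        ≡⟨ cong (4 * R *_) (trans (sum-+ _ _) (cong₂ _+_ (sym (sum-enum keep λ v → ⟦ adj G u v ∧ good (p u) (p v) ⟧)) (sum-+ _ _))) ⟩
      4 * R * (sum (λ y → ⟦ adj reduced x y ⟧) + (loss u + bad))
        ≡⟨ cong (λ s → 4 * R * (s + (loss u + bad))) (count≡sum (adj reduced x)) ⟨
      4 * R * (deg reduced x + (loss u + bad))
        ≡⟨ *-distribˡ-+ (4 * R) (deg reduced x) _ ⟩
      4 * R * deg reduced x + 4 * R * (loss u + bad)
        ≤⟨ +-monoʳ-≤ (4 * R * deg reduced x) (*-cancelˡ-≤ 2 half) ⟩
      4 * R * deg reduced x + n ∎
      where
      u = enum keep x
      bool : ∀ a g k → ⟦ a ⟧ ≤ ⟦ k ⟧ * ⟦ a ∧ g ⟧ + (⟦ a ∧ not g ⟧ + ⟦ not k ⟧)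
      bool false g k = z≤n
      bool true true true = s≤s z≤n
      bool true true false = s≤s z≤n
      bool true false true = s≤s z≤n
      bool true false false = s≤s z≤n
      ring : ∀ R l b → 2 * (4 * R * (l + b)) ≡ 8 * R * l + 8 * R * b
      ring = solve-∀
      half : 2 * (4 * R * (loss u + bad)) ≤ 2 * n
      half = begin
        2 * (4 * R * (loss u + bad))
          ≡⟨ ring R (loss u) bad ⟩
        8 * R * loss u + 8 * R * bad
          ≤⟨ +-mono-≤ (⌊⌋-true (_ ≤? _) (enum-sat keep x)) few-bad ⟩
        n + n
          ≡⟨ cong (n +_) (+-identityʳ n) ⟨
        2 * n ∎

-- Greedy embedding of one component

module Embedding where

  open Summation
  open Regularity
  open Cleaning using (⌊⌋-true; ⌊⌋-false; ∧-true)
  open import Defs using (Graph; adj; eqFinB)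
  open import Data.Bool using (Bool; true; false; _∧_; _∨_; if_then_else_)
  open import Data.Nat
  open import Data.Nat.Properties
  open import Data.Nat.Tactic.RingSolver using (solve-∀)
  open import Data.Fin as Fin using (Fin)
  open import Data.List using (List; []; _∷_; length)
  open import Data.List.Membership.Propositional using (_∈_)
  open import Data.List.Relation.Unary.Any using (here; there)
  import Data.List.Relation.Unary.All as All
  open import Data.List.Relation.Unary.AllPairs using (_∷_)
  open import Data.List.Relation.Unary.Unique.Propositional using (Unique)
  open import Data.Product using (_×_; _,_; proj₁; proj₂)
  open import Data.Empty using (⊥-elim)
  open import Function using (_∘_)
  open import Relation.Nullary using (¬_)
  open import Relation.Nullary.Decidable using (⌊_⌋)
  open import Relation.Binary.PropositionalEquality

  sumOver : ∀ {A : Set} → List A → (A → ℕ) → ℕ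
  sumOver [] f = 0
  sumOver (x ∷ xs) f = f x + sumOver xs f

  sum-sumOver : ∀ {A : Set} {n} (xs : List A) (f : A → Fin n → ℕ) →
    sum (λ v → sumOver xs (λ x → f x v)) ≡ sumOver xs (λ x → sum (f x))
  sum-sumOver [] f = sum-zero λ _ → refl
  sum-sumOver (x ∷ xs) f = trans (sum-+ (f x) _) (cong (sum (f x) +_) (sum-sumOver xs f))

  sumOver-0 : ∀ {A : Set} (xs : List A) (f : A → ℕ) → sumOver xs f ≡ 0 → ∀ {x} → x ∈ xs → f x ≡ 0
  sumOver-0 (x ∷ xs) f e (here refl) = m+n≡0⇒m≡0 (f x) e
  sumOver-0 (x ∷ xs) f e (there x∈) = sumOver-0 xs f (m+n≡0⇒n≡0 (f x) e) x∈

  sumOver-≤ : ∀ {A : Set} (xs : List A) (b : A → ℕ) (f : A → ℕ) c V →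
    (∀ {x} → x ∈ xs → c * f x ≤ b x * V) → c * sumOver xs f ≤ sumOver xs b * V
  sumOver-≤ [] b f c V h = ≤-reflexive (*-zeroʳ c)
  sumOver-≤ (x ∷ xs) b f c V h = begin
    c * (f x + sumOver xs f) ≡⟨ *-distribˡ-+ c (f x) _ ⟩
    c * f x + c * sumOver xs f ≤⟨ +-mono-≤ (h (here refl)) (sumOver-≤ xs b f c V (h ∘ there)) ⟩
    b x * V + sumOver xs b * V ≡⟨ *-distribʳ-+ V (b x) _ ⟨
    (b x + sumOver xs b) * V ∎
    where open ≤-Reasoning

  module Greedy {n : ℕ} (G : Graph n) (D E : ℕ) {M : ℕ} (p : Fin n → Fin M)
    {m : ℕ} (H : Graph m) (π : Fin m → Fin M) (Δ K : ℕ)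
    (E≡ : E ≡ 2 * Δ * K) (1≤D : 1 ≤ D) (1≤Δ : 1 ≤ Δ) (1≤K : 1 ≤ K)
    (regular : ∀ x y → adj H x y ≡ true → ¬ OneSided.Irregular G D E p (π x) (π y))
    (v₀ : Fin n) where

    open OneSided G D E

    V : Fin m → ℕ
    V x = size (cell p (π x))

    cand : (Fin m → Fin n → Bool) → Fin m → Fin n → Bool
    cand C x = cut p (π x) (C x)

    nbrs : Fin m → List (Fin m) → ℕ
    nbrs x ys = sumOver ys λ y → ⟦ adj H x y ⟧

    -- Candidate sets may shrink by a factor D for every neighbour still to be embedded.
    Rich : (Fin m → Fin n → Bool) → List (Fin m) → Fin m → Set
    Rich C ys x = V x * D ^ nbrs x ys ≤ K * size (cand C x)

    shrink : (Fin m → Fin n → Bool) → Fin n → Fin m → Fin n → Bool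
    shrink C v x w = C x w ∧ adj G v w

    poor : (Fin m → Fin n → Bool) → Fin m → Fin n → Bool
    poor C x v = ⌊ D * size (cand (shrink C v) x) <? size (cand C x) ⌋

    open ≤-Reasoning

    rich⇒ : ∀ C ys x → Rich C ys x → V x ≤ K * size (cand C x)
    rich⇒ C ys x rich = ≤-trans (m≤m*n (V x) (D ^ nbrs x ys) ⦃ m^n≢0 D (nbrs x ys) ⦃ >-nonZero 1≤D ⦄ ⦄) rich

    K≤E : K ≤ E
    K≤E = ≤-trans (m≤n*m K (2 * Δ) ⦃ m*n≢0 2 Δ ⦃ _ ⦄ ⦃ >-nonZero 1≤Δ ⦄ ⦄) (≤-reflexive (sym E≡))

    poorIn : (Fin m → Fin n → Bool) → Fin m → Fin m → Fin n → Bool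
    poorIn C y x = cut p (π y) (λ v → C y v ∧ poor C x v)

    -- If the poor vertices made up a 1/`E` share of the cell of y, regularity would give density at
    -- least 1/`D` between them and the candidates of x, while each poor vertex sees less than a
    -- 1/`D` share of these candidates.
    few-poor : ∀ C ys x y → adj H y x ≡ true → 1 ≤ V y → Rich C ys x → E * size (poorIn C y x) ≤ V y
    few-poor C ys x y yx 1≤Vy rich = <⇒≤ (≰⇒> λ large → <⇒≱ (≤-trans 1≤Vy large)
      (≤-trans (≤-reflexive (cong (E *_) (empty large))) (≤-reflexive (*-zeroʳ E))))
      where
      B = poorIn C y x
      c = size (cand C x)
      expand : edges B (cand C x) ≡ sum (λ v → ⟦ B v ⟧ * size (cand (shrink C v) x))
      expand = sum-cong λ v → trans (sym (*-sumˡ ⟦ B v ⟧ _)) (cong (⟦ B v ⟧ *_) (sum-cong λ w →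
        trans (sym (⟦⟧-∧ (cand C x w) (adj G v w))) (cong ⟦_⟧ (assoc (cell p (π x) w) (C x w) (adj G v w)))))
        where
        assoc : ∀ a b c → (a ∧ b) ∧ c ≡ a ∧ (b ∧ c)
        assoc false b c = refl
        assoc true b c = refl
      -- The additional summand carries the strictness of `poor` through the summation; against the
      -- bound from regularity it forces `size B` to be 0.
      poor-bound : ∀ v → ⟦ B v ⟧ * (D * size (cand (shrink C v) x)) + ⟦ B v ⟧ ≤ ⟦ B v ⟧ * c
      poor-bound v with B v in eq
      ... | false = z≤n
      ... | true = begin
        1 * (D * size (cand (shrink C v) x)) + 1
          ≡⟨ trans (cong (_+ 1) (*-identityˡ _)) (+-comm _ 1) ⟩
        suc (D * size (cand (shrink C v) x))
          ≤⟨ ⌊⌋-true (_ <? _) (proj₂ (∧-true (C y v) _ (proj₂ (∧-true (cell p (π y) v) _ eq)))) ⟩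
        c ≡⟨ *-identityˡ c ⟨
        1 * c ∎
      sparse : D * edges B (cand C x) + size B ≤ size B * c
      sparse = begin
        D * edges B (cand C x) + size B
          ≡⟨ cong (λ e → D * e + size B) expand ⟩
        D * sum (λ v → ⟦ B v ⟧ * size (cand (shrink C v) x)) + size B
          ≡⟨ cong (_+ size B) (trans (*-sumˡ D _) (sum-cong λ v → *-swap D ⟦ B v ⟧ _)) ⟩
        sum (λ v → ⟦ B v ⟧ * (D * size (cand (shrink C v) x))) + size B
          ≡⟨ sum-+ _ _ ⟨
        sum (λ v → ⟦ B v ⟧ * (D * size (cand (shrink C v) x)) + ⟦ B v ⟧)
          ≤⟨ sum-mono-≤ poor-bound ⟩
        sum (λ v → ⟦ B v ⟧ * c)
          ≡⟨ *-sumʳ c _ ⟨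
        size B * c ∎
      empty : V y ≤ E * size B → size B ≡ 0
      empty large = n≤0⇒n≡0 (+-cancelˡ-≤ (D * edges B (cand C x)) (size B) 0 (begin
        D * edges B (cand C x) + size B ≤⟨ sparse ⟩
        size B * c ≤⟨ ¬irregular⇒dense p (π y) (π x) (regular y x yx) _ (C x) large
                                             (≤-trans (rich⇒ C ys x rich) (*-monoˡ-≤ c K≤E)) ⟩
        D * edges B (cand C x) ≡⟨ +-identityʳ _ ⟨
        D * edges B (cand C x) + 0 ∎))

    insert : Fin n → (Fin n → Bool) → Fin n → Bool
    insert v W w = W w ∨ eqFinB v w

    size-insert : ∀ v W → size (insert v W) ≤ size W + 1
    size-insert v W = begin
      sum (λ w → ⟦ W w ∨ eqFinB v w ⟧) ≤⟨ sum-mono-≤ (λ w → or (W w) (eqFinB v w)) ⟩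
      sum (λ w → ⟦ W w ⟧ + ⟦ eqFinB v w ⟧) ≡⟨ sum-+ _ _ ⟩
      size W + sum (λ w → ⟦ eqFinB v w ⟧) ≡⟨ cong (size W +_) (sum-δ₁ v) ⟩
      size W + 1 ∎
      where
      or : ∀ a b → ⟦ a ∨ b ⟧ ≤ ⟦ a ⟧ + ⟦ b ⟧
      or true b = s≤s z≤n
      or false b = ≤-refl

    record Choice (C : Fin m → Fin n → Bool) (W : Fin n → Bool) (y : Fin m) (ys : List (Fin m)) : Set where
      field
        image : Fin n
        image-cand : cand C y image ≡ true
        image-fresh : W image ≡ false
        image-rich : ∀ {x} → x ∈ ys → adj H y x ≡ true → size (cand C x) ≤ D * size (cand (shrink C image) x)

    -- At most Δ neighbours rule out at most V/`E` vertices each, in total V/(2`K`) as `E` is 2Δ`K`;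
    -- fewer than V/(2`K`) vertices are already used. Since y has at least V/`K` candidates, one of
    -- them survives.
    choose : ∀ C W y ys s → (∀ {x} → x ∈ ys → Rich C ys x) → V y ≤ K * size (cand C y) →
      nbrs y ys ≤ Δ → suc (size W) ≤ s → 2 * K * s ≤ V y → Choice C W y ys
    choose C W y ys s rich richy deg≤Δ W<s room = record
      { image = v ; image-cand = proj₁ split ; image-fresh = proj₁ (proj₂ split) ; image-rich = proj₂ (proj₂ split) }
      where
      N = sumOver ys λ x → ⟦ adj H y x ⟧ * size (poorIn C y x)
      cost : Fin n → ℕ
      cost v = sumOver ys (λ x → ⟦ adj H y x ⟧ * ⟦ poorIn C y x v ⟧) + ⟦ W v ⟧
      instance
        2K≢0 : NonZero (2 * K)
        2K≢0 = m*n≢0 2 K ⦃ _ ⦄ ⦃ >-nonZero 1≤K ⦄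
      2KW< : suc (2 * K * size W) ≤ V y
      2KW< = begin
        1 + 2 * K * size W ≤⟨ +-monoˡ-≤ _ (>-nonZero⁻¹ (2 * K)) ⟩
        2 * K + 2 * K * size W ≡⟨ *-suc (2 * K) (size W) ⟨
        2 * K * suc (size W) ≤⟨ *-monoʳ-≤ (2 * K) W<s ⟩
        2 * K * s ≤⟨ room ⟩
        V y ∎
      2KN : 2 * K * N ≤ V y
      2KN = *-cancelˡ-≤ Δ ⦃ >-nonZero 1≤Δ ⦄ (begin
        Δ * (2 * K * N) ≡⟨ ring Δ K N ⟩
        2 * Δ * K * N ≡⟨ cong (_* N) E≡ ⟨
        E * N ≤⟨ sumOver-≤ ys (λ x → ⟦ adj H y x ⟧) _ E (V y) term ⟩
        nbrs y ys * V y ≤⟨ *-monoˡ-≤ (V y) deg≤Δ ⟩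
        Δ * V y ∎)
        where
        ring : ∀ Δ K N → Δ * (2 * K * N) ≡ 2 * Δ * K * N
        ring = solve-∀
        term : ∀ {x} → x ∈ ys → E * (⟦ adj H y x ⟧ * size (poorIn C y x)) ≤ ⟦ adj H y x ⟧ * V y
        term {x} x∈ with adj H y x in eq
        ... | false = ≤-reflexive (*-zeroʳ E)
        ... | true = begin
          E * (1 * size (poorIn C y x)) ≡⟨ cong (E *_) (*-identityˡ _) ⟩
          E * size (poorIn C y x) ≤⟨ few-poor C ys x y eq (≤-trans (s≤s z≤n) 2KW<) (rich x∈) ⟩
          V y ≡⟨ *-identityˡ _ ⟨
          1 * V y ∎
      total : sum cost ≡ N + size W
      total = trans (sum-+ _ _) (cong (_+ size W) (trans (sum-sumOver ys (λ x v → ⟦ adj H y x ⟧ * ⟦ poorIn C y x v ⟧)) (go ys)))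
        where
        go : ∀ zs → sumOver zs (λ x → sum (λ v → ⟦ adj H y x ⟧ * ⟦ poorIn C y x v ⟧)) ≡ sumOver zs (λ x → ⟦ adj H y x ⟧ * size (poorIn C y x))
        go [] = refl
        go (z ∷ zs) = cong₂ _+_ (sym (*-sumˡ ⟦ adj H y z ⟧ _)) (go zs)
      cheap : sum cost < size (cand C y)
      cheap = subst (_< size (cand C y)) (sym total) (*-cancelˡ-< (2 * K) _ _ (begin-strict
        2 * K * (N + size W) ≡⟨ *-distribˡ-+ (2 * K) N _ ⟩
        2 * K * N + 2 * K * size W <⟨ +-mono-≤-< 2KN 2KW< ⟩
        V y + V y ≤⟨ +-mono-≤ richy richy ⟩
        K * size (cand C y) + K * size (cand C y) ≡⟨ ring K (size (cand C y)) ⟩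
        2 * K * size (cand C y) ∎))
        where
        ring : ∀ k c → k * c + k * c ≡ 2 * k * c
        ring = solve-∀
      found = sum<⇒∃< cost (⟦_⟧ ∘ cand C y) cheap
      v = proj₁ found
      split : cand C y v ≡ true × W v ≡ false × (∀ {x} → x ∈ ys → adj H y x ≡ true → size (cand C x) ≤ D * size (cand (shrink C v) x))
      split = go (cand C y v) refl (W v) refl (proj₂ found)
        where
        go : ∀ a → cand C y v ≡ a → ∀ b → W v ≡ b → cost v < ⟦ cand C y v ⟧ →
          cand C y v ≡ true × W v ≡ false × (∀ {x} → x ∈ ys → adj H y x ≡ true → size (cand C x) ≤ D * size (cand (shrink C v) x))
        go false ea b eb lt = ⊥-elim (n≮0 (subst (cost v <_) (cong ⟦_⟧ ea) lt))
        go true ea true eb lt = ⊥-elim (n≮0 {0} (s≤s⁻¹ (≤-trans (s≤s (≤-trans (≤-reflexive (sym (cong ⟦_⟧ eb))) (m≤n+m _ _)))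
          (subst (cost v <_) (cong ⟦_⟧ ea) lt))))
        go true ea false eb lt = ea , eb , notPoor
          where
          cost≡0 : sumOver ys (λ x → ⟦ adj H y x ⟧ * ⟦ poorIn C y x v ⟧) ≡ 0
          cost≡0 = n≤0⇒n≡0 (≤-trans (m≤m+n _ _) (s≤s⁻¹ (subst (cost v <_) (cong ⟦_⟧ ea) lt)))
          notPoor : ∀ {x} → x ∈ ys → adj H y x ≡ true → size (cand C x) ≤ D * size (cand (shrink C v) x)
          notPoor {x} x∈ yx = ≮⇒≥ (⌊⌋-false (_ <? _) (poor-false (cell p (π y) v) (C y v) (poor C x v) ea
            (trans (sym (trans (cong (λ b → ⟦ b ⟧ * ⟦ poorIn C y x v ⟧) yx) (*-identityˡ _))) (sumOver-0 ys _ cost≡0 x∈))))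
            where
            poor-false : ∀ a b c → a ∧ b ≡ true → ⟦ a ∧ (b ∧ c) ⟧ ≡ 0 → c ≡ false
            poor-false true true false _ _ = refl

    record Placement (C : Fin m → Fin n → Bool) (W : Fin n → Bool) (ys : List (Fin m)) : Set where
      field
        place : Fin m → Fin n
        place-cand : ∀ {x} → x ∈ ys → cand C x (place x) ≡ true
        place-fresh : ∀ {x} → x ∈ ys → W (place x) ≡ false
        place-inj : ∀ {x y} → x ∈ ys → y ∈ ys → place x ≡ place y → x ≡ y
        place-edge : ∀ {x y} → x ∈ ys → y ∈ ys → adj H x y ≡ true → adj G (place x) (place y) ≡ true

    update : (Fin m → Fin n → Bool) → Fin m → Fin n → Fin m → Fin n → Bool
    update C y v x w = if adj H y x then shrink C v x w else C x w

    -- Used vertices are recorded in `W` and not removed from the candidate sets, so richness is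
    -- paid for only when a neighbour is embedded. The bound `s` counts used and remaining vertices
    -- together and therefore stays fixed in the recursion.
    greedy : ∀ C W ys s → Unique ys → (∀ {x} → x ∈ ys → Rich C ys x) → (∀ {x} → x ∈ ys → nbrs x ys ≤ Δ) →
      size W + length ys ≤ s → (∀ {x} → x ∈ ys → 2 * K * s ≤ V x) → Placement C W ys
    greedy C W [] s uniq rich deg≤Δ few room = record
      { place = λ _ → v₀ ; place-cand = λ () ; place-fresh = λ () ; place-inj = λ () ; place-edge = λ () }
    greedy C W (y ∷ ys) s (y∉ ∷ uniq) rich deg≤Δ few room = record
      { place = place′ ; place-cand = cand′ ; place-fresh = fresh′ ; place-inj = inj′ ; place-edge = edge′ }
      where
      nbrs-tail : ∀ x → nbrs x ys ≤ nbrs x (y ∷ ys)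
      nbrs-tail x = m≤n+m _ _
      rich-tail : ∀ {x} → x ∈ ys → Rich C ys x
      rich-tail {x} x∈ = ≤-trans (*-monoʳ-≤ (V x) (^-monoʳ-≤ D ⦃ >-nonZero 1≤D ⦄ (nbrs-tail x))) (rich (there x∈))
      choice : Choice C W y ys
      choice = choose C W y ys s rich-tail (rich⇒ C (y ∷ ys) y (rich (here refl)))
        (≤-trans (nbrs-tail y) (deg≤Δ (here refl)))
        (≤-trans (s≤s (m≤m+n (size W) (length ys))) (≤-trans (≤-reflexive (sym (+-suc (size W) (length ys)))) few))
        (room (here refl))
      open Choice choice renaming (image to v)
      C′ : Fin m → Fin n → Bool
      C′ = update C y v
      rest : Placement C′ (insert v W) ys
      rest = greedy C′ (insert v W) ys s uniq (λ {x} x∈ → rich″ x∈ (adj H y x) refl) (λ x∈ → ≤-trans (nbrs-tail _) (deg≤Δ (there x∈)))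
        (begin
          size (insert v W) + length ys ≤⟨ +-monoˡ-≤ (length ys) (size-insert v W) ⟩
          size W + 1 + length ys ≡⟨ +-assoc (size W) 1 _ ⟩
          size W + suc (length ys) ≤⟨ few ⟩
          s ∎)
        (λ x∈ → room (there x∈))
        where
        rich″ : ∀ {x} → x ∈ ys → ∀ b → adj H y x ≡ b → Rich C′ ys x
        rich″ {x} x∈ b e = subst (λ b → V x * D ^ nbrs x ys ≤ K * size (cut p (π x) (λ w → if b then shrink C v x w else C x w))) (sym e) (go b e)
          where
          go : ∀ b → adj H y x ≡ b → V x * D ^ nbrs x ys ≤ K * size (cut p (π x) (λ w → if b then shrink C v x w else C x w))
          go false e = rich-tail x∈
          -- The factor `D` lost here is the one that y contributed to the exponent while it was
          -- still to be embedded.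
          go true e = *-cancelˡ-≤ D ⦃ >-nonZero 1≤D ⦄ (begin
            D * (V x * D ^ nbrs x ys) ≡⟨ *-swap D (V x) _ ⟩
            V x * D ^ (1 + nbrs x ys) ≡⟨ cong (λ b → V x * D ^ (⟦ b ⟧ + nbrs x ys)) (trans (Graph.sym H x y) e) ⟨
            V x * D ^ nbrs x (y ∷ ys) ≤⟨ rich (there x∈) ⟩
            K * size (cand C x) ≤⟨ *-monoʳ-≤ K (image-rich x∈ e) ⟩
            K * (D * size (cand (shrink C v) x)) ≡⟨ *-swap K D _ ⟩
            D * (K * size (cand (shrink C v) x)) ∎)
      open Placement rest
      place′ : Fin m → Fin n
      place′ x = if eqFinB y x then v else place x
      at-y : place′ y ≡ v
      at-y = cong (if_then v else place y) (eqFinB-refl y)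
      at-ys : ∀ {x} → x ∈ ys → place′ x ≡ place x
      at-ys {x} x∈ = cong (if_then v else place x) (≢⇒eqFinB y x (All.lookup y∉ x∈))
      fresh-ys : ∀ {x} → x ∈ ys → W (place x) ≡ false × v ≢ place x
      fresh-ys {x} x∈ = go (W (place x)) (eqFinB v (place x)) refl (place-fresh x∈)
        where
        go : ∀ a b → eqFinB v (place x) ≡ b → a ∨ b ≡ false → a ≡ false × v ≢ place x
        go false false e _ = refl , λ eq → case (trans (sym e) (trans (cong (eqFinB v) (sym eq)) (eqFinB-refl v)))
          where
          case : false ≡ true → _
          case ()
      cand-ys : ∀ {x} → x ∈ ys → cand C x (place x) ≡ true × (adj H y x ≡ true → adj G v (place x) ≡ true)
      cand-ys {x} x∈ = go (adj H y x) (cell p (π x) (place x)) (C x (place x)) (adj G v (place x)) (place-cand x∈)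
        where
        go : ∀ b c d e → c ∧ (if b then d ∧ e else d) ≡ true → c ∧ d ≡ true × (b ≡ true → e ≡ true)
        go false true true e _ = refl , λ ()
        go true true true true _ = refl , λ _ → refl
      cand′ : ∀ {x} → x ∈ y ∷ ys → cand C x (place′ x) ≡ true
      cand′ (here refl) = trans (cong (cand C y) at-y) image-cand
      cand′ {x} (there x∈) = trans (cong (cand C x) (at-ys x∈)) (proj₁ (cand-ys x∈))
      fresh′ : ∀ {x} → x ∈ y ∷ ys → W (place′ x) ≡ false
      fresh′ (here refl) = trans (cong W at-y) image-fresh
      fresh′ (there x∈) = trans (cong W (at-ys x∈)) (proj₁ (fresh-ys x∈))
      inj′ : ∀ {x z} → x ∈ y ∷ ys → z ∈ y ∷ ys → place′ x ≡ place′ z → x ≡ z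
      inj′ (here refl) (here refl) e = refl
      inj′ (here refl) (there z∈) e = ⊥-elim (proj₂ (fresh-ys z∈) (trans (sym at-y) (trans e (at-ys z∈))))
      inj′ (there x∈) (here refl) e = ⊥-elim (proj₂ (fresh-ys x∈) (trans (sym at-y) (trans (sym e) (at-ys x∈))))
      inj′ (there x∈) (there z∈) e = place-inj x∈ z∈ (trans (sym (at-ys x∈)) (trans e (at-ys z∈)))
      edge′ : ∀ {x z} → x ∈ y ∷ ys → z ∈ y ∷ ys → adj H x z ≡ true → adj G (place′ x) (place′ z) ≡ true
      edge′ (here refl) (here refl) e = case (trans (sym e) (Graph.irrefl H y))
        where
        case : true ≡ false → _
        case ()
      edge′ (here refl) (there z∈) e = trans (cong₂ (adj G) at-y (at-ys z∈)) (proj₂ (cand-ys z∈) e)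
      edge′ {x} (there x∈) (here refl) e = trans (cong₂ (adj G) (at-ys x∈) at-y)
        (trans (Graph.sym G _ _) (proj₂ (cand-ys x∈) (trans (Graph.sym H y x) e)))
      edge′ (there x∈) (there z∈) e = trans (cong₂ (adj G) (at-ys x∈) (at-ys z∈)) (place-edge x∈ z∈ e)

-- Embedding all components in turn

module Assembling where

  open Summation
  open Regularity
  open Cleaning using (∧-true; not-true)
  open Embedding
  open import Defs using (Graph; adj; eqFinB; deg; SubgraphOf)
  open import Data.Bool using (Bool; true; false; _∧_; _∨_; not; if_then_else_)
  open import Data.Bool.Properties using (∧-zeroʳ)
  open import Data.Nat
  open import Data.Nat.Properties
  open import Data.Nat.Tactic.RingSolver using (solve-∀)
  open import Data.Fin as Fin using (Fin)
  open import Data.List as List using (List; []; _∷_; length; filter; allFin; tabulate)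
  open import Data.List.Membership.Propositional using (_∈_)
  open import Data.List.Membership.Propositional.Properties using (∈-filter⁺; ∈-filter⁻; ∈-allFin)
  open import Data.List.Relation.Unary.Any using (here; there)
  import Data.List.Relation.Unary.All as All
  open import Data.List.Relation.Unary.AllPairs using (_∷_)
  open import Data.List.Relation.Unary.Unique.Propositional using (Unique)
  open import Data.List.Relation.Unary.Unique.Propositional.Properties using (filter⁺; allFin⁺)
  open import Data.Product using (_×_; _,_; proj₁; proj₂)
  open import Data.Empty using (⊥-elim)
  open import Function using (_∘_; id)
  open import Relation.Nullary using (yes; no; ¬_; Dec)
  open import Relation.Nullary.Decidable using (⌊_⌋)
  open import Relation.Binary.PropositionalEquality

  sumOver-tabulate : ∀ {A : Set} {n} (g : Fin n → A) (f : A → ℕ) → sumOver (tabulate g) f ≡ sum (f ∘ g)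
  sumOver-tabulate {n = zero} g f = sym (sum-zero {0} {λ i → f (g i)} λ ())
  sumOver-tabulate {n = suc n} g f = trans (cong (f (g Fin.zero) +_) (sumOver-tabulate (g ∘ Fin.suc) f)) (sym (sum-suc (f ∘ g)))

  sumOver-fibre : ∀ {m N} (comp : Fin m → Fin N) c (xs : List (Fin m)) f →
    sumOver (filter (λ x → comp x Fin.≟ c) xs) f ≡ sumOver xs (λ x → ⟦ eqFinB (comp x) c ⟧ * f x)
  sumOver-fibre comp c [] f = refl
  sumOver-fibre comp c (x ∷ xs) f with comp x Fin.≟ c
  ... | yes _ = cong₂ _+_ (sym (*-identityˡ (f x))) (sumOver-fibre comp c xs f)
  ... | no _ = sumOver-fibre comp c xs f

  length-sumOver : ∀ {A : Set} (xs : List A) → length xs ≡ sumOver xs (λ _ → 1)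
  length-sumOver [] = refl
  length-sumOver (x ∷ xs) = cong suc (length-sumOver xs)

  fibre : ∀ {m N} → (Fin m → Fin N) → Fin N → List (Fin m)
  fibre {m} comp c = filter (λ x → comp x Fin.≟ c) (allFin m)

  module _ {m N} (comp : Fin m → Fin N) (c : Fin N) where

    ∈-fibre⁺ : ∀ {x} → comp x ≡ c → x ∈ fibre comp c
    ∈-fibre⁺ {x} e = ∈-filter⁺ (λ x → comp x Fin.≟ c) (∈-allFin x) e

    ∈-fibre⁻ : ∀ {x} → x ∈ fibre comp c → comp x ≡ c
    ∈-fibre⁻ x∈ = proj₂ (∈-filter⁻ (λ x → comp x Fin.≟ c) {xs = allFin m} x∈)

    fibre-unique : Unique (fibre comp c)
    fibre-unique = filter⁺ (λ x → comp x Fin.≟ c) (allFin⁺ m)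

    sum-fibre : ∀ f → sumOver (fibre comp c) f ≡ sum (λ x → ⟦ eqFinB (comp x) c ⟧ * f x)
    sum-fibre f = trans (sumOver-fibre comp c (allFin m) f) (sumOver-tabulate id _)

    length-fibre : length (fibre comp c) ≡ size (λ x → eqFinB (comp x) c)
    length-fibre = trans (length-sumOver (fibre comp c)) (trans (sum-fibre _) (sum-cong λ x → *-identityʳ _))

  module Assemble {n : ℕ} (G : Graph n) (D E : ℕ) {M : ℕ} (p : Fin n → Fin M)
    {m : ℕ} (H : Graph m) (π : Fin m → Fin M) (Δ F : ℕ)
    (E≡ : E ≡ 2 * Δ * (F * D ^ Δ)) (1≤D : 1 ≤ D) (1≤Δ : 1 ≤ Δ) (1≤F : 1 ≤ F)
    (regular : ∀ x y → adj H x y ≡ true → ¬ OneSided.Irregular G D E p (π x) (π y))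
    (v₀ : Fin n) (deg≤Δ : ∀ x → deg H x ≤ Δ)
    {N : ℕ} (comp : Fin m → Fin N) (comp-adj : ∀ x y → adj H x y ≡ true → comp x ≡ comp y) where

    K = F * D ^ Δ

    1≤K : 1 ≤ K
    1≤K = *-mono-≤ 1≤F (m^n>0 D ⦃ >-nonZero 1≤D ⦄ Δ)

    open OneSided G D E
    open Greedy G D E p H π Δ K E≡ 1≤D 1≤Δ 1≤K regular v₀
    open ≤-Reasoning

    compSize : Fin N → ℕ
    compSize c = size λ x → eqFinB (comp x) c

    load : Fin M → ℕ
    load i = sum λ x → ⟦ eqFinB (π x) i ⟧

    loadOf : Fin M → Fin N → ℕ
    loadOf i c = sum λ x → ⟦ eqFinB (comp x) c ⟧ * ⟦ eqFinB (π x) i ⟧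

    module _ (spare : ∀ x → V x + F * load (π x) ≤ F * V x) (room : ∀ x → 2 * K * compSize (comp x) ≤ V x) where

      record Partial (cs : List (Fin N)) (W : Fin n → Bool) : Set where
        field
          map : Fin m → Fin n
          map-fresh : ∀ {x} → comp x ∈ cs → W (map x) ≡ false
          map-inj : ∀ {x y} → comp x ∈ cs → comp y ∈ cs → map x ≡ map y → x ≡ y
          map-edge : ∀ {x y} → comp x ∈ cs → comp y ∈ cs → adj H x y ≡ true → adj G (map x) (map y) ≡ true

      -- Vertices taken by earlier components are excluded through the candidate sets, so the greedy
      -- step starts with nothing used and needs room for one component only. `spare` keeps a 1/`F`
      -- share of each used cluster free, and the factor `D ^ Δ` in `K` pays for up to Δ shrinkings.
      placeComponent : ∀ W c → (∀ i → size (cut p i W) ≤ load i) → Placement (λ _ v → not (W v)) (λ _ → false) (fibre comp c)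
      placeComponent W c used = greedy _ _ (fibre comp c) (compSize c) (fibre-unique comp c) rich few-nbrs
        (≤-reflexive (trans (cong (_+ length (fibre comp c)) (sum-zero {n} λ _ → refl)) (length-fibre comp c)))
        (λ {x} x∈ → subst (λ c → 2 * K * compSize c ≤ V x) (∈-fibre⁻ comp c x∈) (room x))
        where
        few-nbrs : ∀ {x} → x ∈ fibre comp c → nbrs x (fibre comp c) ≤ Δ
        few-nbrs {x} x∈ = begin
          nbrs x (fibre comp c) ≡⟨ sum-fibre comp c _ ⟩
          sum (λ y → ⟦ eqFinB (comp y) c ⟧ * ⟦ adj H x y ⟧) ≤⟨ sum-mono-≤ (λ y → *-monoˡ-≤ ⟦ adj H x y ⟧ (⟦⟧≤1 (eqFinB (comp y) c))) ⟩
          sum (λ y → 1 * ⟦ adj H x y ⟧) ≡⟨ sum-cong (λ y → *-identityˡ _) ⟩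
          sum (λ y → ⟦ adj H x y ⟧) ≡⟨ count≡sum (adj H x) ⟨
          deg H x ≤⟨ deg≤Δ x ⟩
          Δ ∎
        free : Fin m → ℕ
        free x = size (cut p (π x) (λ v → not (W v)))
        V≡ : ∀ x → V x ≡ free x + size (cut p (π x) W)
        V≡ x = trans (sum-cong λ v → bool (cell p (π x) v) (W v)) (sum-+ _ _)
          where
          bool : ∀ a b → ⟦ a ⟧ ≡ ⟦ a ∧ not b ⟧ + ⟦ a ∧ b ⟧
          bool false b = refl
          bool true false = refl
          bool true true = refl
        V≤ : ∀ x → V x ≤ F * free x
        V≤ x = +-cancelʳ-≤ (F * size (cut p (π x) W)) _ _ (begin
          V x + F * size (cut p (π x) W) ≤⟨ +-monoʳ-≤ (V x) (*-monoʳ-≤ F (used (π x))) ⟩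
          V x + F * load (π x) ≤⟨ spare x ⟩
          F * V x ≡⟨ cong (F *_) (V≡ x) ⟩
          F * (free x + size (cut p (π x) W)) ≡⟨ *-distribˡ-+ F (free x) _ ⟩
          F * free x + F * size (cut p (π x) W) ∎)
        rich : ∀ {x} → x ∈ fibre comp c → Rich (λ _ v → not (W v)) (fibre comp c) x
        rich {x} x∈ = begin
          V x * D ^ nbrs x (fibre comp c) ≤⟨ *-mono-≤ (V≤ x) (^-monoʳ-≤ D ⦃ >-nonZero 1≤D ⦄ (few-nbrs x∈)) ⟩
          F * free x * D ^ Δ ≡⟨ ring F (free x) (D ^ Δ) ⟩
          K * free x ∎
          where
          ring : ∀ a b c → a * b * c ≡ a * c * b
          ring = solve-∀

      -- The invariant sets aside room for the components still to come, so no cell ever holds more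
      -- than its final `load`, and `spare` applies at every stage.
      assemble : ∀ cs W → Unique cs → (∀ i → size (cut p i W) + sumOver cs (loadOf i) ≤ load i) → Partial cs W
      assemble [] W uniq fits = record { map = λ _ → v₀ ; map-fresh = λ () ; map-inj = λ () ; map-edge = λ () }
      assemble (c ∷ cs) W (c∉ ∷ uniq) fits = record
        { map = map′ ; map-fresh = fresh′ ; map-inj = inj′ ; map-edge = edge′ }
        where
        open Placement (placeComponent W c λ i → ≤-trans (m≤m+n _ _) (fits i))
        hits : Fin n → ℕ
        hits v = sum λ x → ⟦ eqFinB (comp x) c ⟧ * ⟦ eqFinB (place x) v ⟧
        W′ : Fin n → Bool
        W′ v = W v ∨ ⌊ 1 ≤? hits v ⌋
        place-cell : ∀ x → comp x ≡ c → p (place x) ≡ π x × W (place x) ≡ false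
        place-cell x e = eqFinB⇒≡ _ _ (proj₁ split) , not-true (W (place x)) (proj₂ split)
          where
          split = ∧-true (cell p (π x) (place x)) (not (W (place x))) (place-cand (∈-fibre⁺ comp c e))
        used′ : ∀ i → size (cut p i W′) ≤ size (cut p i W) + loadOf i c
        used′ i = begin
          sum (λ v → ⟦ cell p i v ∧ W′ v ⟧)
            ≤⟨ sum-mono-≤ (λ v → bool (cell p i v) (W v) (hits v) (1 ≤? hits v)) ⟩
          sum (λ v → ⟦ cell p i v ∧ W v ⟧ + ⟦ cell p i v ⟧ * hits v)
            ≡⟨ sum-+ _ _ ⟩
          size (cut p i W) + sum (λ v → ⟦ cell p i v ⟧ * hits v)
            ≡⟨ cong (size (cut p i W) +_) count-hits ⟩
          size (cut p i W) + loadOf i c ∎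
          where
          bool : ∀ a b k (d : Dec (1 ≤ k)) → ⟦ a ∧ (b ∨ ⌊ d ⌋) ⟧ ≤ ⟦ a ∧ b ⟧ + ⟦ a ⟧ * k
          bool false b k d = z≤n
          bool true true k d = s≤s z≤n
          bool true false k (no _) = z≤n
          bool true false k (yes q) = ≤-trans q (≤-reflexive (sym (+-identityʳ k)))
          swap : ∀ a b c → a * (b * c) ≡ b * (c * a)
          swap = solve-∀
          at : ∀ x → ⟦ eqFinB (comp x) c ⟧ * ⟦ cell p i (place x) ⟧ ≡ ⟦ eqFinB (comp x) c ⟧ * ⟦ eqFinB (π x) i ⟧
          at x = go (eqFinB (comp x) c) refl
            where
            go : ∀ b → eqFinB (comp x) c ≡ b → ⟦ b ⟧ * ⟦ cell p i (place x) ⟧ ≡ ⟦ b ⟧ * ⟦ eqFinB (π x) i ⟧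
            go true e = cong (λ j → 1 * ⟦ eqFinB j i ⟧) (proj₁ (place-cell x (eqFinB⇒≡ _ _ e)))
            go false _ = refl
          count-hits : sum (λ v → ⟦ cell p i v ⟧ * hits v) ≡ loadOf i c
          count-hits = begin-equality
            sum (λ v → ⟦ cell p i v ⟧ * hits v)
              ≡⟨ sum-cong (λ v → trans (*-sumˡ ⟦ cell p i v ⟧ _) (sum-cong λ x → swap ⟦ cell p i v ⟧ ⟦ eqFinB (comp x) c ⟧ ⟦ eqFinB (place x) v ⟧)) ⟩
            sum (λ v → sum λ x → ⟦ eqFinB (comp x) c ⟧ * (⟦ eqFinB (place x) v ⟧ * ⟦ cell p i v ⟧))
              ≡⟨ sum-comm _ ⟩
            sum (λ x → sum λ v → ⟦ eqFinB (comp x) c ⟧ * (⟦ eqFinB (place x) v ⟧ * ⟦ cell p i v ⟧))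
              ≡⟨ sum-cong (λ x → trans (sym (*-sumˡ ⟦ eqFinB (comp x) c ⟧ _))
                   (trans (cong (⟦ eqFinB (comp x) c ⟧ *_) (sum-δ (place x) (λ v → ⟦ cell p i v ⟧))) (at x))) ⟩
            loadOf i c ∎
        rest : Partial cs W′
        rest = assemble cs W′ uniq λ i → begin
          size (cut p i W′) + sumOver cs (loadOf i) ≤⟨ +-monoˡ-≤ _ (used′ i) ⟩
          size (cut p i W) + loadOf i c + sumOver cs (loadOf i) ≡⟨ +-assoc (size (cut p i W)) _ _ ⟩
          size (cut p i W) + (loadOf i c + sumOver cs (loadOf i)) ≤⟨ fits i ⟩
          load i ∎
        open Partial rest
        map′ : Fin m → Fin n
        map′ x = if eqFinB (comp x) c then place x else map x
        at-c : ∀ {x} → comp x ≡ c → map′ x ≡ place x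
        at-c {x} refl = cong (if_then place x else map x) (eqFinB-refl (comp x))
        at-cs : ∀ {x} → comp x ∈ cs → map′ x ≡ map x
        at-cs {x} x∈ = cong (if_then place x else map x) (≢⇒eqFinB _ _ λ e → All.lookup c∉ x∈ (sym e))
        fresh-cs : ∀ {x} → comp x ∈ cs → W (map x) ≡ false × (∀ {y} → comp y ≡ c → place y ≢ map x)
        fresh-cs {x} x∈ = go (W (map x)) (1 ≤? hits (map x)) (map-fresh x∈)
          where
          go : ∀ a (d : Dec (1 ≤ hits (map x))) → a ∨ ⌊ d ⌋ ≡ false → a ≡ false × (∀ {y} → comp y ≡ c → place y ≢ map x)
          go false (no q) _ = refl , λ {y} yc e → q (≤-trans
            (≤-reflexive (sym (cong₂ (λ a b → ⟦ a ⟧ * ⟦ b ⟧)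
              (trans (cong (λ j → eqFinB j c) yc) (eqFinB-refl c)) (trans (cong (λ j → eqFinB j (map x)) e) (eqFinB-refl (map x))))))
            (term≤sum (λ y → ⟦ eqFinB (comp y) c ⟧ * ⟦ eqFinB (place y) (map x) ⟧) y))
        fresh′ : ∀ {x} → comp x ∈ c ∷ cs → W (map′ x) ≡ false
        fresh′ {x} (here e) = trans (cong W (at-c e)) (proj₂ (place-cell x e))
        fresh′ (there x∈) = trans (cong W (at-cs x∈)) (proj₁ (fresh-cs x∈))
        inj′ : ∀ {x y} → comp x ∈ c ∷ cs → comp y ∈ c ∷ cs → map′ x ≡ map′ y → x ≡ y
        inj′ (here e) (here e′) q = place-inj (∈-fibre⁺ comp c e) (∈-fibre⁺ comp c e′) (trans (sym (at-c e)) (trans q (at-c e′)))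
        inj′ (here e) (there y∈) q = ⊥-elim (proj₂ (fresh-cs y∈) e (trans (sym (at-c e)) (trans q (at-cs y∈))))
        inj′ (there x∈) (here e) q = ⊥-elim (proj₂ (fresh-cs x∈) e (trans (sym (at-c e)) (trans (sym q) (at-cs x∈))))
        inj′ (there x∈) (there y∈) q = map-inj x∈ y∈ (trans (sym (at-cs x∈)) (trans q (at-cs y∈)))
        edge′ : ∀ {x y} → comp x ∈ c ∷ cs → comp y ∈ c ∷ cs → adj H x y ≡ true → adj G (map′ x) (map′ y) ≡ true
        edge′ {x} {y} (here e) _ q = trans (cong₂ (adj G) (at-c e) (at-c e′))
          (place-edge (∈-fibre⁺ comp c e) (∈-fibre⁺ comp c e′) q)
          where
          e′ : comp y ≡ c
          e′ = trans (sym (comp-adj x y q)) e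
        edge′ {x} {y} (there x∈) _ q = trans (cong₂ (adj G) (at-cs x∈) (at-cs y∈)) (map-edge x∈ y∈ q)
          where
          y∈ : comp y ∈ cs
          y∈ = subst (_∈ cs) (comp-adj x y q) x∈

      embedding : SubgraphOf H G
      embedding = record
        { emb = map
        ; emb-inj = λ {x} {y} → map-inj (∈-allFin (comp x)) (∈-allFin (comp y))
        ; emb-edge = λ x y → map-edge (∈-allFin (comp x)) (∈-allFin (comp y))
        }
        where
        open Partial (assemble (allFin N) (λ _ → false) (allFin⁺ N) λ i → ≤-reflexive (begin-equality
          size (cut p i λ _ → false) + sumOver (allFin N) (loadOf i)
            ≡⟨ cong₂ _+_ (sum-zero {n} λ v → cong ⟦_⟧ (∧-zeroʳ (cell p i v))) (sumOver-tabulate id (loadOf i)) ⟩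
          sum (loadOf i)
            ≡⟨ sum-fibres comp (λ x → ⟦ eqFinB (π x) i ⟧) ⟨
          load i ∎))

-- Second moment method without randomness

module Derandomise where

  open Summation
  open import Data.Nat
  open import Data.Nat.Properties
  open import Data.Nat.Tactic.RingSolver using (solve-∀)
  open import Data.Fin as Fin using (Fin)
  open import Data.Product using (∃; _,_; proj₁; proj₂)
  open import Data.Sum using (inj₁; inj₂)
  open import Data.Empty using (⊥-elim)
  open import Function using (_∘_)
  open import Relation.Nullary using (yes; no)
  open import Relation.Binary.PropositionalEquality

  2ab≤a²+b² : ∀ a b → 2 * a * b ≤ a * a + b * b
  2ab≤a²+b² a b with ≤-total a b
  ... | inj₁ a≤b = subst (λ b → 2 * a * b ≤ a * a + b * b) (m+[n∸m]≡n a≤b)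
    (≤-trans (m≤m+n _ ((b ∸ a) * (b ∸ a))) (≤-reflexive (ring a (b ∸ a))))
    where
    ring : ∀ a e → 2 * a * (a + e) + e * e ≡ a * a + (a + e) * (a + e)
    ring = solve-∀
  ... | inj₂ b≤a = subst (λ a → 2 * a * b ≤ a * a + b * b) (m+[n∸m]≡n b≤a)
    (≤-trans (m≤m+n _ ((a ∸ b) * (a ∸ b))) (≤-reflexive (ring b (a ∸ b))))
    where
    ring : ∀ b e → 2 * (b + e) * b + e * e ≡ (b + e) * (b + e) + b * b
    ring = solve-∀

  m²≤n²⇒m≤n : ∀ m n → m * m ≤ n * n → m ≤ n
  m²≤n²⇒m≤n m n le with m ≤? n
  ... | yes p = p
  ... | no q = ⊥-elim (<⇒≱ (*-mono-< (≰⇒> q) (≰⇒> q)) le)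

  sum-squares≤ : ∀ {n} (f : Fin n → ℕ) → sum (λ i → f i * f i) ≤ sum f * sum f
  sum-squares≤ f = ≤-trans (sum-mono-≤ λ i → *-monoʳ-≤ (f i) (term≤sum f i)) (≤-reflexive (sym (*-sumʳ (sum f) f)))

  sum-excess : ∀ {n} (f g : Fin n → ℕ) Z → (∀ i → g i ≤ f i) → sum f ≤ sum g + Z → ∀ i → f i ≤ g i + Z
  sum-excess f g Z g≤f le i = begin
    f i ≡⟨ m+[n∸m]≡n (g≤f i) ⟨
    g i + (f i ∸ g i) ≤⟨ +-monoʳ-≤ (g i) (≤-trans (term≤sum (λ j → f j ∸ g j) i) excess) ⟩
    g i + Z ∎
    where
    open ≤-Reasoning
    excess : sum (λ j → f j ∸ g j) ≤ Z
    excess = +-cancelˡ-≤ (sum g) _ _ (≤-trans (≤-reflexive (trans (sym (sum-+ g _)) (sum-cong λ j → m+[n∸m]≡n (g≤f j)))) le)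

  -- The averaging step of the method of conditional expectations. Passing to `suc (g o)` makes the
  -- comparison of the sums strict, as the total weight is positive; a strict term has positive
  -- weight, which cancels.
  weighted-choice : ∀ {N} (w f g : Fin N → ℕ) → 1 ≤ sum w →
    sum (λ o → w o * f o) ≤ sum (λ o → w o * g o) → ∃ λ o → f o ≤ g o
  weighted-choice w f g pos le with sum<⇒∃< (λ o → w o * f o) (λ o → w o * suc (g o))
    (≤-trans (s≤s le) (≤-trans (+-monoˡ-≤ _ pos) (≤-reflexive (trans (sym (sum-+ w _)) (sum-cong λ o → sym (*-suc (w o) (g o)))))))
  ... | o , lt = o , s≤s⁻¹ (*-cancelˡ-< (w o) (f o) (suc (g o)) lt)

  module Variance {N M : ℕ} (w : Fin N → ℕ) (1≤Ω : 1 ≤ sum w) where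

    Ω : ℕ
    Ω = sum w

    mean : (Fin N → Fin M → ℕ) → Fin M → ℕ
    mean x i = sum λ o → w o * x o i

    open ≤-Reasoning

    -- (a − b)² ≤ Z summed over all coordinates, without subtraction.
    Close : (a b : Fin M → ℕ) → ℕ → Set
    Close a b Z = sum (λ i → a i * a i + b i * b i) ≤ sum (λ i → 2 * a i * b i) + Z

    -- The expected squared deviation grows by at most the second moment of the random increment.
    advance : ∀ (x : Fin N → Fin M → ℕ) (a b : Fin M → ℕ) Z s → (∀ o → sum (x o) ≤ s) → Close a b Z →
      ∃ λ o → Close (λ i → a i + Ω * x o i) (λ i → b i + mean x i) (Z + Ω * Ω * (s * s))
    advance x a b Z s x≤s close = weighted-choice w lhs rhs 1≤Ω (+-cancelʳ-≤ extra _ _ (begin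
      sum (λ o → w o * lhs o) + extra
        ≡⟨ cong₂ _+_ (trans (sum-cong λ o → *-sumˡ (w o) _) (sum-comm _)) refl ⟩
      sum (λ i → sum λ o → w o * (a′ o i * a′ o i + b′ i * b′ i)) + extra
        ≡⟨ sum-+ _ _ ⟨
      sum (λ i → sum (λ o → w o * (a′ o i * a′ o i + b′ i * b′ i)) + (Ω * (2 * a i * b i) + Ω * (y i * y i)))
        ≡⟨ sum-cong perCoordinate ⟩
      sum (λ i → sum (λ o → w o * (2 * a′ o i * b′ i)) + (Ω * (a i * a i + b i * b i) + Ω * Ω * S i))
        ≡⟨ trans (sum-+ _ _) (cong₂ _+_ (sym (trans (sum-cong λ o → *-sumˡ (w o) _) (sum-comm _))) (trans (sum-+ _ _) (cong₂ _+_ (sym (*-sumˡ Ω _)) (sym (*-sumˡ (Ω * Ω) S))))) ⟩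
      sum (λ o → w o * sum (λ i → 2 * a′ o i * b′ i)) + (Ω * sum (λ i → a i * a i + b i * b i) + Ω * Ω * sum S)
        ≤⟨ +-monoʳ-≤ (sum (λ o → w o * sum (λ i → 2 * a′ o i * b′ i)))
             (+-mono-≤ (*-monoʳ-≤ Ω close) (*-monoʳ-≤ (Ω * Ω) second-moment)) ⟩
      sum (λ o → w o * sum (λ i → 2 * a′ o i * b′ i)) + (Ω * (sum (λ i → 2 * a i * b i) + Z) + Ω * Ω * (Ω * (s * s)))
        ≡⟨ ring (sum (λ o → w o * sum (λ i → 2 * a′ o i * b′ i))) Ω (sum (λ i → 2 * a i * b i)) Z s ⟩
      sum (λ o → w o * sum (λ i → 2 * a′ o i * b′ i)) + Ω * (Z + Ω * Ω * (s * s)) + Ω * sum (λ i → 2 * a i * b i)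
        ≡⟨ cong (_+ Ω * sum (λ i → 2 * a i * b i)) (trans (cong₂ _+_ refl (*-sumʳ (Z + Ω * Ω * (s * s)) w))
             (trans (sym (sum-+ _ _)) (sum-cong λ o → sym (*-distribˡ-+ (w o) _ _)))) ⟩
      sum (λ o → w o * rhs o) + Ω * sum (λ i → 2 * a i * b i)
        ≤⟨ +-monoʳ-≤ (sum (λ o → w o * rhs o)) (≤-trans (m≤m+n _ _) (≤-reflexive (trans (cong₂ _+_ (*-sumˡ Ω _) refl) (sym (sum-+ _ _))))) ⟩
      sum (λ o → w o * rhs o) + extra ∎))
      where
      y : Fin M → ℕ
      y = mean x
      a′ : Fin N → Fin M → ℕ
      a′ o i = a i + Ω * x o i
      b′ : Fin M → ℕ
      b′ i = b i + y i
      S : Fin M → ℕ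
      S i = sum λ o → w o * (x o i * x o i)
      lhs rhs : Fin N → ℕ
      lhs o = sum λ i → a′ o i * a′ o i + b′ i * b′ i
      rhs o = sum (λ i → 2 * a′ o i * b′ i) + (Z + Ω * Ω * (s * s))
      extra : ℕ
      extra = sum λ i → Ω * (2 * a i * b i) + Ω * (y i * y i)
      ring : ∀ t Ω q Z s → t + (Ω * (q + Z) + Ω * Ω * (Ω * (s * s))) ≡ t + Ω * (Z + Ω * Ω * (s * s)) + Ω * q
      ring = solve-∀
      second-moment : sum S ≤ Ω * (s * s)
      second-moment = begin
        sum S
          ≡⟨ trans (sum-comm _) (sum-cong λ o → sym (*-sumˡ (w o) _)) ⟩
        sum (λ o → w o * sum (λ i → x o i * x o i))
          ≤⟨ sum-mono-≤ (λ o → *-monoʳ-≤ (w o) (≤-trans (sum-squares≤ (x o)) (*-mono-≤ (x≤s o) (x≤s o)))) ⟩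
        sum (λ o → w o * (s * s))
          ≡⟨ *-sumʳ (s * s) w ⟨
        Ω * (s * s) ∎
      linear : ∀ (α β γ : ℕ) i → sum (λ o → w o * (α + β * x o i + γ * (x o i * x o i))) ≡ Ω * α + y i * β + S i * γ
      linear α β γ i = trans (sum-cong λ o → expand (w o) α β γ (x o i))
        (trans (sum-+ _ _) (cong₂ _+_ (trans (sum-+ _ _) (cong₂ _+_ (sym (*-sumʳ α w)) (sym (*-sumʳ β _)))) (sym (*-sumʳ γ _))))
        where
        expand : ∀ w α β γ x → w * (α + β * x + γ * (x * x)) ≡ w * α + w * x * β + w * (x * x) * γ
        expand = solve-∀
      -- With δ = a - b this is the identity Σ w (δ + Ωx - y)² = Ωδ² + Ω²S - Ωy², negative terms
      -- moved across. The cross term vanishes because Ωx - y has weighted mean 0.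
      perCoordinate : ∀ i → sum (λ o → w o * (a′ o i * a′ o i + b′ i * b′ i)) + (Ω * (2 * a i * b i) + Ω * (y i * y i))
        ≡ sum (λ o → w o * (2 * a′ o i * b′ i)) + (Ω * (a i * a i + b i * b i) + Ω * Ω * S i)
      perCoordinate i = begin-equality
        sum (λ o → w o * (a′ o i * a′ o i + b′ i * b′ i)) + (Ω * (2 * a i * b i) + Ω * (y i * y i))
          ≡⟨ cong (_+ (Ω * (2 * a i * b i) + Ω * (y i * y i)))
               (trans (sum-cong λ o → cong (w o *_) (square (a i) Ω (x o i) (b′ i)))
                      (linear (a i * a i + b′ i * b′ i) (2 * a i * Ω) (Ω * Ω) i)) ⟩
        Ω * (a i * a i + b′ i * b′ i) + y i * (2 * a i * Ω) + S i * (Ω * Ω) + (Ω * (2 * a i * b i) + Ω * (y i * y i))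
          ≡⟨ balance Ω (a i) (b i) (y i) (S i) ⟩
        Ω * (2 * a i * b′ i) + y i * (2 * Ω * b′ i) + S i * 0 + (Ω * (a i * a i + b i * b i) + Ω * Ω * S i)
          ≡⟨ cong (_+ (Ω * (a i * a i + b i * b i) + Ω * Ω * S i))
               (trans (sum-cong λ o → cong (w o *_) (product (a i) Ω (x o i) (b′ i)))
                      (linear (2 * a i * b′ i) (2 * Ω * b′ i) 0 i)) ⟨
        sum (λ o → w o * (2 * a′ o i * b′ i)) + (Ω * (a i * a i + b i * b i) + Ω * Ω * S i) ∎
        where
        square : ∀ a Ω x b → (a + Ω * x) * (a + Ω * x) + b * b ≡ a * a + b * b + 2 * a * Ω * x + Ω * Ω * (x * x)
        square = solve-∀
        product : ∀ a Ω x b → 2 * (a + Ω * x) * b ≡ 2 * a * b + 2 * Ω * b * x + 0 * (x * x)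
        product = solve-∀
        balance : ∀ Ω a b y S → Ω * (a * a + (b + y) * (b + y)) + y * (2 * a * Ω) + S * (Ω * Ω) + (Ω * (2 * a * b) + Ω * (y * y))
          ≡ Ω * (2 * a * (b + y)) + y * (2 * Ω * (b + y)) + S * 0 + (Ω * (a * a + b * b) + Ω * Ω * S)
        balance = solve-∀

    chooseAll : ∀ {C} (x : Fin C → Fin N → Fin M → ℕ) (s : Fin C → ℕ) (a b : Fin M → ℕ) Z →
      (∀ c o → sum (x c o) ≤ s c) → Close a b Z →
      ∃ λ (o : Fin C → Fin N) → Close (λ i → a i + Ω * sum (λ c → x c (o c) i)) (λ i → b i + sum (λ c → mean (x c) i))
                                      (Z + Ω * Ω * sum (λ c → s c * s c))
    chooseAll {zero} x s a b Z x≤s close = none , subst₂ _≤_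
      (sum-cong λ i → cong₂ (λ a b → a * a + b * b) (a≡ i) (b≡ i))
      (cong₂ _+_ (sum-cong λ i → cong₂ (λ a b → 2 * a * b) (a≡ i) (b≡ i))
                 (sym (trans (cong (λ t → Z + Ω * Ω * t) (sum-zero {0} {λ c → s c * s c} λ ())) (trans (cong (Z +_) (*-zeroʳ (Ω * Ω))) (+-identityʳ Z)))))
      close
      where
      none : Fin 0 → Fin N
      none ()
      a≡ : ∀ i → a i ≡ a i + Ω * sum {0} (λ c → x c (none c) i)
      a≡ i = sym (trans (cong (λ t → a i + Ω * t) (sum-zero {0} {λ c → x c (none c) i} λ ())) (trans (cong (a i +_) (*-zeroʳ Ω)) (+-identityʳ (a i))))
      b≡ : ∀ i → b i ≡ b i + sum {0} (λ c → mean (x c) i)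
      b≡ i = sym (trans (cong (b i +_) (sum-zero {0} λ ())) (+-identityʳ (b i)))
    chooseAll {suc C} x s a b Z x≤s close = o , subst₂ _≤_
      (sum-cong λ i → cong₂ (λ a b → a * a + b * b) (a≡ i) (b≡ i))
      (cong₂ _+_ (sum-cong λ i → cong₂ (λ a b → 2 * a * b) (a≡ i) (b≡ i)) Z≡)
      (proj₂ rest)
      where
      first = advance (x Fin.zero) a b Z (s Fin.zero) (x≤s Fin.zero) close
      rest = chooseAll (x ∘ Fin.suc) (s ∘ Fin.suc) (λ i → a i + Ω * x Fin.zero (proj₁ first) i) (λ i → b i + mean (x Fin.zero) i) _ (x≤s ∘ Fin.suc) (proj₂ first)
      o : Fin (suc C) → Fin N
      o Fin.zero = proj₁ first
      o (Fin.suc c) = proj₁ rest c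
      a≡ : ∀ i → a i + Ω * x Fin.zero (o Fin.zero) i + Ω * sum (λ c → x (Fin.suc c) (o (Fin.suc c)) i) ≡ a i + Ω * sum (λ c → x c (o c) i)
      a≡ i = trans (+-assoc (a i) _ _) (cong (a i +_) (trans (sym (*-distribˡ-+ Ω _ _)) (cong (Ω *_) (sym (sum-suc (λ c → x c (o c) i))))))
      b≡ : ∀ i → b i + mean (x Fin.zero) i + sum (λ c → mean (x (Fin.suc c)) i) ≡ b i + sum (λ c → mean (x c) i)
      b≡ i = trans (+-assoc (b i) _ _) (cong (b i +_) (sym (sum-suc (λ c → mean (x c) i))))
      Z≡ : Z + Ω * Ω * (s Fin.zero * s Fin.zero) + Ω * Ω * sum (λ c → s (Fin.suc c) * s (Fin.suc c)) ≡ Z + Ω * Ω * sum (λ c → s c * s c)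
      Z≡ = trans (+-assoc Z _ _) (cong (Z +_) (trans (sym (*-distribˡ-+ (Ω * Ω) _ _)) (cong (Ω * Ω *_) (sym (sum-suc (λ c → s c * s c))))))

    -- A single squared deviation is at most the sum of all, so no union bound over clusters is
    -- taken. That sum is at most Ω² Σ s², and Σ s² ≤ max s · Σ s ≤ (n/`Y`²) · n, which bounds each
    -- deviation by Ωn/`Y`.
    derandomise : ∀ {C} (x : Fin C → Fin N → Fin M → ℕ) (s : Fin C → ℕ) (Y n : ℕ) →
      (∀ c o → sum (x c o) ≤ s c) → (∀ c → Y * Y * s c ≤ n) → sum s ≤ n →
      ∃ λ (o : Fin C → Fin N) → ∀ i → Y * (Ω * sum (λ c → x c (o c) i)) ≤ Y * sum (λ c → mean (x c) i) + Ω * n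
    derandomise x s Y n x≤s small total = proj₁ chosen , bound
      where
      chosen = chooseAll x s (λ _ → 0) (λ _ → 0) 0 x≤s (≤-trans (≤-reflexive (sum-zero {M} λ _ → refl)) z≤n)
      L T : Fin M → ℕ
      L i = sum λ c → x c (proj₁ chosen c) i
      T i = sum λ c → mean (x c) i
      Z : ℕ
      Z = Ω * Ω * sum (λ c → s c * s c)
      close : ∀ i → Ω * L i * (Ω * L i) + T i * T i ≤ 2 * (Ω * L i) * T i + Z
      close = sum-excess _ _ Z (λ i → 2ab≤a²+b² (Ω * L i) (T i)) (proj₂ chosen)
      YYZ : Y * Y * Z ≤ Ω * n * (Ω * n)
      YYZ = begin
        Y * Y * (Ω * Ω * sum (λ c → s c * s c))
          ≡⟨ *-swap (Y * Y) (Ω * Ω) _ ⟩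
        Ω * Ω * (Y * Y * sum (λ c → s c * s c))
          ≡⟨ cong (Ω * Ω *_) (trans (*-sumˡ (Y * Y) _) (sum-cong λ c → sym (*-assoc (Y * Y) (s c) (s c)))) ⟩
        Ω * Ω * sum (λ c → Y * Y * s c * s c)
          ≤⟨ *-monoʳ-≤ (Ω * Ω) (sum-mono-≤ λ c → *-monoˡ-≤ (s c) (small c)) ⟩
        Ω * Ω * sum (λ c → n * s c)
          ≡⟨ cong (Ω * Ω *_) (*-sumˡ n s) ⟨
        Ω * Ω * (n * sum s)
          ≤⟨ *-monoʳ-≤ (Ω * Ω) (*-monoʳ-≤ n total) ⟩
        Ω * Ω * (n * n)
          ≡⟨ ring Ω n ⟩
        Ω * n * (Ω * n) ∎
        where
        ring : ∀ a b → a * a * (b * b) ≡ a * b * (a * b)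
        ring = solve-∀
      bound : ∀ i → Y * (Ω * L i) ≤ Y * T i + Ω * n
      bound i with ≤-total (Ω * L i) (T i)
      ... | inj₁ le = ≤-trans (*-monoʳ-≤ Y le) (m≤m+n _ _)
      ... | inj₂ ge = begin
        Y * (Ω * L i) ≡⟨ cong (Y *_) (m+[n∸m]≡n ge) ⟨
        Y * (T i + e) ≡⟨ *-distribˡ-+ Y (T i) e ⟩
        Y * T i + Y * e ≤⟨ +-monoʳ-≤ (Y * T i) (m²≤n²⇒m≤n (Y * e) (Ω * n) Ye²) ⟩
        Y * T i + Ω * n ∎
        where
        e = Ω * L i ∸ T i
        expand : ∀ t e → (t + e) * (t + e) + t * t ≡ 2 * (t + e) * t + e * e
        expand = solve-∀
        e²≤Z : e * e ≤ Z
        e²≤Z = +-cancelˡ-≤ (2 * (Ω * L i) * T i) _ _ (≤-trans (≤-reflexive (trans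
          (cong (λ a → 2 * a * T i + e * e) (sym (m+[n∸m]≡n ge))) (trans (sym (expand (T i) e))
          (cong (λ a → a * a + T i * T i) (m+[n∸m]≡n ge))))) (close i))
        Ye² : Y * e * (Y * e) ≤ Ω * n * (Ω * n)
        Ye² = ≤-trans (≤-reflexive (ring Y e)) (≤-trans (*-monoʳ-≤ (Y * Y) e²≤Z) YYZ)
          where
          ring : ∀ a b → a * b * (a * b) ≡ a * a * (b * b)
          ring = solve-∀

-- Connected components of H

module Components where

  open import Defs using (Graph; adj; eqFinB; Reach)
  open Summation
  open import Data.Bool as Bool using (Bool; true; if_then_else_)
  open import Data.Nat using (ℕ)
  open import Data.Fin as Fin using (Fin)
  open import Data.List using (List; []; _∷_; allFin; cartesianProduct)
  open import Data.List.Membership.Propositional using (_∈_)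
  open import Data.List.Membership.Propositional.Properties using (∈-allFin; ∈-cartesianProduct⁺)
  open import Data.List.Relation.Unary.Any using (here; there)
  open import Data.Product using (∃; _×_; _,_)
  open import Function using (_∘_; id)
  open import Relation.Nullary using (yes; no; contradiction)
  open import Relation.Binary.PropositionalEquality
  open import Relation.Binary.Construct.Closure.ReflexiveTransitive as Star using (Star; ε; _◅_; _◅◅_)

  module _ {m : ℕ} (H : Graph m) where

    Labelling : Set
    Labelling = Fin m → Fin m

    Sound : Labelling → Set
    Sound l = ∀ {u v} → l u ≡ l v → Reach H u v

    reach-sym : ∀ {u v} → Reach H u v → Reach H v u
    reach-sym = Star.reverse λ {u} {v} e → trans (Graph.sym H v u) e

    merge : Labelling → Fin m → Fin m → Labelling
    merge l x y z = if eqFinB (l z) (l y) then l x else l z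

    merge-coarser : ∀ l x y {u v} → l u ≡ l v → merge l x y u ≡ merge l x y v
    merge-coarser l x y e = cong (λ c → if eqFinB c (l y) then l x else c) e

    merge-identifies : ∀ l x y → merge l x y x ≡ merge l x y y
    merge-identifies l x y rewrite eqFinB-refl (l y) with l x Fin.≟ l y
    ... | yes _ = refl
    ... | no _ = refl

    merge-sound : ∀ l x y → adj H x y ≡ true → Sound l → Sound (merge l x y)
    merge-sound l x y xy sound {u} {v} e with l u Fin.≟ l y | l v Fin.≟ l y
    ... | yes a | yes b = sound a ◅◅ sound (sym b)
    ... | yes a | no _ = sound a ◅◅ reach-sym (xy ◅ ε) ◅◅ sound e
    ... | no _ | yes b = sound e ◅◅ (xy ◅ ε) ◅◅ sound (sym b)
    ... | no _ | no _ = sound e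

    -- `Reach` comes without a decision procedure, so classes are merged edge by edge over all pairs
    -- of vertices. Soundness makes a class a list of mutually reachable vertices, to which the
    -- bound in `InB` applies; joining keeps every edge within one class.
    label : ∀ ps l → Sound l → ∃ λ l′ → Sound l′ × (∀ {u v} → l u ≡ l v → l′ u ≡ l′ v) ×
      (∀ {x y} → (x , y) ∈ ps → adj H x y ≡ true → l′ x ≡ l′ y)
    label [] l sound = l , sound , id , λ ()
    label ((x , y) ∷ ps) l sound with adj H x y Bool.≟ true
    ... | yes xy with label ps (merge l x y) (merge-sound l x y xy sound)
    ... | l′ , sound′ , coarser , joins = l′ , sound′ , coarser ∘ merge-coarser l x y , λ where
      (here refl) _ → coarser (merge-identifies l x y)
      (there p) e → joins p e
    label ((x , y) ∷ ps) l sound | no ¬xy with label ps l sound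
    ... | l′ , sound′ , coarser , joins = l′ , sound′ , coarser , λ where
      (here refl) e → contradiction e ¬xy
      (there p) e → joins p e

    components : ∃ λ (l : Labelling) → Sound l × (∀ x y → adj H x y ≡ true → l x ≡ l y)
    components with label (cartesianProduct (allFin m) (allFin m)) id (λ { refl → ε })
    ... | l , sound , _ , joins = l , sound , λ x y → joins (∈-cartesianProduct⁺ (∈-allFin x) (∈-allFin y))

-- Between rationals and natural numbers

module Rationals where

  open import Defs using (ℕ→ℚ; _÷₀_)
  open import Data.Nat as ℕ using (ℕ; suc)
  import Data.Nat.Properties as ℕₚ
  open import Data.Nat.Coprimality using (1-coprimeTo) renaming (sym to coprime-sym)
  open import Data.Integer as ℤ using (+_)
  import Data.Integer.Properties as ℤₚ
  open import Data.Rational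
  open import Data.Rational.Properties
  open import Data.Rational.Solver using (module +-*-Solver)
  open import Data.Empty using (⊥-elim)
  open import Relation.Nullary using (yes; no)
  open import Relation.Binary.PropositionalEquality

  -- `ℕ→ℚ n` is normalised through a gcd and is stuck on a variable `n`; in this form numerator and
  -- denominator can be read off.
  whole : ℕ → ℚ
  whole n = mkℚ (+ n) 0 (coprime-sym (1-coprimeTo n))

  ℕ→ℚ≡whole : ∀ n → ℕ→ℚ n ≡ whole n
  ℕ→ℚ≡whole n = ↥p/↧p≡p (whole n)

  ℕ→ℚ-+ : ∀ m n → ℕ→ℚ (m ℕ.+ n) ≡ ℕ→ℚ m + ℕ→ℚ n
  ℕ→ℚ-+ m n = trans (cong (_/ 1) (cong₂ ℤ._+_ (sym (ℤₚ.*-identityʳ (+ m))) (sym (ℤₚ.*-identityʳ (+ n)))))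
    (sym (cong₂ _+_ (ℕ→ℚ≡whole m) (ℕ→ℚ≡whole n)))

  ℕ→ℚ-* : ∀ m n → ℕ→ℚ (m ℕ.* n) ≡ ℕ→ℚ m * ℕ→ℚ n
  ℕ→ℚ-* m n = trans (cong (_/ 1) (ℤₚ.pos-* m n)) (sym (cong₂ _*_ (ℕ→ℚ≡whole m) (ℕ→ℚ≡whole n)))

  ℕ→ℚ-mono : ∀ m n → m ℕ.≤ n → ℕ→ℚ m ≤ ℕ→ℚ n
  ℕ→ℚ-mono m n m≤n = subst₂ _≤_ (sym (ℕ→ℚ≡whole m)) (sym (ℕ→ℚ≡whole n)) (*≤* (ℤₚ.*-monoʳ-≤-nonNeg (+ 1) (ℤ.+≤+ m≤n)))

  ℕ→ℚ-cancel : ∀ m n → ℕ→ℚ m ≤ ℕ→ℚ n → m ℕ.≤ n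
  ℕ→ℚ-cancel m n le with subst₂ _≤_ (ℕ→ℚ≡whole m) (ℕ→ℚ≡whole n) le
  ... | *≤* h = ℤₚ.drop‿+≤+ (ℤₚ.*-cancelʳ-≤-pos (+ m) (+ n) (+ 1) h)

  ℕ→ℚ-injective : ∀ m n → ℕ→ℚ m ≡ ℕ→ℚ n → m ≡ n
  ℕ→ℚ-injective m n e = ℕₚ.≤-antisym (ℕ→ℚ-cancel m n (≤-reflexive e)) (ℕ→ℚ-cancel n m (≤-reflexive (sym e)))

  0≤ℕ→ℚ : ∀ n → 0ℚ ≤ ℕ→ℚ n
  0≤ℕ→ℚ n = ℕ→ℚ-mono 0 n ℕ.z≤n

  *-monoʳ : ∀ {p q} r → 0ℚ ≤ r → p ≤ q → p * r ≤ q * r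
  *-monoʳ r 0≤r p≤q = *-monoʳ-≤-nonNeg r ⦃ nonNegative 0≤r ⦄ p≤q

  *-monoˡ : ∀ {p q} r → 0ℚ ≤ r → p ≤ q → r * p ≤ r * q
  *-monoˡ r 0≤r p≤q = *-monoˡ-≤-nonNeg r ⦃ nonNegative 0≤r ⦄ p≤q

  ÷₀-* : ∀ p q → q ≢ 0ℚ → (p ÷₀ q) * q ≡ p
  ÷₀-* p q q≢0 with q ≟ 0ℚ
  ... | yes q≡0 = ⊥-elim (q≢0 q≡0)
  ... | no q≢0′ = trans (*-assoc p _ q) (trans (cong (p *_) (*-inverseˡ q ⦃ ≢-nonZero q≢0′ ⦄)) (*-identityʳ p))

  ℕ→ℚ≢0 : ∀ n → 1 ℕ.≤ n → ℕ→ℚ n ≢ 0ℚ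
  ℕ→ℚ≢0 (suc n) _ e with ℕ→ℚ-injective (suc n) 0 e
  ... | ()

  open +-*-Solver using (solve; con; _:=_; _:+_; _:*_; _:-_)

  -- χ_cr ≤ χ with denominators cleared; here α(H) = s/m and 1 − α(H) = r/m.
  clear-denominators : ∀ c q a b s r α → 1 ℕ.≤ r → 1 ℕ.≤ b → α ≡ ℕ→ℚ s ÷₀ ℕ→ℚ (s ℕ.+ r) →
    (ℕ→ℚ (suc c) - 1ℚ) + ((α * (ℕ→ℚ (suc c) - 1ℚ)) ÷₀ (1ℚ - α)) ≤ (ℕ→ℚ (suc q) - 1ℚ) + (ℕ→ℚ a ÷₀ ℕ→ℚ b) →
    c ℕ.* (s ℕ.+ r) ℕ.* b ℕ.≤ (q ℕ.* b ℕ.+ a) ℕ.* r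
  clear-denominators c q a b s r α 1≤r 1≤b α≡ le = ℕ→ℚ-cancel (c ℕ.* (s ℕ.+ r) ℕ.* b) ((q ℕ.* b ℕ.+ a) ℕ.* r) (subst₂ _≤_ lhs rhs
    (*-monoʳ (ℕ→ℚ r * ℕ→ℚ b) (subst (0ℚ ≤_) (ℕ→ℚ-* r b) (0≤ℕ→ℚ (r ℕ.* b))) le))
    where
    S = ℕ→ℚ s
    R = ℕ→ℚ r
    B = ℕ→ℚ b
    C = ℕ→ℚ c
    T = (α * (ℕ→ℚ (suc c) - 1ℚ)) ÷₀ (1ℚ - α)
    β = ℕ→ℚ a ÷₀ B
    pred : ∀ n → ℕ→ℚ (suc n) - 1ℚ ≡ ℕ→ℚ n
    pred n = trans (cong (_- 1ℚ) (ℕ→ℚ-+ 1 n)) (solve 1 (λ x → con 1ℚ :+ x :- con 1ℚ := x) refl (ℕ→ℚ n))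
    α* : α * (S + R) ≡ S
    α* = trans (cong₂ _*_ α≡ (sym (ℕ→ℚ-+ s r))) (÷₀-* S _ (ℕ→ℚ≢0 (s ℕ.+ r) (ℕₚ.≤-trans 1≤r (ℕₚ.m≤n+m r s))))
    1-α* : (1ℚ - α) * (S + R) ≡ R
    1-α* = trans (solve 3 (λ α s r → (con 1ℚ :- α) :* (s :+ r) := s :+ r :- α :* (s :+ r)) refl α S R)
      (trans (cong (λ t → S + R - t) α*) (solve 2 (λ s r → s :+ r :- s := r) refl S R))
    1-α≢0 : 1ℚ - α ≢ 0ℚ
    1-α≢0 e = ℕ→ℚ≢0 r 1≤r (trans (sym 1-α*) (trans (cong (_* (S + R)) e) (*-zeroˡ (S + R))))
    T* : T * (1ℚ - α) ≡ α * C
    T* = trans (÷₀-* _ _ 1-α≢0) (cong (α *_) (pred c))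
    β* : β * B ≡ ℕ→ℚ a
    β* = ÷₀-* (ℕ→ℚ a) B (ℕ→ℚ≢0 b 1≤b)
    lhs : ((ℕ→ℚ (suc c) - 1ℚ) + T) * (R * B) ≡ ℕ→ℚ (c ℕ.* (s ℕ.+ r) ℕ.* b)
    lhs = begin
      ((ℕ→ℚ (suc c) - 1ℚ) + T) * (R * B) ≡⟨ cong (λ x → (x + T) * (R * B)) (pred c) ⟩
      (C + T) * (R * B) ≡⟨ solve 4 (λ c t r b → (c :+ t) :* (r :* b) := c :* r :* b :+ t :* r :* b) refl C T R B ⟩
      C * R * B + T * R * B ≡⟨ cong (λ x → C * R * B + T * x * B) 1-α* ⟨
      C * R * B + T * ((1ℚ - α) * (S + R)) * B ≡⟨ cong (λ x → C * R * B + x * B) (sym (*-assoc T (1ℚ - α) (S + R))) ⟩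
      C * R * B + T * (1ℚ - α) * (S + R) * B ≡⟨ cong (λ x → C * R * B + x * (S + R) * B) T* ⟩
      C * R * B + α * C * (S + R) * B ≡⟨ solve 5 (λ c r b α m → c :* r :* b :+ α :* c :* m :* b := c :* r :* b :+ c :* (α :* m) :* b) refl C R B α (S + R) ⟩
      C * R * B + C * (α * (S + R)) * B ≡⟨ cong (λ x → C * R * B + C * x * B) α* ⟩
      C * R * B + C * S * B ≡⟨ solve 4 (λ c s r b → c :* r :* b :+ c :* s :* b := c :* (s :+ r) :* b) refl C S R B ⟩
      C * (S + R) * B ≡⟨ cong (λ x → C * x * B) (sym (ℕ→ℚ-+ s r)) ⟩
      C * ℕ→ℚ (s ℕ.+ r) * B ≡⟨ cong (_* B) (sym (ℕ→ℚ-* c (s ℕ.+ r))) ⟩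
      ℕ→ℚ (c ℕ.* (s ℕ.+ r)) * B ≡⟨ ℕ→ℚ-* (c ℕ.* (s ℕ.+ r)) b ⟨
      ℕ→ℚ (c ℕ.* (s ℕ.+ r) ℕ.* b) ∎
      where open ≡-Reasoning
    rhs : ((ℕ→ℚ (suc q) - 1ℚ) + β) * (R * B) ≡ ℕ→ℚ ((q ℕ.* b ℕ.+ a) ℕ.* r)
    rhs = begin
      ((ℕ→ℚ (suc q) - 1ℚ) + β) * (R * B) ≡⟨ cong (λ x → (x + β) * (R * B)) (pred q) ⟩
      (ℕ→ℚ q + β) * (R * B) ≡⟨ solve 4 (λ q t r b → (q :+ t) :* (r :* b) := (q :* b :+ t :* b) :* r) refl (ℕ→ℚ q) β R B ⟩
      (ℕ→ℚ q * B + β * B) * R ≡⟨ cong (λ x → (ℕ→ℚ q * B + x) * R) β* ⟩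
      (ℕ→ℚ q * B + ℕ→ℚ a) * R ≡⟨ cong (λ x → (x + ℕ→ℚ a) * R) (sym (ℕ→ℚ-* q b)) ⟩
      (ℕ→ℚ (q ℕ.* b) + ℕ→ℚ a) * R ≡⟨ cong (_* R) (sym (ℕ→ℚ-+ (q ℕ.* b) a)) ⟩
      ℕ→ℚ (q ℕ.* b ℕ.+ a) * R ≡⟨ ℕ→ℚ-* (q ℕ.* b ℕ.+ a) r ⟨
      ℕ→ℚ ((q ℕ.* b ℕ.+ a) ℕ.* r) ∎
      where open ≡-Reasoning

-- Averaging over permutations of the colours

module Mixing where

  open Summation
  open import Defs using (eqFinB)
  open import Data.Bool using (Bool; true; false; not)
  open import Data.Nat
  open import Data.Nat.Properties
  open import Data.Nat.DivMod using (_%_; _/_; m%n<n; m≡m%n+[m/n]*n)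
  open import Data.Nat.Tactic.RingSolver using (solve-∀)
  open import Data.Fin as Fin using (Fin; toℕ; fromℕ<; splitAt)
  open import Data.Fin.Properties as Finₚ using (toℕ<n; toℕ-fromℕ<; toℕ-injective; splitAt-↑ˡ; splitAt-↑ʳ)
  open import Data.Product using (_,_)
  open import Data.Sum using (_⊎_; inj₁; inj₂; [_,_]′)
  open import Data.Empty using (⊥-elim)
  open import Relation.Binary using (tri<; tri≈; tri>)
  open import Relation.Nullary using (¬_)
  open import Relation.Binary.PropositionalEquality

  rotate : ∀ {k} → Fin k → Fin k → Fin k
  rotate {suc k} r j = fromℕ< (m%n<n (toℕ j + toℕ r) (suc k))

  -- Equal remainders with different quotients would put the sums at least `suc k` apart and the
  -- larger summand out of range.
  +-%-injective : ∀ k x y r → x < suc k → y < suc k → (x + r) % suc k ≡ (y + r) % suc k → x ≡ y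
  +-%-injective k x y r x< y< e = go (<-cmp qx qy)
    where
    n = suc k
    qx = (x + r) / n
    qy = (y + r) / n
    ex : x + r ≡ (x + r) % n + qx * n
    ex = m≡m%n+[m/n]*n (x + r) n
    ey : y + r ≡ (x + r) % n + qy * n
    ey = trans (m≡m%n+[m/n]*n (y + r) n) (cong (_+ qy * n) (sym e))
    gap : ∀ {x y r ρ p q} → x + r ≡ ρ + p * n → y + r ≡ ρ + q * n → p < q → ¬ y < n
    gap {x} {y} {r} {ρ} {p} {q} ex ey p<q = ≤⇒≯ (+-cancelʳ-≤ r n y (begin
      n + r ≤⟨ +-monoʳ-≤ n (m≤n+m r x) ⟩
      n + (x + r) ≡⟨ cong (n +_) ex ⟩
      n + (ρ + p * n) ≡⟨ ring n ρ (p * n) ⟩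
      ρ + suc p * n ≤⟨ +-monoʳ-≤ ρ (*-monoˡ-≤ n p<q) ⟩
      ρ + q * n ≡⟨ ey ⟨
      y + r ∎))
      where
      open ≤-Reasoning
      ring : ∀ n ρ t → n + (ρ + t) ≡ ρ + (n + t)
      ring = solve-∀
    go : _ → x ≡ y
    go (tri< lt _ _) = ⊥-elim (gap {x} {y} {r} ex ey lt y<)
    go (tri> _ _ gt) = ⊥-elim (gap {y} {x} {r} ey ex gt x<)
    go (tri≈ _ eq _) = +-cancelʳ-≡ r x y (trans ex (trans (cong (λ t → (x + r) % n + t * n) eq) (sym ey)))

  rotate-% : ∀ {k} (r j : Fin (suc k)) → toℕ (rotate r j) ≡ (toℕ j + toℕ r) % suc k
  rotate-% {k} r j = toℕ-fromℕ< (m%n<n (toℕ j + toℕ r) (suc k))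

  rotate-injective : ∀ {k} (r i j : Fin k) → rotate r i ≡ rotate r j → i ≡ j
  rotate-injective {suc k} r i j e = toℕ-injective (+-%-injective k (toℕ i) (toℕ j) (toℕ r) (toℕ<n i) (toℕ<n j)
    (trans (sym (rotate-% r i)) (trans (cong toℕ e) (rotate-% r j))))

  rotate-injectiveˡ : ∀ {k} (j r s : Fin k) → rotate r j ≡ rotate s j → r ≡ s
  rotate-injectiveˡ {suc k} j r s e = toℕ-injective (+-%-injective k (toℕ r) (toℕ s) (toℕ j) (toℕ<n r) (toℕ<n s)
    (trans (cong (_% suc k) (+-comm (toℕ r) (toℕ j)))
      (trans (sym (rotate-% r j)) (trans (cong toℕ e) (trans (rotate-% s j) (cong (_% suc k) (+-comm (toℕ j) (toℕ s))))))))

  rotate⁺ : ∀ {q} → Fin q → Fin (suc q) → Fin (suc q)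
  rotate⁺ r Fin.zero = Fin.zero
  rotate⁺ r (Fin.suc j) = Fin.suc (rotate r j)

  rotate⁺-injective : ∀ {q} (r : Fin q) i j → rotate⁺ r i ≡ rotate⁺ r j → i ≡ j
  rotate⁺-injective r Fin.zero Fin.zero e = refl
  rotate⁺-injective r (Fin.suc i) (Fin.suc j) e = cong Fin.suc (rotate-injective r i j (Finₚ.suc-injective e))

  partSize : ∀ {q} → ℕ → ℕ → Fin (suc q) → ℕ
  partSize a b Fin.zero = a
  partSize a b (Fin.suc _) = b

  -- A weighted family of bijections from colours to the parts of B_χ under which
  -- the average load of every part is proportional to its size.
  record Balanced {m q : ℕ} (a b : ℕ) (φ : Fin m → Fin (suc q)) : Set where
    field
      N : ℕ
      w : Fin N → ℕ
      perm : Fin N → Fin (suc q) → Fin (suc q)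
      perm-injective : ∀ o i j → perm o i ≡ perm o j → i ≡ j
      1≤total : 1 ≤ sum w
      balanced : ∀ P → (a + q * b) * sum (λ o → w o * sum (λ x → ⟦ eqFinB (perm o (φ x)) P ⟧)) ≤ sum w * m * partSize a b P

  module _ {m q : ℕ} (φ : Fin m → Fin (suc q)) where

    S₀ S₁ : ℕ
    S₀ = sum λ x → ⟦ eqFinB (φ x) Fin.zero ⟧
    S₁ = sum λ x → ⟦ not (eqFinB (φ x) Fin.zero) ⟧

    S₀+S₁ : S₀ + S₁ ≡ m
    S₀+S₁ = trans (sym (sum-+ _ _)) (trans (sum-cong λ x → bool (eqFinB (φ x) Fin.zero)) (trans (sum-const m 1) (*-identityʳ m)))
      where
      bool : ∀ b → ⟦ b ⟧ + ⟦ not b ⟧ ≡ 1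
      bool true = refl
      bool false = refl

  module _ {m q : ℕ} (φ : Fin m → Fin (suc q)) (α β : ℕ) where

    weight : Fin (q + suc q) → ℕ
    weight o = [ (λ _ → α) , (λ _ → β) ]′ (splitAt q o)

    permOf : Fin q ⊎ Fin (suc q) → Fin (suc q) → Fin (suc q)
    permOf = [ rotate⁺ , rotate ]′

    mixPerm : Fin (q + suc q) → Fin (suc q) → Fin (suc q)
    mixPerm o = permOf (splitAt q o)

    mixPerm-injective : ∀ o i j → mixPerm o i ≡ mixPerm o j → i ≡ j
    mixPerm-injective o i j = go (splitAt q o)
      where
      go : ∀ s → permOf s i ≡ permOf s j → i ≡ j
      go (inj₁ r) = rotate⁺-injective r i j
      go (inj₂ r) = rotate-injective r i j

    split-sum : ∀ (g : (Fin (suc q) → Fin (suc q)) → ℕ) →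
      sum (λ o → weight o * g (mixPerm o)) ≡ α * sum (λ r → g (rotate⁺ r)) + β * sum (λ r → g (rotate r))
    split-sum g = trans (sum-++ q _) (cong₂ _+_
      (trans (sum-cong λ r → cong (λ s → [ (λ _ → α) , (λ _ → β) ]′ s * g (permOf s)) (splitAt-↑ˡ q r (suc q))) (sym (*-sumˡ α _)))
      (trans (sum-cong λ r → cong (λ s → [ (λ _ → α) , (λ _ → β) ]′ s * g (permOf s)) (splitAt-↑ʳ q (suc q) r)) (sym (*-sumˡ β _))))

    total-weight : sum weight ≡ α * q + β * suc q
    total-weight = trans (sum-cong λ o → sym (*-identityʳ (weight o))) (trans (split-sum (λ _ → 1))
      (cong₂ (λ s t → α * s + β * t) (trans (sum-const q 1) (*-identityʳ q)) (trans (sum-const (suc q) 1) (*-identityʳ (suc q)))))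

    hits : Fin (suc q) → (Fin (suc q) → Fin (suc q)) → ℕ
    hits P π = sum λ x → ⟦ eqFinB (π (φ x)) P ⟧

    rotate-hits : ∀ P → sum (λ r → hits P (rotate r)) ≤ m
    rotate-hits P = begin
      sum (λ r → sum λ x → ⟦ eqFinB (rotate r (φ x)) P ⟧) ≡⟨ sum-comm _ ⟩
      sum (λ x → sum λ r → ⟦ eqFinB (rotate r (φ x)) P ⟧) ≤⟨ sum-mono-≤ (λ x → sum-injective≤1 (λ r → rotate r (φ x)) (rotate-injectiveˡ (φ x)) P) ⟩
      sum (λ (x : Fin m) → 1) ≡⟨ trans (sum-const m 1) (*-identityʳ m) ⟩
      m ∎
      where open ≤-Reasoning

    rotate⁺-hits-zero : sum (λ r → hits Fin.zero (rotate⁺ r)) ≡ q * S₀ φ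
    rotate⁺-hits-zero = trans (sum-cong λ r → sum-cong λ x → cong ⟦_⟧ (zero-fixed r (φ x))) (sum-const q (S₀ φ))
      where
      zero-fixed : ∀ r c → eqFinB (rotate⁺ r c) Fin.zero ≡ eqFinB c Fin.zero
      zero-fixed r Fin.zero = refl
      zero-fixed r (Fin.suc c) = refl

    rotate⁺-hits-suc : ∀ P → sum (λ r → hits (Fin.suc P) (rotate⁺ r)) ≤ S₁ φ
    rotate⁺-hits-suc P = ≤-trans (≤-reflexive (sum-comm _)) (sum-mono-≤ λ x → bound (φ x))
      where
      bound : ∀ c → sum (λ r → ⟦ eqFinB (rotate⁺ r c) (Fin.suc P) ⟧) ≤ ⟦ not (eqFinB c Fin.zero) ⟧
      bound Fin.zero = ≤-reflexive (sum-zero λ r → refl)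
      bound (Fin.suc j) = sum-injective≤1 (λ r → Fin.suc (rotate r j)) (λ r s e → rotate-injectiveˡ j r s (Finₚ.suc-injective e)) (Fin.suc P)

    -- α weights each of the q rotations fixing colour 0, β each of the q + 1 full rotations. The
    -- former put class 0 into part 0 all q times and any other vertex once into each other part;
    -- the latter put every vertex once into every part. The two inequalities keep part 0 and the
    -- other parts within their shares.
    mix : ∀ a b → 1 ≤ α * q + β * suc q →
      (a + q * b) * (α * (q * S₀ φ) + β * m) ≤ (α * q + β * suc q) * m * a →
      (a + q * b) * (α * S₁ φ + β * m) ≤ (α * q + β * suc q) * m * b →
      Balanced a b φ
    mix a b pos special ordinary = record
      { N = q + suc q ; w = weight ; perm = mixPerm ; perm-injective = mixPerm-injective
      ; 1≤total = subst (1 ≤_) (sym total-weight) pos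
      ; balanced = bal }
      where
      open ≤-Reasoning
      bal : ∀ P → (a + q * b) * sum (λ o → weight o * hits P (mixPerm o)) ≤ sum weight * m * partSize a b P
      bal Fin.zero = begin
        (a + q * b) * sum (λ o → weight o * hits Fin.zero (mixPerm o))
          ≡⟨ cong ((a + q * b) *_) (split-sum (hits Fin.zero)) ⟩
        (a + q * b) * (α * sum (λ r → hits Fin.zero (rotate⁺ r)) + β * sum (λ r → hits Fin.zero (rotate r)))
          ≤⟨ *-monoʳ-≤ (a + q * b) (+-mono-≤ (*-monoʳ-≤ α (≤-reflexive rotate⁺-hits-zero)) (*-monoʳ-≤ β (rotate-hits Fin.zero))) ⟩
        (a + q * b) * (α * (q * S₀ φ) + β * m)
          ≤⟨ special ⟩
        (α * q + β * suc q) * m * a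
          ≡⟨ cong (λ t → t * m * a) total-weight ⟨
        sum weight * m * a ∎
      bal (Fin.suc P) = begin
        (a + q * b) * sum (λ o → weight o * hits (Fin.suc P) (mixPerm o))
          ≡⟨ cong ((a + q * b) *_) (split-sum (hits (Fin.suc P))) ⟩
        (a + q * b) * (α * sum (λ r → hits (Fin.suc P) (rotate⁺ r)) + β * sum (λ r → hits (Fin.suc P) (rotate r)))
          ≤⟨ *-monoʳ-≤ (a + q * b) (+-mono-≤ (*-monoʳ-≤ α (rotate⁺-hits-suc P)) (*-monoʳ-≤ β (rotate-hits (Fin.suc P)))) ⟩
        (a + q * b) * (α * S₁ φ + β * m)
          ≤⟨ ordinary ⟩
        (α * q + β * suc q) * m * b
          ≡⟨ cong (λ t → t * m * b) total-weight ⟨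
        sum weight * m * b ∎

  -- If a < b, mixing the permutations that fix colour 0 (weight m(b − a)) with all rotations
  -- (weight am − (a + qb)S₀) gives part 0 exactly its share am/(a + qb).
  balance : ∀ {m q} a b (φ : Fin m → Fin (suc q)) → 1 ≤ m → 1 ≤ q → a ≤ b →
    (a + q * b) * S₀ φ ≤ a * m → Balanced a b φ
  balance {m} {q} a b φ 1≤m 1≤q a≤b skew with m≤n⇒∃[o]m+o≡n a≤b
  -- If a = b, the weight m(b - a) is 0 and the other weight may vanish as well, which would leave
  -- total weight 0. Uniform weights on the full rotations serve instead.
  ... | zero , eq = subst (λ b → Balanced a b φ) eq (mix φ 0 1 a (a + 0) (s≤s z≤n) (≤-reflexive (ring a q m)) (≤-reflexive (ring′ a q m)))
    where
    ring : ∀ a q m → (a + q * (a + 0)) * (0 + 1 * m) ≡ (0 + 1 * suc q) * m * a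
    ring = solve-∀
    ring′ : ∀ a q m → (a + q * (a + 0)) * (0 + 1 * m) ≡ (0 + 1 * suc q) * m * (a + 0)
    ring′ = solve-∀
  ... | suc d′ , refl with m≤n⇒∃[o]m+o≡n skew
  ... | e , We = mix φ (m * d) e a (a + d) (≤-trans (*-mono-≤ (*-mono-≤ 1≤m (s≤s z≤n)) 1≤q) (m≤m+n (m * d * q) (e * suc q)))
      (≤-reflexive special) (≤-reflexive ordinary)
    where
    open ≡-Reasoning
    d = suc d′
    W = a + q * (a + d)
    special : W * (m * d * (q * S₀ φ) + e * m) ≡ (m * d * q + e * suc q) * m * a
    special = +-cancelʳ-≡ (m * d * q * e) _ _ (begin
      W * (m * d * (q * S₀ φ) + e * m) + m * d * q * e ≡⟨ left W m d q (S₀ φ) e ⟩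
      m * d * q * (W * S₀ φ + e) + W * (e * m) ≡⟨ cong (λ t → m * d * q * t + W * (e * m)) We ⟩
      m * d * q * (a * m) + W * (e * m) ≡⟨ right a m d q e ⟩
      (m * d * q + e * suc q) * m * a + m * d * q * e ∎)
      where
      left : ∀ W m d q s e → W * (m * d * (q * s) + e * m) + m * d * q * e ≡ m * d * q * (W * s + e) + W * (e * m)
      left = solve-∀
      right : ∀ a m d q e → m * d * q * (a * m) + (a + q * (a + d)) * (e * m) ≡ (m * d * q + e * suc q) * m * a + m * d * q * e
      right = solve-∀
    WS₁ : W * S₁ φ + a * m ≡ W * m + e
    WS₁ = begin
      W * S₁ φ + a * m ≡⟨ cong (W * S₁ φ +_) We ⟨
      W * S₁ φ + (W * S₀ φ + e) ≡⟨ regroup W (S₁ φ) (S₀ φ) e ⟩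
      W * (S₀ φ + S₁ φ) + e ≡⟨ cong (λ t → W * t + e) (S₀+S₁ φ) ⟩
      W * m + e ∎
      where
      regroup : ∀ W s t e → W * s + (W * t + e) ≡ W * (t + s) + e
      regroup = solve-∀
    ordinary : W * (m * d * S₁ φ + e * m) ≡ (m * d * q + e * suc q) * m * (a + d)
    ordinary = +-cancelʳ-≡ (m * d * (a * m)) _ _ (begin
      W * (m * d * S₁ φ + e * m) + m * d * (a * m) ≡⟨ left W m d (S₁ φ) a e ⟩
      m * d * (W * S₁ φ + a * m) + W * (e * m) ≡⟨ cong (λ t → m * d * t + W * (e * m)) WS₁ ⟩
      m * d * (W * m + e) + W * (e * m) ≡⟨ right a m d q e ⟩
      (m * d * q + e * suc q) * m * (a + d) + m * d * (a * m) ∎)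
      where
      left : ∀ W m d s a e → W * (m * d * s + e * m) + m * d * (a * m) ≡ m * d * (W * s + a * m) + W * (e * m)
      left = solve-∀
      right : ∀ a m d q e → m * d * ((a + q * (a + d)) * m + e) + (a + q * (a + d)) * (e * m) ≡ (m * d * q + e * suc q) * m * (a + d) + m * d * (a * m)
      right = solve-∀

-- From the critical chromatic number to a skewed colouring

module Colouring where

  open Summation
  open Regularity using (size)
  open Rationals
  open Mixing using (S₀)
  open import Defs using (Graph; adj; eqFinB; count; cons; allMaps; allB; isProperB; minimumℚ; ℕ→ℚ; _÷₀_; ProperColouring; alphaH; smallestClassProportion; IsChromaticNumber; InJ)
  open import Data.Bool as Bool using (Bool; true; false; _∧_; not; if_then_else_)
  open import Data.Nat
  open import Data.Nat.Properties
  open import Data.Nat.Tactic.RingSolver using (solve-∀)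
  open import Data.Fin as Fin using (Fin; punchOut; inject≤)
  open import Data.Fin.Properties as Finₚ using (punchOut-injective; inject≤-injective; any?)
  open import Data.List as List using (List; []; _∷_; foldr; allFin; filter)
  import Data.List as L
  open import Data.List.Membership.Propositional using (_∈_)
  open import Data.List.Membership.Propositional.Properties using (∈-map⁺; ∈-map⁻; ∈-filter⁺; ∈-filter⁻; ∈-allFin; ∈-concatMap⁺)
  open import Data.List.Relation.Unary.Any as Any using (here; there)
  open import Data.Product using (∃; _×_; _,_; proj₁; proj₂)
  open import Data.Sum using (inj₁; inj₂)
  open import Data.Empty using (⊥-elim)
  open import Data.Rational as ℚ using (ℚ; 0ℚ; 1ℚ)
  import Data.Rational.Properties as ℚₚ
  open import Function using (_∘_)
  open import Relation.Binary using (tri<; tri≈; tri>)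
  open import Relation.Nullary using (yes; no; ¬_; contradiction)
  open import Relation.Binary.PropositionalEquality

  allB-sound : ∀ {n} (p : Fin n → Bool) → allB p ≡ true → ∀ i → p i ≡ true
  allB-sound {n} p h i = go (allFin n) h (∈-allFin i)
    where
    go : ∀ xs → foldr (λ i r → p i ∧ r) true xs ≡ true → i ∈ xs → p i ≡ true
    go (x ∷ xs) h i∈ with p x in eq
    go (x ∷ xs) h (here refl) | true = eq
    go (x ∷ xs) h (there i∈) | true = go xs h i∈

  allB-complete : ∀ {n} (p : Fin n → Bool) → (∀ i → p i ≡ true) → allB p ≡ true
  allB-complete {n} p h = go (allFin n)
    where
    go : ∀ xs → foldr (λ i r → p i ∧ r) true xs ≡ true
    go [] = refl
    go (x ∷ xs) rewrite h x = go xs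

  module _ {m : ℕ} (H : Graph m) where

    isProperB-sound : ∀ c col → isProperB H c col ≡ true → ProperColouring H c col
    isProperB-sound c col h u v uv e with allB-sound _ (allB-sound _ h u) v
    ... | uvOK rewrite uv | e | eqFinB-refl (col v) with uvOK
    ... | ()

    isProperB-complete : ∀ c col → ProperColouring H c col → isProperB H c col ≡ true
    isProperB-complete c col proper = allB-complete _ λ u → allB-complete _ λ v → go u v
      where
      go : ∀ u v → (if adj H u v then not (eqFinB (col u) (col v)) else true) ≡ true
      go u v with adj H u v in uv
      ... | false = refl
      ... | true = cong not (≢⇒eqFinB _ _ (proper u v uv))

  allMaps-complete : ∀ m {n} (f : Fin m → Fin n) → ∃ λ g → g ∈ allMaps m n × (∀ i → g i ≡ f i)
  allMaps-complete zero f = _ , here refl , λ ()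
  allMaps-complete (suc m) {n} f with allMaps-complete m (f ∘ Fin.suc)
  ... | g , g∈ , eq = cons (f Fin.zero) g ,
    ∈-concatMap⁺ (λ h → L.map (λ i → cons i h) (allFin n))
      (Any.map (λ { refl → ∈-map⁺ (λ i → cons i g) (∈-allFin (f Fin.zero)) }) g∈) ,
    λ { Fin.zero → refl ; (Fin.suc i) → eq i }

  minimumℚ-∈ : ∀ d {y} xs → y ∈ xs → minimumℚ d xs ∈ xs
  minimumℚ-∈ d (x ∷ xs) _ = go xs
    where
    skip : ∀ {z y} {ys : List ℚ} → z ∈ x ∷ ys → z ∈ x ∷ y ∷ ys
    skip (here e) = here e
    skip (there z∈) = there (there z∈)
    go : ∀ ys → foldr ℚ._⊓_ x ys ∈ x ∷ ys
    go [] = here refl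
    go (y ∷ ys) with ℚₚ.⊓-sel y (foldr ℚ._⊓_ x ys)
    ... | inj₁ e = subst (_∈ x ∷ y ∷ ys) (sym e) (there (here refl))
    ... | inj₂ e = subst (_∈ x ∷ y ∷ ys) (sym e) (skip (go ys))

  minimumℚ-map : ∀ {A : Set} d (f : A → ℚ) {y} xs → y ∈ xs → ∃ λ x → x ∈ xs × minimumℚ d (L.map f xs) ≡ f x
  minimumℚ-map d f xs y∈ = ∈-map⁻ f (minimumℚ-∈ d (L.map f xs) (∈-map⁺ f y∈))

  another : ∀ {q} → 1 ≤ q → (c : Fin (suc q)) → ∃ λ c′ → c ≢ c′
  another {suc q} _ Fin.zero = Fin.suc Fin.zero , λ ()
  another {suc q} _ (Fin.suc c) = Fin.zero , λ ()

  relabel : ∀ {q} → Fin (suc q) → Fin (suc q) → Fin (suc q)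
  relabel i c with i Fin.≟ c
  ... | yes _ = Fin.zero
  ... | no i≢c = Fin.suc (punchOut i≢c)

  relabel-injective : ∀ {q} (i c c′ : Fin (suc q)) → relabel i c ≡ relabel i c′ → c ≡ c′
  relabel-injective i c c′ e with i Fin.≟ c | i Fin.≟ c′
  ... | yes refl | yes refl = refl
  ... | no p | no p′ = punchOut-injective p p′ (Finₚ.suc-injective e)

  relabel-zero : ∀ {q} (i c : Fin (suc q)) → eqFinB (relabel i c) Fin.zero ≡ eqFinB c i
  relabel-zero i c with i Fin.≟ c
  ... | yes refl = sym (eqFinB-refl i)
  ... | no i≢c = sym (≢⇒eqFinB c i (i≢c ∘ sym))

  module _ {m : ℕ} (H : Graph m) where

    classSize : ∀ {c} → (Fin m → Fin c) → Fin c → ℕ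
    classSize col i = size λ u → eqFinB (col u) i

    class-nonempty : ∀ {c} (col : Fin m → Fin (suc c)) → ProperColouring H (suc c) col →
      (∀ j → j < suc c → ∀ col → ¬ ProperColouring H j col) → ∀ i → ∃ λ u → col u ≡ i
    class-nonempty {c} col proper minimal i with any? (λ u → col u Fin.≟ i)
    ... | yes found = found
    ... | no none = ⊥-elim (minimal c ≤-refl (λ u → punchOut (missed u))
          λ u v uv e → proper u v uv (punchOut-injective (missed u) (missed v) e))
      where
      missed : ∀ u → i ≢ col u
      missed u e = none (u , sym e)

    1≤classSize : ∀ {c} (col : Fin m → Fin c) i → (∃ λ u → col u ≡ i) → 1 ≤ classSize col i
    1≤classSize col i (u , e) = ≤-trans (≤-reflexive (cong ⟦_⟧ (sym (trans (cong (λ j → eqFinB j i) e) (eqFinB-refl i)))))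
      (term≤sum (λ u → ⟦ eqFinB (col u) i ⟧) u)

    classSize-two : ∀ {c} (col : Fin m → Fin c) i j → i ≢ j → classSize col i + classSize col j ≤ m
    classSize-two col i j i≢j = begin
      classSize col i + classSize col j ≡⟨ sum-+ _ _ ⟨
      sum (λ u → ⟦ eqFinB (col u) i ⟧ + ⟦ eqFinB (col u) j ⟧) ≤⟨ sum-mono-≤ (λ u → bound (col u)) ⟩
      sum (λ (u : Fin m) → 1) ≡⟨ trans (sum-const m 1) (*-identityʳ m) ⟩
      m ∎
      where
      open ≤-Reasoning
      bound : ∀ c → ⟦ eqFinB c i ⟧ + ⟦ eqFinB c j ⟧ ≤ 1
      bound c with c Fin.≟ i | c Fin.≟ j
      ... | yes refl | yes refl = ⊥-elim (i≢j refl)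
      ... | yes _ | no _ = s≤s z≤n
      ... | no _ | yes _ = s≤s z≤n
      ... | no _ | no _ = z≤n

    smallest-attained : ∀ c (col : Fin m → Fin (suc c)) →
      ∃ λ i → smallestClassProportion (suc c) col ≡ ℕ→ℚ (classSize col i) ÷₀ ℕ→ℚ m
    smallest-attained c col = proj₁ attained , trans (proj₂ (proj₂ attained))
      (cong (λ s → ℕ→ℚ s ÷₀ ℕ→ℚ m) (count≡sum (λ u → eqFinB (col u) (proj₁ attained))))
      where
      attained = minimumℚ-map 0ℚ (λ i → ℕ→ℚ (count (λ u → eqFinB (col u) i)) ÷₀ ℕ→ℚ m) (allFin (suc c)) (∈-allFin Fin.zero)

    -- The given colouring, or rather a pointwise equal copy of it in `allMaps`, makes the list
    -- non-empty, so its minimum is attained and is not the default 0.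
    alpha-attained : ∀ c → ∃ (ProperColouring H (suc c)) → ∃ λ col → ProperColouring H (suc c) col ×
      ∃ λ i → alphaH H (suc c) ≡ ℕ→ℚ (classSize col i) ÷₀ ℕ→ℚ m
    alpha-attained c (col₀ , proper₀) = proj₁ attained ,
      isProperB-sound H (suc c) (proj₁ attained) (proj₂ (∈-filter⁻ proper? {xs = allMaps m (suc c)} (proj₁ (proj₂ attained)))) ,
      proj₁ smallest , trans (proj₂ (proj₂ attained)) (proj₂ smallest)
      where
      proper? : ∀ col → _
      proper? col = isProperB H (suc c) col Bool.≟ true
      complete = allMaps-complete m col₀
      col₁ = proj₁ complete
      proper₁ : ProperColouring H (suc c) col₁
      proper₁ u v uv e = proper₀ u v uv (trans (sym (proj₂ (proj₂ complete) u)) (trans e (proj₂ (proj₂ complete) v)))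
      attained = minimumℚ-map 0ℚ (smallestClassProportion (suc c)) (filter proper? (allMaps m (suc c)))
        (∈-filter⁺ proper? (proj₁ (proj₂ complete)) (isProperB-complete H (suc c) col₁ proper₁))
      smallest = smallest-attained c (proj₁ attained)

    Skewed : (q a b : ℕ) → Set
    Skewed q a b = ∃ λ (φ : Fin m → Fin (suc q)) → ProperColouring H (suc q) φ × (a + q * b) * S₀ φ ≤ a * m

    -- At most q colours occur; shifting them past 0 leaves class 0 empty.
    fewer-colours : ∀ {c q} a b (col : Fin m → Fin (suc c)) → ProperColouring H (suc c) col → c < q → Skewed q a b
    fewer-colours {c} {q} a b col proper c<q = (λ u → Fin.suc (inject≤ (col u) c<q)) ,
      (λ u v uv e → proper u v uv (inject≤-injective c<q c<q _ _ (Finₚ.suc-injective e))) ,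
      ≤-trans (≤-reflexive (trans (cong ((a + q * b) *_) (sum-zero {m} λ u → refl)) (*-zeroʳ (a + q * b)))) z≤n

    same-colours : ∀ {q} a b (col : Fin m → Fin (suc q)) → ProperColouring H (suc q) col → ∀ i →
      (a + q * b) * classSize col i ≤ a * m → Skewed q a b
    same-colours {q} a b col proper i le = (λ u → relabel i (col u)) ,
      (λ u v uv e → proper u v uv (relabel-injective i _ _ e)) ,
      subst (λ s → (a + q * b) * s ≤ a * m) (sum-cong λ u → cong ⟦_⟧ (sym (relabel-zero i (col u)))) le

    -- The last inequality is χ_cr(H) ≤ χ with denominators cleared, for c + 1 colours and a class
    -- of size s = m - r. With fewer colours than parts, class 0 can be left empty; with equally
    -- many, the inequality rearranges to the claim; with more, it would give m ≤ r, contrary to s ≥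
    -- 1.
    skewed-by-count : ∀ q a b c → 1 ≤ b → a ≤ b → (col : Fin m → Fin (suc c)) → ProperColouring H (suc c) col →
      ∀ i r → 1 ≤ classSize col i → classSize col i + r ≡ m → c * m * b ≤ (q * b + a) * r → Skewed q a b
    skewed-by-count q a b c 1≤b a≤b col proper i r 1≤s s+r≡m bound = go (<-cmp c q)
      where
      s = classSize col i
      open ≤-Reasoning
      go : _ → Skewed q a b
      go (tri< c<q _ _) = fewer-colours a b col proper c<q
      go (tri≈ _ refl _) = same-colours a b col proper i (+-cancelˡ-≤ (q * m * b) _ _ (begin
        q * m * b + (a + q * b) * s ≤⟨ +-monoˡ-≤ _ bound ⟩
        (q * b + a) * r + (a + q * b) * s ≡⟨ ring q b a r s ⟩
        (q * b + a) * (s + r) ≡⟨ cong ((q * b + a) *_) s+r≡m ⟩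
        (q * b + a) * m ≡⟨ ring′ q b a m ⟩
        q * m * b + a * m ∎))
        where
        ring : ∀ q b a r s → (q * b + a) * r + (a + q * b) * s ≡ (q * b + a) * (s + r)
        ring = solve-∀
        ring′ : ∀ q b a m → (q * b + a) * m ≡ q * m * b + a * m
        ring′ = solve-∀
      go (tri> _ _ q<c) = contradiction 1≤s (<⇒≱ (s≤s (≤-reflexive s≡0)))
        where
        m≤r : m ≤ r
        m≤r = *-cancelˡ-≤ (suc q * b) ⦃ m*n≢0 (suc q) b ⦃ _ ⦄ ⦃ >-nonZero 1≤b ⦄ ⦄ (begin
          suc q * b * m ≡⟨ ring (suc q) b m ⟩
          suc q * m * b ≤⟨ *-monoˡ-≤ b (*-monoˡ-≤ m q<c) ⟩
          c * m * b ≤⟨ bound ⟩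
          (q * b + a) * r ≤⟨ *-monoˡ-≤ r (+-monoʳ-≤ (q * b) a≤b) ⟩
          (q * b + b) * r ≡⟨ cong (_* r) (+-comm (q * b) b) ⟩
          suc q * b * r ∎)
          where
          ring : ∀ x b m → x * b * m ≡ x * m * b
          ring = solve-∀
        s≡0 : s ≡ 0
        s≡0 = n≤0⇒n≡0 (+-cancelʳ-≤ r s 0 (≤-trans (≤-reflexive s+r≡m) m≤r))

    one-colour : ∀ q a b → (col : Fin m → Fin 1) → ProperColouring H 1 col → Skewed q a b
    one-colour zero a b col proper = col , proper ,
      *-mono-≤ (≤-reflexive (+-identityʳ a)) (≤-trans (sum-mono-≤ λ u → ⟦⟧≤1 _) (≤-reflexive (trans (sum-const m 1) (*-identityʳ m))))
    one-colour (suc q) a b col proper = fewer-colours a b col proper (s≤s z≤n)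

    -- Minimality of the number of colours makes a second class non-empty. So r = m - s is positive,
    -- 1 - α is not 0, and the quotient in `chiCr` is a genuine one.
    several-colours : ∀ q a b c → 1 ≤ b → a ≤ b → IsChromaticNumber H (suc (suc c)) →
      (∀ s r → 1 ≤ r → s + r ≡ m → alphaH H (suc (suc c)) ≡ ℕ→ℚ s ÷₀ ℕ→ℚ (s + r) → suc c * (s + r) * b ≤ (q * b + a) * r) →
      Skewed q a b
    several-colours q a b c 1≤b a≤b (∃col , minimal) χ≤ =
      skewed-by-count q a b (suc c) 1≤b a≤b col proper i r 1≤s s+r≡m
        (subst (λ m → suc c * m * b ≤ (q * b + a) * r) s+r≡m
          (χ≤ s r (m<n⇒0<n∸m s<m) s+r≡m (trans (proj₂ (proj₂ (proj₂ attained))) (cong (λ m → ℕ→ℚ s ÷₀ ℕ→ℚ m) (sym s+r≡m)))))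
      where
      attained = alpha-attained (suc c) ∃col
      col = proj₁ attained
      proper : ProperColouring H (suc (suc c)) col
      proper = proj₁ (proj₂ attained)
      i : Fin (suc (suc c))
      i = proj₁ (proj₂ (proj₂ attained))
      s r : ℕ
      s = classSize col i
      r = m ∸ s
      1≤s : 1 ≤ s
      1≤s = 1≤classSize col i (class-nonempty col proper minimal i)
      j : Fin (suc (suc c))
      j = proj₁ (another (s≤s z≤n) i)
      s<m : suc s ≤ m
      s<m = ≤-trans (≤-trans (≤-reflexive (+-comm 1 s)) (+-monoʳ-≤ s (1≤classSize col j (class-nonempty col proper minimal j))))
        (classSize-two col i j (proj₂ (another (s≤s z≤n) i)))
      s+r≡m : s + r ≡ m
      s+r≡m = m+[n∸m]≡n (<⇒≤ s<m)

    skewed-colouring : ∀ q a b → 1 ≤ m → 1 ≤ b → a ≤ b →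
      InJ ((ℕ→ℚ (suc q) ℚ.- 1ℚ) ℚ.+ (ℕ→ℚ a ÷₀ ℕ→ℚ b)) H → Skewed q a b
    skewed-colouring q a b 1≤m 1≤b a≤b (zero , ((col , _) , _) , _) with col (Fin.fromℕ< 1≤m)
    ... | ()
    -- The only class is all of H, so 1 - α is 0 and the quotient in `chiCr` takes the default value
    -- of `÷₀`; the claim comes from the colouring itself.
    skewed-colouring q a b 1≤m 1≤b a≤b (suc zero , ((col , proper) , _) , _) = one-colour q a b col proper
    skewed-colouring q a b 1≤m 1≤b a≤b (suc (suc c) , chromatic , χ≤) = several-colours q a b c 1≤b a≤b chromatic
      λ s r 1≤r _ α≡ → clear-denominators (suc c) q a b s r (alphaH H (suc (suc c))) 1≤r 1≤b α≡ χ≤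

-- Fractional tilings with integral weights

module Tiling where

  open Summation
  open Rationals
  open Colouring using (allB-sound)
  open import Defs using (Graph; adj; eqFinB; isHomB; sumℚ; ℕ→ℚ; homs; allMaps; preimageSize; FractionalTiling; tilingWeight; module FractionalTiling)
  open import Data.Bool as Bool using (Bool; true; if_then_else_)
  open import Data.Nat as ℕ using (ℕ; zero; suc)
  import Data.Nat.Properties as ℕₚ
  open import Data.Fin as Fin using (Fin)
  open import Data.Integer as ℤ using (+_; -[1+_])
  import Data.Integer.Properties as ℤₚ
  open import Data.List as List using (List; []; _∷_; map; lookup; length)
  open import Data.List.Membership.Propositional.Properties using (∈-filter⁻; ∈-lookup)
  open import Data.Product using (∃; _×_; _,_; proj₁; proj₂)
  open import Data.Rational
  open import Data.Rational.Properties
  open import Data.Rational.Solver using (module +-*-Solver)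
  import Data.Rational.Unnormalised as ℚᵘ
  import Data.Rational.Unnormalised.Properties as ℚᵘₚ
  open import Function using (_∘_)
  open import Relation.Binary.PropositionalEquality

  open +-*-Solver using (solve; con; _:=_; _:+_; _:*_; _:-_)

  clear-denominator : ∀ p → 0ℚ ≤ p → ∃ λ d → ∃ λ n → 1 ℕ.≤ d × ℕ→ℚ n ≡ p * ℕ→ℚ d
  clear-denominator p@(mkℚ (+ n) d-1 c) _ = suc d-1 , n , ℕ.s≤s ℕ.z≤n ,
    trans (ℕ→ℚ≡whole n) (trans (toℚᵘ-injective (ℚᵘₚ.≃-trans (ℚᵘ.*≡* eq) (ℚᵘₚ.≃-sym (toℚᵘ-homo-* p (whole (suc d-1))))))
      (cong (p *_) (sym (ℕ→ℚ≡whole (suc d-1)))))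
    where
    eq : + n ℤ.* (+ suc d-1 ℤ.* + 1) ≡ (+ n ℤ.* + suc d-1) ℤ.* + 1
    eq = sym (ℤₚ.*-assoc (+ n) (+ suc d-1) (+ 1))
  clear-denominator (mkℚ -[1+ n ] d-1 c) (*≤* ())

  -- Averaging over options works with natural weights, so the weights of all homomorphisms are
  -- multiplied by one and the same number.
  common-denominator : ∀ {A : Set} (f : A → ℚ) → (∀ x → 0ℚ ≤ f x) → ∀ xs →
    ∃ λ D → ∃ λ (w : Fin (length xs) → ℕ) → 1 ℕ.≤ D × (∀ i → ℕ→ℚ (w i) ≡ f (lookup xs i) * ℕ→ℚ D)
  common-denominator f f≥0 [] = 1 , (λ ()) , ℕ.s≤s ℕ.z≤n , λ ()
  common-denominator f f≥0 (x ∷ xs) = d ℕ.* D , w′ , ℕₚ.*-mono-≤ 1≤d 1≤D , eq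
    where
    rest = common-denominator f f≥0 xs
    D = proj₁ rest
    w = proj₁ (proj₂ rest)
    1≤D : 1 ℕ.≤ D
    1≤D = proj₁ (proj₂ (proj₂ rest))
    head = clear-denominator (f x) (f≥0 x)
    d = proj₁ head
    n = proj₁ (proj₂ head)
    1≤d : 1 ℕ.≤ d
    1≤d = proj₁ (proj₂ (proj₂ head))
    w′ : Fin (suc (length xs)) → ℕ
    w′ Fin.zero = n ℕ.* D
    w′ (Fin.suc i) = d ℕ.* w i
    open ≡-Reasoning
    eq : ∀ i → ℕ→ℚ (w′ i) ≡ f (lookup (x ∷ xs) i) * ℕ→ℚ (d ℕ.* D)
    eq Fin.zero = begin
      ℕ→ℚ (n ℕ.* D) ≡⟨ ℕ→ℚ-* n D ⟩
      ℕ→ℚ n * ℕ→ℚ D ≡⟨ cong (_* ℕ→ℚ D) (proj₂ (proj₂ (proj₂ head))) ⟩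
      f x * ℕ→ℚ d * ℕ→ℚ D ≡⟨ *-assoc (f x) (ℕ→ℚ d) (ℕ→ℚ D) ⟩
      f x * (ℕ→ℚ d * ℕ→ℚ D) ≡⟨ cong (f x *_) (ℕ→ℚ-* d D) ⟨
      f x * ℕ→ℚ (d ℕ.* D) ∎
    eq (Fin.suc i) = begin
      ℕ→ℚ (d ℕ.* w i) ≡⟨ ℕ→ℚ-* d (w i) ⟩
      ℕ→ℚ d * ℕ→ℚ (w i) ≡⟨ cong (ℕ→ℚ d *_) (proj₂ (proj₂ (proj₂ rest)) i) ⟩
      ℕ→ℚ d * (f (lookup xs i) * ℕ→ℚ D) ≡⟨ solve 3 (λ d x D → d :* (x :* D) := x :* (d :* D)) refl (ℕ→ℚ d) (f (lookup xs i)) (ℕ→ℚ D) ⟩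
      f (lookup xs i) * (ℕ→ℚ d * ℕ→ℚ D) ≡⟨ cong (f (lookup xs i) *_) (ℕ→ℚ-* d D) ⟨
      f (lookup xs i) * ℕ→ℚ (d ℕ.* D) ∎

  sum-scaled : ∀ {A : Set} (f : A → ℚ) D xs (u : Fin (length xs) → ℕ) →
    (∀ i → ℕ→ℚ (u i) ≡ f (lookup xs i) * D) → ℕ→ℚ (sum u) ≡ sumℚ (map f xs) * D
  sum-scaled f D [] u h = trans (cong ℕ→ℚ (sum-zero {0} {u} λ ())) (sym (*-zeroˡ D))
  sum-scaled f D (x ∷ xs) u h = begin
    ℕ→ℚ (sum u) ≡⟨ cong ℕ→ℚ (sum-suc u) ⟩
    ℕ→ℚ (u Fin.zero ℕ.+ sum (u ∘ Fin.suc)) ≡⟨ ℕ→ℚ-+ (u Fin.zero) (sum (u ∘ Fin.suc)) ⟩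
    ℕ→ℚ (u Fin.zero) + ℕ→ℚ (sum (u ∘ Fin.suc)) ≡⟨ cong₂ _+_ (h Fin.zero) (sum-scaled f D xs (u ∘ Fin.suc) (h ∘ Fin.suc)) ⟩
    f x * D + sumℚ (map f xs) * D ≡⟨ *-distribʳ-+ D (f x) (sumℚ (map f xs)) ⟨
    (f x + sumℚ (map f xs)) * D ∎
    where open ≡-Reasoning

  isHomB-sound : ∀ {m n} (F : Graph m) (G : Graph n) θ → isHomB F G θ ≡ true →
    ∀ u v → adj F u v ≡ true → adj G (θ u) (θ v) ≡ true
  isHomB-sound F G θ h u v uv = subst (λ b → (if b then adj G (θ u) (θ v) else true) ≡ true) uv (allB-sound _ (allB-sound _ h u) v)

  -- A fractional tiling with weights w h / D; at most a 1/Q fraction of G is left uncovered.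
  record IntegralTiling {m n} (F : Graph m) (G : Graph n) (Q : ℕ) : Set where
    field
      N : ℕ
      hom : Fin N → Fin m → Fin n
      isHom : ∀ h u v → adj F u v ≡ true → adj G (hom h u) (hom h v) ≡ true
      w : Fin N → ℕ
      D : ℕ
      1≤D : 1 ℕ.≤ D
      covered≤ : ∀ v → sum (λ h → w h ℕ.* sum (λ u → ⟦ eqFinB (hom h u) v ⟧)) ℕ.≤ D
      large : Q ℕ.* (n ℕ.* D) ℕ.≤ Q ℕ.* (m ℕ.* sum w) ℕ.+ n ℕ.* D

  integral-tiling : ∀ {m n} (F : Graph m) (G : Graph n) (Q : ℕ) ρ (T : FractionalTiling F G) →
    ℕ→ℚ Q * ρ ≤ 1ℚ → (1ℚ - ρ) * ℕ→ℚ n ≤ tilingWeight T → IntegralTiling F G Q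
  integral-tiling {m} {n} F G Q ρ T Qρ≤1 weight = record
    { N = length hs ; hom = lookup hs ; isHom = isHom ; w = w ; D = D ; 1≤D = proj₁ (proj₂ (proj₂ common))
    ; covered≤ = covered≤ ; large = large }
    where
    open FractionalTiling T
    hs = homs F G
    common = common-denominator ω ω-nonneg hs
    D = proj₁ common
    w = proj₁ (proj₂ common)
    w≡ : ∀ i → ℕ→ℚ (w i) ≡ ω (lookup hs i) * ℕ→ℚ D
    w≡ = proj₂ (proj₂ (proj₂ common))
    isHom : ∀ h u v → adj F u v ≡ true → adj G (lookup hs h u) (lookup hs h v) ≡ true
    isHom h = isHomB-sound F G (lookup hs h) (proj₂ (∈-filter⁻ (λ θ → isHomB F G θ Bool.≟ true) {xs = allMaps m n} (∈-lookup {xs = hs} h)))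
    covered : ∀ v → sum (λ h → w h ℕ.* preimageSize (lookup hs h) v) ℕ.≤ D
    covered v = ℕ→ℚ-cancel (sum (λ h → w h ℕ.* preimageSize (lookup hs h) v)) D (begin
      ℕ→ℚ (sum (λ h → w h ℕ.* preimageSize (lookup hs h) v))
        ≡⟨ sum-scaled (λ θ → ω θ * ℕ→ℚ (preimageSize θ v)) (ℕ→ℚ D) hs (λ h → w h ℕ.* preimageSize (lookup hs h) v) scaled ⟩
      sumℚ (map (λ θ → ω θ * ℕ→ℚ (preimageSize θ v)) hs) * ℕ→ℚ D
        ≤⟨ *-monoʳ (ℕ→ℚ D) (0≤ℕ→ℚ D) (vertex-bound v) ⟩
      1ℚ * ℕ→ℚ D
        ≡⟨ *-identityˡ (ℕ→ℚ D) ⟩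
      ℕ→ℚ D ∎)
      where
      open ≤-Reasoning
      scaled : ∀ i → ℕ→ℚ (w i ℕ.* preimageSize (lookup hs i) v) ≡ ω (lookup hs i) * ℕ→ℚ (preimageSize (lookup hs i) v) * ℕ→ℚ D
      scaled i = trans (ℕ→ℚ-* (w i) (preimageSize (lookup hs i) v)) (trans (cong (_* ℕ→ℚ (preimageSize (lookup hs i) v)) (w≡ i))
        (solve 3 (λ x d p → x :* d :* p := x :* p :* d) refl (ω (lookup hs i)) (ℕ→ℚ D) (ℕ→ℚ (preimageSize (lookup hs i) v))))
    covered≤ : ∀ v → sum (λ h → w h ℕ.* sum (λ u → ⟦ eqFinB (lookup hs h u) v ⟧)) ℕ.≤ D
    covered≤ v = subst (ℕ._≤ D) (sum-cong λ h → cong (w h ℕ.*_) (count≡sum (λ u → eqFinB (lookup hs h u) v))) (covered v)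
    total : ℕ→ℚ (sum w) ≡ sumℚ (map ω hs) * ℕ→ℚ D
    total = sum-scaled ω (ℕ→ℚ D) hs w w≡
    large : Q ℕ.* (n ℕ.* D) ℕ.≤ Q ℕ.* (m ℕ.* sum w) ℕ.+ n ℕ.* D
    large = ℕ→ℚ-cancel (Q ℕ.* (n ℕ.* D)) (Q ℕ.* (m ℕ.* sum w) ℕ.+ n ℕ.* D) (begin
      ℕ→ℚ (Q ℕ.* (n ℕ.* D))
        ≡⟨ trans (ℕ→ℚ-* Q (n ℕ.* D)) (cong (ℕ→ℚ Q *_) (ℕ→ℚ-* n D)) ⟩
      q * (N * d)
        ≡⟨ solve 4 (λ q ρ N d → q :* (N :* d) := (con 1ℚ :- ρ) :* N :* (q :* d) :+ q :* ρ :* (N :* d)) refl q ρ N d ⟩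
      (1ℚ - ρ) * N * (q * d) + q * ρ * (N * d)
        ≤⟨ +-mono-≤ (*-monoʳ (q * d) (subst (0ℚ ≤_) (ℕ→ℚ-* Q D) (0≤ℕ→ℚ (Q ℕ.* D))) weight)
                    (*-monoʳ (N * d) (subst (0ℚ ≤_) (ℕ→ℚ-* n D) (0≤ℕ→ℚ (n ℕ.* D))) Qρ≤1) ⟩
      ℕ→ℚ m * Σω * (q * d) + 1ℚ * (N * d)
        ≡⟨ solve 5 (λ m s q d N → m :* s :* (q :* d) :+ con 1ℚ :* (N :* d) := q :* (m :* (s :* d)) :+ N :* d) refl (ℕ→ℚ m) Σω q d N ⟩
      q * (ℕ→ℚ m * (Σω * d)) + N * d
        ≡⟨ cong (λ t → q * (ℕ→ℚ m * t) + N * d) total ⟨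
      q * (ℕ→ℚ m * ℕ→ℚ (sum w)) + N * d
        ≡⟨ cong₂ (λ s t → q * s + t) (ℕ→ℚ-* m (sum w)) (ℕ→ℚ-* n D) ⟨
      q * ℕ→ℚ (m ℕ.* sum w) + ℕ→ℚ (n ℕ.* D)
        ≡⟨ cong (_+ ℕ→ℚ (n ℕ.* D)) (ℕ→ℚ-* Q (m ℕ.* sum w)) ⟨
      ℕ→ℚ (Q ℕ.* (m ℕ.* sum w)) + ℕ→ℚ (n ℕ.* D)
        ≡⟨ ℕ→ℚ-+ (Q ℕ.* (m ℕ.* sum w)) (n ℕ.* D) ⟨
      ℕ→ℚ (Q ℕ.* (m ℕ.* sum w) ℕ.+ n ℕ.* D) ∎)
      where
      open ≤-Reasoning
      q = ℕ→ℚ Q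
      N = ℕ→ℚ n
      d = ℕ→ℚ D
      Σω = sumℚ (map ω hs)

-- Random assignments of colours to clusters and their expected loads

module Options where

  open Summation
  open Regularity using (size)
  open Mixing using (Balanced; module Balanced; partSize)
  open Tiling
  open import Defs using (Graph; adj; eqFinB; Bχ; partB; eqPartB)
  open import Data.Bool using (Bool; true; not)
  open import Data.Maybe using (Maybe; just; nothing)
  open import Data.Nat
  open import Data.Nat.Properties
  open import Data.Nat.Tactic.RingSolver using (solve-∀)
  open import Data.Fin as Fin using (Fin; _↑ˡ_; _↑ʳ_; combine; remQuot)
  open import Data.Fin.Properties as Finₚ using (splitAt-↑ˡ; splitAt-↑ʳ; remQuot-combine)
  open import Data.Product using (∃; _×_; _,_; proj₁; proj₂)
  open import Data.Empty using (⊥-elim)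
  open import Function using (_∘_)
  open import Relation.Binary.PropositionalEquality

  sum-remQuot : ∀ m {n} (f : Fin m → Fin n → ℕ) →
    sum (λ x → f (proj₁ (remQuot {m} n x)) (proj₂ (remQuot {m} n x))) ≡ sum (λ i → sum (f i))
  sum-remQuot m f = trans (sum-combine m _) (sum-cong λ i → sum-cong λ j →
    cong (λ ij → f (proj₁ ij) (proj₂ ij)) (remQuot-combine i j))

  module _ {q a b : ℕ} where

    -- One vertex from every part of B_χ, taken at position s of the special part and s′ of the others.
    transversal : Fin a → Fin b → Fin (suc q) → Fin (a + q * b)
    transversal s s′ Fin.zero = s ↑ˡ (q * b)
    transversal s s′ (Fin.suc B) = a ↑ʳ combine B s′

    partLabel : Fin (suc q) → Maybe (Fin q)
    partLabel Fin.zero = nothing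
    partLabel (Fin.suc B) = just B

    partB-transversal : ∀ s s′ P → partB (suc q) a b (transversal s s′ P) ≡ partLabel P
    partB-transversal s s′ Fin.zero rewrite splitAt-↑ˡ a s (q * b) = refl
    partB-transversal s s′ (Fin.suc B) rewrite splitAt-↑ʳ a (q * b) (combine B s′) = cong just (cong proj₁ (remQuot-combine B s′))

    transversal-adj : ∀ s s′ P P′ → P ≢ P′ → adj (Bχ (suc q) a b) (transversal s s′ P) (transversal s s′ P′) ≡ true
    transversal-adj s s′ P P′ P≢P′ = trans (cong₂ (λ x y → not (eqPartB x y)) (partB-transversal s s′ P) (partB-transversal s s′ P′))
      (differ P P′ P≢P′)
      where
      differ : ∀ P P′ → P ≢ P′ → not (eqPartB (partLabel P) (partLabel P′)) ≡ true
      differ Fin.zero Fin.zero ne = ⊥-elim (ne refl)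
      differ Fin.zero (Fin.suc _) ne = refl
      differ (Fin.suc _) Fin.zero ne = refl
      differ (Fin.suc i) (Fin.suc j) ne = cong not (≢⇒eqFinB i j (ne ∘ cong Fin.suc))

    -- A uniform transversal meets a given vertex of part P with probability 1/|P|; weighting P by
    -- its size therefore counts all vertices of B_χ equally.
    sum-transversal : ∀ (g : Fin (a + q * b) → ℕ) →
      sum (λ P → partSize a b P * sum (λ s → sum (λ s′ → g (transversal s s′ P)))) ≡ a * b * sum g
    sum-transversal g = begin
      sum (λ P → partSize a b P * sum (λ s → sum (λ s′ → g (transversal s s′ P))))
        ≡⟨ sum-suc _ ⟩
      a * sum (λ s → sum {b} (λ _ → g (s ↑ˡ (q * b)))) + sum (λ B → b * sum {a} (λ _ → sum (λ s′ → g (a ↑ʳ combine B s′))))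
        ≡⟨ cong₂ _+_ (cong (a *_) (trans (sum-cong λ s → sum-const b _) (sym (*-sumˡ b _))))
                     (trans (sum-cong λ B → cong (b *_) (sum-const a _)) (trans (sym (*-sumˡ b _)) (cong (b *_) (sym (*-sumˡ a _))))) ⟩
      a * (b * sum (λ s → g (s ↑ˡ (q * b)))) + b * (a * sum (λ B → sum (λ s′ → g (a ↑ʳ combine B s′))))
        ≡⟨ ring a b _ _ ⟩
      a * b * (sum (λ s → g (s ↑ˡ (q * b))) + sum (λ B → sum (λ s′ → g (a ↑ʳ combine B s′))))
        ≡⟨ cong (λ t → a * b * (sum (λ s → g (s ↑ˡ (q * b))) + t)) (sum-combine q (λ y → g (a ↑ʳ y))) ⟨
      a * b * (sum (λ s → g (s ↑ˡ (q * b))) + sum (λ y → g (a ↑ʳ y)))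
        ≡⟨ cong (a * b *_) (sum-++ a g) ⟨
      a * b * sum g ∎
      where
      open ≡-Reasoning
      ring : ∀ a b x y → a * (b * x) + b * (a * y) ≡ a * b * (x + y)
      ring = solve-∀

  module FromTiling {m q a b n′ M Q : ℕ} (φ : Fin m → Fin (suc q)) (bal : Balanced a b φ)
    (G′ : Graph n′) (tiling : IntegralTiling (Bχ (suc q) a b) G′ Q) (p : Fin n′ → Fin M) where

    open Balanced bal renaming (N to Np; w to wp)
    open IntegralTiling tiling renaming (N to Nh; w to wh)

    W : ℕ
    W = a + q * b

    -- An option is a quadruple: a homomorphism of the tiling, a position in the special part, a
    -- common position in the other parts, and a permutation of the colours. It is coded as one
    -- index because the derandomised choice is over a single `Fin N`.
    N : ℕ
    N = Nh * (a * (b * Np))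

    homOf : Fin N → Fin Nh
    homOf o = proj₁ (remQuot {Nh} (a * (b * Np)) o)

    rest₁ : Fin N → Fin (a * (b * Np))
    rest₁ o = proj₂ (remQuot {Nh} (a * (b * Np)) o)

    at : Fin Nh → Fin a → Fin b → Fin Np → Fin (suc q) → Fin M
    at h s s′ o c = p (hom h (transversal s s′ (perm o c)))

    sOf : Fin (a * (b * Np)) → Fin a
    sOf y = proj₁ (remQuot {a} (b * Np) y)

    s′Of : Fin (a * (b * Np)) → Fin b
    s′Of y = proj₁ (remQuot {b} Np (proj₂ (remQuot {a} (b * Np) y)))

    permOf : Fin (a * (b * Np)) → Fin Np
    permOf y = proj₂ (remQuot {b} Np (proj₂ (remQuot {a} (b * Np) y)))

    at₁ : Fin Nh → Fin (a * (b * Np)) → Fin (suc q) → Fin M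
    at₁ h y = at h (sOf y) (s′Of y) (permOf y)

    weight₁ : Fin (a * (b * Np)) → ℕ
    weight₁ y = wp (permOf y)

    cluster : Fin N → Fin (suc q) → Fin M
    cluster o = at₁ (homOf o) (rest₁ o)

    weight : Fin N → ℕ
    weight o = wh (homOf o) * weight₁ (rest₁ o)

    sum-options : ∀ (f : (Fin (suc q) → Fin M) → ℕ) →
      sum (λ o → weight o * f (cluster o)) ≡
      sum (λ h → wh h * sum (λ s → sum (λ s′ → sum (λ o → wp o * f (at h s s′ o)))))
    sum-options f = begin
      sum (λ o → weight o * f (cluster o))
        ≡⟨ sum-remQuot Nh (λ h y → wh h * weight₁ y * f (at₁ h y)) ⟩
      sum (λ h → sum (λ y → wh h * weight₁ y * f (at₁ h y)))
        ≡⟨ sum-cong (λ h → trans (sum-cong λ y → *-assoc (wh h) (weight₁ y) _) (sym (*-sumˡ (wh h) _))) ⟩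
      sum (λ h → wh h * sum (λ y → weight₁ y * f (at₁ h y)))
        ≡⟨ sum-cong (λ h → cong (wh h *_) (trans
             (sum-remQuot a (λ s y → wp (proj₂ (remQuot {b} Np y)) * f (at h s (proj₁ (remQuot {b} Np y)) (proj₂ (remQuot {b} Np y)))))
             (sum-cong λ s → sum-remQuot b (λ s′ o → wp o * f (at h s s′ o))))) ⟩
      sum (λ h → wh h * sum (λ s → sum (λ s′ → sum (λ o → wp o * f (at h s s′ o))))) ∎
      where open ≡-Reasoning

    total : sum weight ≡ sum wh * (a * (b * sum wp))
    total = begin
      sum weight
        ≡⟨ sum-cong (λ o → sym (*-identityʳ (weight o))) ⟩
      sum (λ o → weight o * 1)
        ≡⟨ sum-options (λ _ → 1) ⟩
      sum (λ h → wh h * sum {a} (λ s → sum {b} (λ s′ → sum (λ o → wp o * 1))))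
        ≡⟨ sum-cong (λ h → cong (wh h *_) (trans (sum-const a _) (cong (a *_) (trans (sum-const b _) (cong (b *_) (sum-cong λ o → *-identityʳ (wp o))))))) ⟩
      sum (λ h → wh h * (a * (b * sum wp)))
        ≡⟨ *-sumʳ _ wh ⟨
      sum wh * (a * (b * sum wp)) ∎
      where open ≡-Reasoning

    cluster-adj : ∀ o c c′ → c ≢ c′ → ∃ λ x → ∃ λ y → adj G′ x y ≡ true × p x ≡ cluster o c × p y ≡ cluster o c′
    cluster-adj o c c′ c≢c′ = _ , _ , isHom (homOf o) _ _ (transversal-adj {q} {a} {b} (sOf y) (s′Of y) (perm (permOf y) c) (perm (permOf y) c′)
      (c≢c′ ∘ perm-injective (permOf y) c c′)) , refl , refl
      where
      y = rest₁ o

    open ≤-Reasoning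

    load : Fin M → ℕ
    load i = sum λ o → weight o * sum (λ x → ⟦ eqFinB (cluster o (φ x)) i ⟧)

    module _ (i : Fin M) where

      indicator : Fin Nh → Fin (a + q * b) → ℕ
      indicator h y = ⟦ eqFinB (p (hom h y)) i ⟧

      partLoad : Fin (suc q) → ℕ
      partLoad P = sum λ o → wp o * sum (λ x → ⟦ eqFinB (perm o (φ x)) P ⟧)

      -- Balancedness limits part P to a share |P|/`W` of the m vertices of H, and the transversal
      -- spreads this evenly over the part. So every vertex of B_χ is bounded alike, by m/`W`.
      hom-load : ∀ h → W * sum (λ s → sum (λ s′ → sum (λ o → wp o * sum (λ x → indicator h (transversal s s′ (perm o (φ x)))))))
        ≤ sum wp * m * (a * b * sum (indicator h))
      hom-load h = begin
        W * sum (λ s → sum (λ s′ → sum (λ o → wp o * sum (λ x → g s s′ (perm o (φ x))))))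
          ≡⟨ cong (W *_) (sum-cong λ s → sum-cong λ s′ → byPart s s′) ⟩
        W * sum (λ s → sum (λ s′ → sum (λ P → partLoad P * g s s′ P)))
          ≡⟨ cong (W *_) (trans (sum-cong λ s → sum-comm _) (sum-comm _)) ⟩
        W * sum (λ P → sum (λ s → sum (λ s′ → partLoad P * g s s′ P)))
          ≡⟨ cong (W *_) (sum-cong λ P → trans (sum-cong λ s → sym (*-sumˡ (partLoad P) _)) (sym (*-sumˡ (partLoad P) _))) ⟩
        W * sum (λ P → partLoad P * sum (λ s → sum (λ s′ → g s s′ P)))
          ≡⟨ trans (*-sumˡ W _) (sum-cong λ P → sym (*-assoc W (partLoad P) _)) ⟩
        sum (λ P → W * partLoad P * sum (λ s → sum (λ s′ → g s s′ P)))
          ≤⟨ sum-mono-≤ (λ P → *-monoˡ-≤ (sum (λ s → sum (λ s′ → g s s′ P))) (balanced P)) ⟩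
        sum (λ P → sum wp * m * partSize a b P * sum (λ s → sum (λ s′ → g s s′ P)))
          ≡⟨ trans (sum-cong λ P → *-assoc (sum wp * m) (partSize a b P) _) (sym (*-sumˡ (sum wp * m) _)) ⟩
        sum wp * m * sum (λ P → partSize a b P * sum (λ s → sum (λ s′ → g s s′ P)))
          ≡⟨ cong (sum wp * m *_) (sum-transversal {q} {a} {b} (indicator h)) ⟩
        sum wp * m * (a * b * sum (indicator h)) ∎
        where
        g : Fin a → Fin b → Fin (suc q) → ℕ
        g s s′ P = indicator h (transversal s s′ P)
        swap : ∀ x y z → x * (y * z) ≡ x * y * z
        swap = solve-∀
        byPart : ∀ s s′ → sum (λ o → wp o * sum (λ x → g s s′ (perm o (φ x)))) ≡ sum (λ P → partLoad P * g s s′ P)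
        byPart s s′ = begin-equality
          sum (λ o → wp o * sum (λ x → g s s′ (perm o (φ x))))
            ≡⟨ sum-cong (λ o → cong (wp o *_) (trans (sum-cong λ x → sym (sum-δ (perm o (φ x)) (g s s′))) (sum-comm _))) ⟩
          sum (λ o → wp o * sum (λ P → sum (λ x → ⟦ eqFinB (perm o (φ x)) P ⟧ * g s s′ P)))
            ≡⟨ sum-cong (λ o → trans (*-sumˡ (wp o) _) (sum-cong λ P → trans (cong (wp o *_) (sym (*-sumʳ (g s s′ P) _))) (swap (wp o) _ _))) ⟩
          sum (λ o → sum (λ P → wp o * sum (λ x → ⟦ eqFinB (perm o (φ x)) P ⟧) * g s s′ P))
            ≡⟨ trans (sum-comm _) (sum-cong λ P → sym (*-sumʳ (g s s′ P) _)) ⟩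
          sum (λ P → partLoad P * g s s′ P) ∎

      covered : sum (λ h → wh h * sum (indicator h)) ≤ size (λ v → eqFinB (p v) i) * D
      covered = begin
        sum (λ h → wh h * sum (indicator h))
          ≡⟨ sum-cong (λ h → cong (wh h *_) (trans (sum-cong λ y → sym (sum-δ (hom h y) (λ v → χ v))) (sum-comm _))) ⟩
        sum (λ h → wh h * sum (λ v → sum (λ y → ⟦ eqFinB (hom h y) v ⟧ * χ v)))
          ≡⟨ sum-cong (λ h → trans (*-sumˡ (wh h) _) (sum-cong λ v → trans (cong (wh h *_) (sym (*-sumʳ (χ v) _))) (swap (wh h) _ (χ v)))) ⟩
        sum (λ h → sum (λ v → χ v * (wh h * sum (λ y → ⟦ eqFinB (hom h y) v ⟧))))
          ≡⟨ trans (sum-comm _) (sum-cong λ v → sym (*-sumˡ (χ v) _)) ⟩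
        sum (λ v → χ v * sum (λ h → wh h * sum (λ y → ⟦ eqFinB (hom h y) v ⟧)))
          ≤⟨ sum-mono-≤ (λ v → *-monoʳ-≤ (χ v) (covered≤ v)) ⟩
        sum (λ v → χ v * D)
          ≡⟨ *-sumʳ D _ ⟨
        size (λ v → eqFinB (p v) i) * D ∎
        where
        χ : Fin n′ → ℕ
        χ v = ⟦ eqFinB (p v) i ⟧
        swap : ∀ x y z → x * (y * z) ≡ z * (x * y)
        swap = solve-∀

      -- Divided by the total weight: the expected load of a cluster is at most m·|cluster|·`D`/(`W`
      -- · Σ `wh`), where `W` · Σ `wh`/`D` is the weight of the tiling, almost the number of
      -- vertices of `G′`.
      load-bound : W * load i ≤ sum wp * m * (a * b) * (size (λ v → eqFinB (p v) i) * D)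
      load-bound = begin
        W * load i
          ≡⟨ cong (W *_) (sum-options (λ κ → sum (λ x → ⟦ eqFinB (κ (φ x)) i ⟧))) ⟩
        W * sum (λ h → wh h * sum (λ s → sum (λ s′ → sum (λ o → wp o * sum (λ x → indicator h (transversal s s′ (perm o (φ x))))))))
          ≡⟨ trans (*-sumˡ W _) (sum-cong λ h → *-swap W (wh h) _) ⟩
        sum (λ h → wh h * (W * sum (λ s → sum (λ s′ → sum (λ o → wp o * sum (λ x → indicator h (transversal s s′ (perm o (φ x)))))))))
          ≤⟨ sum-mono-≤ (λ h → *-monoʳ-≤ (wh h) (hom-load h)) ⟩
        sum (λ h → wh h * (sum wp * m * (a * b * sum (indicator h))))
          ≡⟨ trans (sum-cong λ h → regroup (wh h) (sum wp * m) (a * b) (sum (indicator h))) (sym (*-sumˡ (sum wp * m * (a * b)) _)) ⟩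
        sum wp * m * (a * b) * sum (λ h → wh h * sum (indicator h))
          ≤⟨ *-monoʳ-≤ (sum wp * m * (a * b)) covered ⟩
        sum wp * m * (a * b) * (size (λ v → eqFinB (p v) i) * D) ∎
        where
        regroup : ∀ w t s x → w * (t * (s * x)) ≡ t * s * (w * x)
        regroup = solve-∀

-- Constants and the embedding theorem in integer form

module Core where

  open Summation
  open Regularity
  open Cleaning
  open Assembling using (module Assemble)
  open Colouring using (another)
  open Derandomise using (module Variance)
  open Mixing using (Balanced; module Balanced)
  open Tiling using (IntegralTiling; module IntegralTiling)
  open Options using (module FromTiling)
  open import Defs using (Graph; adj; eqFinB; deg; SubgraphOf; emb; Bχ; ProperColouring)
  open import Data.Bool using (Bool; true)
  open import Data.Nat
  open import Data.Nat.Properties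
  open import Data.Nat.Tactic.RingSolver using (solve-∀)
  open import Data.Fin as Fin using (Fin; fromℕ<)
  open import Data.Product using (∃; _×_; _,_; proj₁; proj₂)
  open import Function using (_∘_)
  open import Relation.Nullary using (¬_)
  open import Relation.Binary.PropositionalEquality

  -- The fraction of a cluster of size V that H is expected to fill: with R = r + 1,
  -- (1 − 1/R) / (1 − 1/(4R))² ≤ 1 − 1/(2R).
  expected-load : ∀ r n n′ m W T P V d wh → 1 ≤ n → 1 ≤ W → let R = suc r in
    W * T ≤ P * m * (V * d) →
    4 * R * (n′ * d) ≤ 4 * R * (W * wh) + n′ * d →
    4 * R * n ≤ 4 * R * n′ + n →
    R * m + n ≤ R * n →
    2 * R * T ≤ (2 * r + 1) * (wh * P * V)
  expected-load r n n′ m W T P V d wh 1≤n 1≤W load cover kept small =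
    *-cancelˡ-≤ (z * z * n * W) ⦃ m*n≢0 (z * z * n) W ⦃ m*n≢0 (z * z) n ⦃ m*n≢0 z z ⦄ ⦃ >-nonZero 1≤n ⦄ ⦄ ⦃ >-nonZero 1≤W ⦄ ⦄ (begin
      z * z * n * W * (2 * R * T)
        ≡⟨ e₁ z n W R T ⟩
      z * z * n * (2 * R) * (W * T)
        ≤⟨ *-monoʳ-≤ (z * z * n * (2 * R)) load ⟩
      z * z * n * (2 * R) * (P * m * (V * d))
        ≡⟨ e₂ z n R P m V d ⟩
      2 * (z * z) * n * P * V * d * (R * m)
        ≤⟨ *-monoʳ-≤ (2 * (z * z) * n * P * V * d) Rm≤ ⟩
      2 * (z * z) * n * P * V * d * (r * n)
        ≡⟨ e₃ z n P V d r ⟩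
      2 * z * n * P * V * d * r * (z * n)
        ≤⟨ *-monoʳ-≤ (2 * z * n * P * V * d * r) zn≤ ⟩
      2 * z * n * P * V * d * r * (4 * R * n′)
        ≡⟨ e₄ z n P V d r R n′ ⟩
      8 * r * R * n * V * P * (z * (n′ * d))
        ≤⟨ *-monoʳ-≤ (8 * r * R * n * V * P) znd≤ ⟩
      8 * r * R * n * V * P * (4 * R * (W * wh))
        -- The slack of the claim: `z` is 4`R` - 1, and (4`R` - 1)²(2r + 1) - 32r`R`² = 10r + 9.
        ≤⟨ m≤m+n _ ((10 * r + 9) * (n * V * P * (W * wh))) ⟩
      8 * r * R * n * V * P * (4 * R * (W * wh)) + (10 * r + 9) * (n * V * P * (W * wh))
        ≡⟨ e₅ r n V P W wh ⟩
      z * z * n * W * ((2 * r + 1) * (wh * P * V)) ∎)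
    where
    open ≤-Reasoning
    R = suc r
    z = 3 + 4 * r
    e₁ : ∀ z n W R T → z * z * n * W * (2 * R * T) ≡ z * z * n * (2 * R) * (W * T)
    e₁ = solve-∀
    e₂ : ∀ z n R P m V d → z * z * n * (2 * R) * (P * m * (V * d)) ≡ 2 * (z * z) * n * P * V * d * (R * m)
    e₂ = solve-∀
    e₃ : ∀ z n P V d r → 2 * (z * z) * n * P * V * d * (r * n) ≡ 2 * z * n * P * V * d * r * (z * n)
    e₃ = solve-∀
    e₄ : ∀ z n P V d r R n′ → 2 * z * n * P * V * d * r * (4 * R * n′) ≡ 8 * r * R * n * V * P * (z * (n′ * d))
    e₄ = solve-∀
    e₅ : ∀ r n V P W wh → 8 * r * suc r * n * V * P * (4 * suc r * (W * wh)) + (10 * r + 9) * (n * V * P * (W * wh))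
      ≡ (3 + 4 * r) * (3 + 4 * r) * n * W * ((2 * r + 1) * (wh * P * V))
    e₅ = solve-∀
    Rm≤ : R * m ≤ r * n
    Rm≤ = +-cancelʳ-≤ n _ _ (≤-trans small (≤-reflexive (+-comm n (r * n))))
    drop : ∀ x → z * x + x ≡ 4 * R * x
    drop = lem r
      where
      lem : ∀ r x → (3 + 4 * r) * x + x ≡ 4 * suc r * x
      lem = solve-∀
    zn≤ : z * n ≤ 4 * R * n′
    zn≤ = +-cancelʳ-≤ n _ _ (≤-trans (≤-reflexive (drop n)) kept)
    znd≤ : z * (n′ * d) ≤ 4 * R * (W * wh)
    znd≤ = +-cancelʳ-≤ (n′ * d) _ _ (≤-trans (≤-reflexive (drop (n′ * d))) cover)

  -- Passing from the expected to the actual load costs at most another V/(4R).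
  actual-load : ∀ r n B V L T Ω → 1 ≤ B → 1 ≤ Ω → let R = suc r in
    n ≤ B * V → 2 * R * T ≤ (2 * r + 1) * (Ω * V) → 4 * R * B * (Ω * L) ≤ 4 * R * B * T + Ω * n →
    V + 4 * R * L ≤ 4 * R * V
  actual-load r n B V L T Ω 1≤B 1≤Ω big expected close =
    ≤-trans (+-monoʳ-≤ V (*-cancelˡ-≤ (B * Ω) ⦃ m*n≢0 B Ω ⦃ >-nonZero 1≤B ⦄ ⦃ >-nonZero 1≤Ω ⦄ ⦄ (begin
      B * Ω * (4 * R * L)
        ≡⟨ e₁ B Ω R L ⟩
      4 * R * B * (Ω * L)
        ≤⟨ close ⟩
      4 * R * B * T + Ω * n
        ≤⟨ +-monoʳ-≤ (4 * R * B * T) (*-monoʳ-≤ Ω big) ⟩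
      4 * R * B * T + Ω * (B * V)
        ≡⟨ e₂ R B T Ω V ⟩
      2 * B * (2 * R * T) + Ω * (B * V)
        ≤⟨ +-monoˡ-≤ (Ω * (B * V)) (*-monoʳ-≤ (2 * B) expected) ⟩
      2 * B * ((2 * r + 1) * (Ω * V)) + Ω * (B * V)
        ≡⟨ e₃ B r Ω V ⟩
      B * Ω * ((3 + 4 * r) * V) ∎))) (≤-reflexive (e₄ r V))
    where
    open ≤-Reasoning
    R = suc r
    e₁ : ∀ B Ω R L → B * Ω * (4 * R * L) ≡ 4 * R * B * (Ω * L)
    e₁ = solve-∀
    e₂ : ∀ R B T Ω V → 4 * R * B * T + Ω * (B * V) ≡ 2 * B * (2 * R * T) + Ω * (B * V)
    e₂ = solve-∀
    e₃ : ∀ B r Ω V → 2 * B * ((2 * r + 1) * (Ω * V)) + Ω * (B * V) ≡ B * Ω * ((3 + 4 * r) * V)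
    e₃ = solve-∀
    e₄ : ∀ r V → V + (3 + 4 * r) * V ≡ 4 * suc r * V
    e₄ = solve-∀

  scaled≤⇒≡0 : ∀ r x → 4 * suc r * x ≤ x → x ≡ 0
  scaled≤⇒≡0 r x le = n≤0⇒n≡0 (≤-trans (m≤n*m x (3 + 4 * r))
    (+-cancelʳ-≤ x _ 0 (≤-trans (≤-reflexive (ring r x)) le)))
    where
    ring : ∀ r x → (3 + 4 * r) * x + x ≡ 4 * suc r * x
    ring = solve-∀

  -- R = r + 1 is at least 1/μ and 1/ρ'; 1/D is the density threshold of regular pairs and 1/E the
  -- relative size of witnesses of irregularity; Mmax bounds the number of clusters, and components
  -- of H have at most n/Z vertices.
  module Constants (r Δ : ℕ) where

    R : ℕ
    R = suc r

    opaque
      D : ℕ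
      D = 48 * R * (8 * R)

      D≡ : D ≡ 48 * R * (8 * R)
      D≡ = refl

      1≤D : 1 ≤ D
      1≤D = *-mono-≤ {1} {48 * R} {1} {8 * R} (s≤s z≤n) (s≤s z≤n)

    F K E : ℕ
    F = 4 * R
    K = F * D ^ Δ
    E = 2 * Δ * K

    1≤F : 1 ≤ F
    1≤F = s≤s z≤n

    opaque
      Mmax : ℕ
      Mmax = iterStep (suc (D * (E * E))) 1

      Mmax≡ : Mmax ≡ iterStep (suc (D * (E * E))) 1
      Mmax≡ = refl

    -- A used cluster has at least n/`B` vertices. `Y` reduces the deviation n/`Y` of a load to at
    -- most 1/(4`R`) of such a cluster. In `Z` the factor `Y`² serves the variance and 2`K` the room
    -- for the greedy step.
    B Y Z : ℕ
    B = Mmax * D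
    Y = 4 * R * B
    Z = Y * Y * (2 * K)

    1≤B : 1 ≤ B
    1≤B = *-mono-≤ (≤-trans (M≤iterStep (suc (D * (E * E))) 1) (≤-reflexive (sym Mmax≡))) 1≤D

    1≤Y : 1 ≤ Y
    1≤Y = *-mono-≤ {1} {4 * R} (s≤s z≤n) 1≤B

    1≤Z : 1 ≤ Z
    1≤Z = *-mono-≤ (*-mono-≤ 1≤Y 1≤Y) (*-mono-≤ {1} {2} (s≤s z≤n) (*-mono-≤ 1≤F (m^n>0 D ⦃ >-nonZero 1≤D ⦄ Δ)))

    Z-large : ∀ n s V → Z * s ≤ n → n ≤ B * V → 2 * K * s ≤ V
    Z-large n s V small big = *-cancelˡ-≤ B ⦃ >-nonZero 1≤B ⦄ (begin
      B * (2 * K * s) ≤⟨ *-monoˡ-≤ (2 * K * s) (≤-trans (m≤n*m B (4 * R)) (m≤m*n Y Y ⦃ >-nonZero 1≤Y ⦄)) ⟩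
      Y * Y * (2 * K * s) ≡⟨ *-assoc (Y * Y) (2 * K) s ⟨
      Z * s ≤⟨ small ⟩
      n ≤⟨ big ⟩
      B * V ∎)
      where open ≤-Reasoning

    YYs≤ : ∀ n s → Z * s ≤ n → Y * Y * s ≤ n
    YYs≤ n s small = ≤-trans (*-monoˡ-≤ s (m≤m*n (Y * Y) (2 * K) ⦃ m*n≢0 2 K ⦃ _ ⦄ ⦃ m*n≢0 F (D ^ Δ) ⦃ _ ⦄ ⦃ m^n≢0 D Δ ⦃ >-nonZero 1≤D ⦄ ⦄ ⦄ ⦄)) small

  -- What robustness provides, with both errors and the uncovered fraction replaced by 1/Q; this
  -- keeps rationals out of the embedding.
  RobustlyTileable : ∀ {f n} → ℕ → Graph f → Graph n → Set
  RobustlyTileable {n = n} Q F G = ∀ {n′} (G′ : Graph n′) (s : SubgraphOf G′ G) →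
    (∀ x → Q * deg G (emb s x) ≤ Q * deg G′ x + n) → Q * n ≤ Q * n′ + n → IntegralTiling F G′ Q

  module _ (r Δ q a b : ℕ) (1≤Δ : 1 ≤ Δ) (1≤q : 1 ≤ q) (1≤a : 1 ≤ a) (1≤b : 1 ≤ b) where

    open Constants r Δ

    module _ {n : ℕ} (G : Graph n) (1≤n : 1 ≤ n)
      (tile : RobustlyTileable (4 * R) (Bχ (suc q) a b) G)
      {m : ℕ} (H : Graph m) (deg≤Δ : ∀ x → deg H x ≤ Δ) (Rm+n≤Rn : R * m + n ≤ R * n)
      (φ : Fin m → Fin (suc q)) (proper : ProperColouring H (suc q) φ) (bal : Balanced a b φ)
      {C : ℕ} (comp : Fin m → Fin C) (comp-adj : ∀ x y → adj H x y ≡ true → comp x ≡ comp y)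
      (small-components : ∀ c → Z * size (λ x → eqFinB (comp x) c) ≤ n) where

      module Partitioned {M : ℕ} (M≤ : M ≤ Mmax) (p : Fin n → Fin M)
        (few : D * OneSided.edgesIn G D E (OneSided.irregularPairs G D E p) ≤ 2 * (n * n)) where

        open Clean G D E Mmax R D≡ (s≤s z≤n) 1≤n M≤ p few
        open OneSided G D E using (cell; Irregular)

        tiling : IntegralTiling (Bχ (suc q) a b) reduced (4 * R)
        tiling = tile reduced reduced⊆ degree-kept kept-large

        open IntegralTiling tiling using () renaming (w to wh; D to d; 1≤D to 1≤d; large to covers)
        open Balanced bal using (1≤total) renaming (w to wp)
        open FromTiling φ bal reduced tiling (p ∘ enum keep) using (N; W; weight; cluster; total; cluster-adj; load-bound) renaming (load to expected)

        V : Fin M → ℕ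
        V i = size (cell p i)

        edge-good : ∀ i j → (∃ λ x → ∃ λ y → adj reduced x y ≡ true × p (enum keep x) ≡ i × p (enum keep y) ≡ j) → Good i j
        edge-good _ _ (x , y , xy , refl , refl) = reduced-good x y xy

        cluster-good : ∀ o c c′ → c ≢ c′ → Good (cluster o c) (cluster o c′)
        cluster-good o c c′ c≢c′ = edge-good (cluster o c) (cluster o c′) (cluster-adj o c c′ c≢c′)

        -- Clusters are known to be big only as ends of an edge of `reduced`, so a second colour is
        -- called upon; this is where q ≥ 1 enters.
        cluster-big : ∀ o c → n ≤ B * V (cluster o c)
        cluster-big o c = ≤-trans (proj₁ (proj₂ (proj₂ (cluster-good o c _ (proj₂ (another 1≤q c)))))) (≤-reflexive (sym (*-assoc Mmax D _)))

        -- Loads are compared with the full cells of G, deleted vertices included: regularity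
        -- concerns G, and H is embedded into G, while `reduced` only supplies the tiling.
        kept-cell : ∀ i → size (λ x → eqFinB (p (enum keep x)) i) ≤ V i
        kept-cell i = ≤-trans (≤-reflexive (sum-enum keep λ u → ⟦ cell p i u ⟧))
          (sum-mono-≤ λ u → ≤-trans (*-monoˡ-≤ ⟦ cell p i u ⟧ (⟦⟧≤1 (keep u))) (≤-reflexive (*-identityˡ _)))

        Ω : ℕ
        Ω = sum weight

        P : ℕ
        P = sum wp * (a * b)

        Ω≡ : Ω ≡ sum wh * P
        Ω≡ = trans total (cong (sum wh *_) (ring a b (sum wp)))
          where
          ring : ∀ a b s → a * (b * s) ≡ s * (a * b)
          ring = solve-∀

        1≤W : 1 ≤ W
        1≤W = ≤-trans 1≤a (m≤m+n a (q * b))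

        expected-bound : ∀ i → 2 * R * expected i ≤ (2 * r + 1) * (Ω * V i)
        expected-bound i = subst (λ t → 2 * R * expected i ≤ (2 * r + 1) * (t * V i)) (sym Ω≡)
          (expected-load r n kept m W (expected i) P (V i) d (sum wh) 1≤n 1≤W
            (≤-trans (load-bound i) (≤-trans (*-monoʳ-≤ (sum wp * m * (a * b)) (*-monoˡ-≤ d (kept-cell i)))
              (≤-reflexive (ring (sum wp) m (a * b) (V i * d)))))
            covers kept-large Rm+n≤Rn)
          where
          ring : ∀ s m t x → s * m * t * x ≡ s * t * m * x
          ring = solve-∀

        1≤kept : 1 ≤ kept
        1≤kept = n≢0⇒n>0 λ kept≡0 → n>0⇒n≢0 1≤n (scaled≤⇒≡0 r n
          (≤-trans kept-large (≤-reflexive (trans (cong (λ t → 4 * R * t + n) kept≡0) (cong (_+ n) (*-zeroʳ (4 * R)))))))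

        1≤wh : 1 ≤ sum wh
        1≤wh = n≢0⇒n>0 λ wh≡0 → n>0⇒n≢0 (*-mono-≤ 1≤kept 1≤d) (scaled≤⇒≡0 r (kept * d)
          (≤-trans covers (≤-reflexive (cong (_+ kept * d) (trans (cong (λ t → 4 * R * (W * t)) wh≡0)
            (trans (cong (4 * R *_) (*-zeroʳ W)) (*-zeroʳ (4 * R))))))))

        1≤Ω : 1 ≤ Ω
        1≤Ω = subst (1 ≤_) (sym Ω≡) (*-mono-≤ 1≤wh (*-mono-≤ 1≤total (*-mono-≤ 1≤a 1≤b)))

        share : Fin C → Fin N → Fin M → ℕ
        share c o i = sum λ x → ⟦ eqFinB (comp x) c ⟧ * ⟦ eqFinB (cluster o (φ x)) i ⟧

        compSize : Fin C → ℕ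
        compSize c = size λ x → eqFinB (comp x) c

        sum-compSize : sum compSize ≡ m
        sum-compSize = trans (sum-comm _) (trans (sum-cong λ x → sum-δ₁ (comp x)) (trans (sum-const m 1) (*-identityʳ m)))

        share-total : ∀ c o → sum (share c o) ≤ compSize c
        share-total c o = ≤-reflexive (trans (sum-comm _) (sum-cong λ x →
          trans (sym (*-sumˡ ⟦ eqFinB (comp x) c ⟧ _)) (trans (cong (⟦ eqFinB (comp x) c ⟧ *_) (sum-δ₁ (cluster o (φ x)))) (*-identityʳ _))))

        m≤n : m ≤ n
        m≤n = *-cancelˡ-≤ R (≤-trans (m≤m+n (R * m) n) Rm+n≤Rn)

        open Variance {N} {M} weight 1≤Ω using (mean; derandomise)

        chosen = derandomise share compSize Y n share-total (λ c → YYs≤ n (compSize c) (small-components c)) (≤-trans (≤-reflexive sum-compSize) m≤n)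

        π : Fin m → Fin M
        π x = cluster (proj₁ chosen (comp x)) (φ x)

        actual : Fin M → ℕ
        actual i = sum λ x → ⟦ eqFinB (π x) i ⟧

        shares-actual : ∀ i → sum (λ c → share c (proj₁ chosen c) i) ≡ actual i
        shares-actual i = trans (sum-comm _) (sum-cong λ x → sum-δ (comp x) (λ c → ⟦ eqFinB (cluster (proj₁ chosen c) (φ x)) i ⟧))

        -- All components draw from the same weights, so the means add up to a quantity that depends
        -- only on the colour classes of H as a whole; a single component may be coloured in any
        -- proportions.
        means-expected : ∀ i → sum (λ c → mean (share c) i) ≡ expected i
        means-expected i = trans (sum-comm _) (sum-cong λ o → trans (sym (*-sumˡ (weight o) _)) (cong (weight o *_)
          (trans (sum-comm _) (sum-cong λ x → sum-δ (comp x) (λ _ → ⟦ eqFinB (cluster o (φ x)) i ⟧)))))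

        spare : ∀ x → V (π x) + F * actual (π x) ≤ F * V (π x)
        spare x = actual-load r n B (V i) (actual i) (expected i) Ω 1≤B 1≤Ω (cluster-big _ (φ x)) (expected-bound i)
          (subst₂ (λ L T → Y * (Ω * L) ≤ Y * T + Ω * n) (shares-actual i) (means-expected i) (proj₂ chosen i))
          where
          i = π x

        regular : ∀ x y → adj H x y ≡ true → ¬ Irregular p (π x) (π y)
        regular x y xy = subst (λ c → ¬ Irregular p (π x) (cluster (proj₁ chosen c) (φ y))) (comp-adj x y xy)
          (proj₁ (cluster-good (proj₁ chosen (comp x)) (φ x) (φ y) (proper x y xy)))

        embedding : SubgraphOf H G
        embedding = Assemble.embedding G D E p H π Δ F refl 1≤D 1≤Δ 1≤F regular (fromℕ< 1≤n) deg≤Δ comp comp-adj spare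
          (λ x → Z-large n (compSize (comp x)) (V (π x)) (small-components (comp x)) (cluster-big (proj₁ chosen (comp x)) (φ x)))

      embed : SubgraphOf H G
      embed with OneSided.fewIrregular G D E 1≤n
      ... | M , M≤ , p , few = Partitioned.embedding (≤-trans M≤ (≤-reflexive (sym Mmax≡))) p few

-- Translating the hypotheses into integer form

module Main where

  open Summation
  open Regularity using (size)
  open Rationals
  open Tiling using (clear-denominator; integral-tiling)
  open Colouring using (skewed-colouring)
  open Mixing using (balance; S₀)
  open Components using (components)
  open Assembling using (fibre; fibre-unique; ∈-fibre⁻; length-fibre)
  open Core using (module Constants; RobustlyTileable; embed)
  open import Defs using (Graph; adj; eqFinB; Bχ; ℕ→ℚ; _÷₀_; SubgraphOf; emb; IsApproximation; RobustTilingFramework; InB; InJ; Reach; ProperColouring)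
  open import Data.Bool using (Bool; true)
  open import Data.Nat as ℕ using (ℕ; zero; suc)
  import Data.Nat.Properties as ℕₚ
  open import Data.Fin as Fin using (Fin; inject≤)
  open import Data.Fin.Properties using (any?; inject≤-injective)
  open import Data.List using (length)
  import Data.List.Relation.Unary.All as All
  open import Data.List.Relation.Unary.Unique.Propositional using (Unique)
  open import Data.Rational
  open import Data.Rational.Properties
  open import Data.Rational.Solver using (module +-*-Solver)
  open import Data.Product using (∃; _×_; _,_; proj₁; proj₂)
  open import Data.Empty using (⊥-elim)
  open import Relation.Nullary using (yes; no; ¬_)
  open import Relation.Binary.PropositionalEquality

  open +-*-Solver using (solve; con; _:=_; _:+_; _:*_; _:-_)

  0<ℕ→ℚ : ∀ d → 1 ℕ.≤ d → 0ℚ < ℕ→ℚ d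
  0<ℕ→ℚ d 1≤d = ≰⇒> λ le → ℕₚ.<⇒≱ 1≤d (ℕ→ℚ-cancel d 0 le)

  reciprocal : ∀ Q → 1 ℕ.≤ Q → ∃ λ r → 0ℚ < r × ℕ→ℚ Q * r ≡ 1ℚ
  reciprocal Q 1≤Q = r , ≰⇒> (λ r≤0 → absurd (subst₂ _≤_ Qr (*-zeroʳ (ℕ→ℚ Q)) (*-monoˡ (ℕ→ℚ Q) (0≤ℕ→ℚ Q) r≤0))) , Qr
    where
    r = 1ℚ ÷₀ ℕ→ℚ Q
    Qr : ℕ→ℚ Q * r ≡ 1ℚ
    Qr = trans (*-comm (ℕ→ℚ Q) r) (÷₀-* 1ℚ (ℕ→ℚ Q) (ℕ→ℚ≢0 Q 1≤Q))
    absurd : ¬ 1ℚ ≤ 0ℚ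
    absurd le = ℕₚ.1+n≰n (ℕ→ℚ-cancel 1 0 le)

  archimedean : ∀ p → 0ℚ < p → ∃ λ r → 1ℚ ≤ ℕ→ℚ (suc r) * p
  archimedean p 0<p = go d n 1≤d n≡
    where
    cleared = clear-denominator p (<⇒≤ 0<p)
    d n : ℕ
    d = proj₁ cleared
    n = proj₁ (proj₂ cleared)
    1≤d : 1 ℕ.≤ d
    1≤d = proj₁ (proj₂ (proj₂ cleared))
    n≡ : ℕ→ℚ n ≡ p * ℕ→ℚ d
    n≡ = proj₂ (proj₂ (proj₂ cleared))
    go : ∀ d n → 1 ℕ.≤ d → ℕ→ℚ n ≡ p * ℕ→ℚ d → ∃ λ r → 1ℚ ≤ ℕ→ℚ (suc r) * p
    go (suc r) (suc n) _ e = r , ≤-trans (ℕ→ℚ-mono 1 (suc n) (ℕ.s≤s ℕ.z≤n)) (≤-reflexive (trans e (*-comm p (ℕ→ℚ (suc r)))))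
    go (suc r) zero 1≤d e = ⊥-elim (<-irrefl refl (<-≤-trans 0<p (*-cancelʳ-≤-pos (ℕ→ℚ (suc r)) ⦃ positive (0<ℕ→ℚ (suc r) 1≤d) ⦄
      (≤-reflexive (trans (sym e) (sym (*-zeroˡ (ℕ→ℚ (suc r)))))))))

  scale-up : ∀ p m n → 0ℚ ≤ p → m ℕ.≤ n → 1ℚ ≤ ℕ→ℚ m * p → 1ℚ ≤ ℕ→ℚ n * p
  scale-up p m n 0≤p m≤n le = ≤-trans le (*-monoʳ p 0≤p (ℕ→ℚ-mono m n m≤n))

  archimedean₂ : ∀ p p′ → 0ℚ < p → 0ℚ < p′ → ∃ λ r → 1ℚ ≤ ℕ→ℚ (suc r) * p × 1ℚ ≤ ℕ→ℚ (suc r) * p′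
  archimedean₂ p p′ 0<p 0<p′ = r ℕ.+ r′ ,
    scale-up p (suc r) (suc (r ℕ.+ r′)) (<⇒≤ 0<p) (ℕ.s≤s (ℕₚ.m≤m+n r r′)) (proj₂ (archimedean p 0<p)) ,
    scale-up p′ (suc r′) (suc (r ℕ.+ r′)) (<⇒≤ 0<p′) (ℕ.s≤s (ℕₚ.m≤n+m r′ r)) (proj₂ (archimedean p′ 0<p′))
    where
    r r′ : ℕ
    r = proj₁ (archimedean p 0<p)
    r′ = proj₁ (archimedean p′ 0<p′)

  few-vertices : ∀ R m n ρ → 1ℚ ≤ ℕ→ℚ R * ρ → ℕ→ℚ m ≤ (1ℚ - ρ) * ℕ→ℚ n → R ℕ.* m ℕ.+ n ℕ.≤ R ℕ.* n
  few-vertices R m n ρ 1≤Rρ le = ℕ→ℚ-cancel (R ℕ.* m ℕ.+ n) (R ℕ.* n) (begin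
    ℕ→ℚ (R ℕ.* m ℕ.+ n)
      ≡⟨ trans (ℕ→ℚ-+ (R ℕ.* m) n) (cong₂ _+_ (ℕ→ℚ-* R m) (sym (*-identityˡ (ℕ→ℚ n)))) ⟩
    ℕ→ℚ R * ℕ→ℚ m + 1ℚ * ℕ→ℚ n
      ≤⟨ +-mono-≤ (*-monoˡ (ℕ→ℚ R) (0≤ℕ→ℚ R) le) (*-monoʳ (ℕ→ℚ n) (0≤ℕ→ℚ n) 1≤Rρ) ⟩
    ℕ→ℚ R * ((1ℚ - ρ) * ℕ→ℚ n) + ℕ→ℚ R * ρ * ℕ→ℚ n
      ≡⟨ solve 3 (λ r ρ n → r :* ((con 1ℚ :- ρ) :* n) :+ r :* ρ :* n := r :* n) refl (ℕ→ℚ R) ρ (ℕ→ℚ n) ⟩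
    ℕ→ℚ R * ℕ→ℚ n
      ≡⟨ ℕ→ℚ-* R n ⟨
    ℕ→ℚ (R ℕ.* n) ∎)
    where open ≤-Reasoning

  deficit : ∀ Q x y n μ → 1 ℕ.≤ Q → 1ℚ ≤ ℕ→ℚ Q * μ → Q ℕ.* x ℕ.≤ Q ℕ.* y ℕ.+ n → ℕ→ℚ x - μ * ℕ→ℚ n ≤ ℕ→ℚ y
  deficit Q x y n μ 1≤Q 1≤Qμ le = *-cancelˡ-≤-pos (ℕ→ℚ Q) ⦃ positive (0<ℕ→ℚ Q 1≤Q) ⦄ (begin
    ℕ→ℚ Q * (ℕ→ℚ x - μ * ℕ→ℚ n)
      ≡⟨ solve 4 (λ q x μ n → q :* (x :- μ :* n) := q :* x :- q :* μ :* n) refl (ℕ→ℚ Q) (ℕ→ℚ x) μ (ℕ→ℚ n) ⟩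
    ℕ→ℚ Q * ℕ→ℚ x - ℕ→ℚ Q * μ * ℕ→ℚ n
      ≤⟨ +-mono-≤ Qx≤ (neg-antimono-≤ (*-monoʳ (ℕ→ℚ n) (0≤ℕ→ℚ n) 1≤Qμ)) ⟩
    ℕ→ℚ Q * ℕ→ℚ y + ℕ→ℚ n - 1ℚ * ℕ→ℚ n
      ≡⟨ solve 3 (λ q y n → q :* y :+ n :- con 1ℚ :* n := q :* y) refl (ℕ→ℚ Q) (ℕ→ℚ y) (ℕ→ℚ n) ⟩
    ℕ→ℚ Q * ℕ→ℚ y ∎)
    where
    open ≤-Reasoning
    Qx≤ : ℕ→ℚ Q * ℕ→ℚ x ≤ ℕ→ℚ Q * ℕ→ℚ y + ℕ→ℚ n
    Qx≤ = subst₂ _≤_ (ℕ→ℚ-* Q x) (trans (ℕ→ℚ-+ (Q ℕ.* y) n) (cong (_+ ℕ→ℚ n) (ℕ→ℚ-* Q y)))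
      (ℕ→ℚ-mono (Q ℕ.* x) (Q ℕ.* y ℕ.+ n) le)

  few-in-component : ∀ Z s n ξ ξ₀ → ℕ→ℚ Z * ξ₀ ≡ 1ℚ → ξ ≤ ξ₀ → ℕ→ℚ s ≤ ξ * ℕ→ℚ n → Z ℕ.* s ℕ.≤ n
  few-in-component Z s n ξ ξ₀ Zξ₀ ξ≤ξ₀ le = ℕ→ℚ-cancel (Z ℕ.* s) n (begin
    ℕ→ℚ (Z ℕ.* s) ≡⟨ ℕ→ℚ-* Z s ⟩
    ℕ→ℚ Z * ℕ→ℚ s ≤⟨ *-monoˡ (ℕ→ℚ Z) (0≤ℕ→ℚ Z) (≤-trans le (*-monoʳ (ℕ→ℚ n) (0≤ℕ→ℚ n) ξ≤ξ₀)) ⟩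
    ℕ→ℚ Z * (ξ₀ * ℕ→ℚ n) ≡⟨ *-assoc (ℕ→ℚ Z) ξ₀ (ℕ→ℚ n) ⟨
    ℕ→ℚ Z * ξ₀ * ℕ→ℚ n ≡⟨ trans (cong (_* ℕ→ℚ n) Zξ₀) (*-identityˡ (ℕ→ℚ n)) ⟩
    ℕ→ℚ n ∎)
    where open ≤-Reasoning

  occupied-fibres : ∀ {m N} (l : Fin m → Fin N) Z n →
    (∀ x → Z ℕ.* size (λ y → eqFinB (l y) (l x)) ℕ.≤ n) → ∀ c → Z ℕ.* size (λ y → eqFinB (l y) c) ℕ.≤ n
  occupied-fibres l Z n bound c with any? (λ x → l x Fin.≟ c)
  ... | yes (x , refl) = bound x
  ... | no none = ℕₚ.≤-trans (ℕₚ.≤-reflexive (trans (cong (Z ℕ.*_) (sum-zero λ x → cong ⟦_⟧ (≢⇒eqFinB (l x) c λ e → none (x , e))))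
    (ℕₚ.*-zeroʳ Z))) ℕ.z≤n

  edgeless-⊆ : ∀ {m n} (H : Graph m) (G : Graph n) → m ℕ.≤ n → (∀ u v → adj H u v ≢ true) → SubgraphOf H G
  edgeless-⊆ H G m≤n none = record
    { emb = λ x → inject≤ x m≤n
    ; emb-inj = λ {x} {y} → inject≤-injective m≤n m≤n x y
    ; emb-edge = λ u v e → ⊥-elim (none u v e) }

  module _ {m : ℕ} (H : Graph m) (w : ℚ)
    (bounded : ∀ v L → Unique L → All.All (Reach H v) L → ℕ→ℚ (length L) ≤ w) where

    component-size : ∀ v → ℕ→ℚ (size (λ x → eqFinB (proj₁ (components H) x) (proj₁ (components H) v))) ≤ w
    component-size v = subst (λ s → ℕ→ℚ s ≤ w) (length-fibre l (l v))
      (bounded v (fibre l (l v)) (fibre-unique l (l v)) (All.tabulate λ x∈ → proj₁ (proj₂ (components H)) (sym (∈-fibre⁻ l (l v) x∈))))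
      where
      l = proj₁ (components H)

  embed-in-robust : ∀ r q a b Δ μ ρ ρ′ ξ ξ₀ → 1 ℕ.≤ a → 1 ℕ.≤ b → 1 ℕ.≤ Δ → a ℕ.≤ b →
    let open Constants r Δ in
    1ℚ ≤ ℕ→ℚ R * μ → 0ℚ ≤ μ → 1ℚ ≤ ℕ→ℚ R * ρ′ → ℕ→ℚ (4 ℕ.* R) * ρ ≤ 1ℚ → ℕ→ℚ Z * ξ₀ ≡ 1ℚ → ξ ≤ ξ₀ →
    ∀ n → 1 ℕ.≤ n → ∀ ℓ t (G : Graph n) → RobustTilingFramework μ (suc q) a b ρ t ℓ G →
    ∀ m (H : Graph m) → InB ((1ℚ - ρ′) * ℕ→ℚ n) (ξ * ℕ→ℚ n) Δ H →
    InJ ((ℕ→ℚ (suc q) - 1ℚ) + (ℕ→ℚ a ÷₀ ℕ→ℚ b)) H → SubgraphOf H G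
  embed-in-robust r q a b Δ μ ρ ρ′ ξ ξ₀ 1≤a 1≤b 1≤Δ a≤b 1≤Rμ 0≤μ 1≤Rρ′ Qρ≤1 Zξ₀ ξ≤ξ₀ n 1≤n ℓ t G robust zero H inB inJ =
    edgeless-⊆ H G ℕ.z≤n λ ()
  embed-in-robust r q a b Δ μ ρ ρ′ ξ ξ₀ 1≤a 1≤b 1≤Δ a≤b 1≤Rμ 0≤μ 1≤Rρ′ Qρ≤1 Zξ₀ ξ≤ξ₀ n 1≤n ℓ t G robust m@(suc _) H (m≤ , deg≤Δ , bounded) inJ =
    go q (proj₁ skewed) (proj₁ (proj₂ skewed)) (proj₂ (proj₂ skewed)) tile
    where
    open Constants r Δ
    skewed = skewed-colouring H q a b (ℕ.s≤s ℕ.z≤n) 1≤b a≤b inJ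
    Rm+n≤Rn : R ℕ.* m ℕ.+ n ℕ.≤ R ℕ.* n
    Rm+n≤Rn = few-vertices R m n ρ′ 1≤Rρ′ m≤
    small : ∀ c → Z ℕ.* size (λ x → eqFinB (proj₁ (components H) x) c) ℕ.≤ n
    small = occupied-fibres (proj₁ (components H)) Z n λ x →
      few-in-component Z (size (λ y → eqFinB (proj₁ (components H) y) (proj₁ (components H) x))) n ξ ξ₀ Zξ₀ ξ≤ξ₀
        (component-size H (ξ * ℕ→ℚ n) bounded x)
    1≤Qμ : 1ℚ ≤ ℕ→ℚ (4 ℕ.* R) * μ
    1≤Qμ = scale-up μ R (4 ℕ.* R) 0≤μ (ℕₚ.m≤n*m R 4) 1≤Rμ
    tile : RobustlyTileable (4 ℕ.* R) (Bχ (suc q) a b) G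
    tile {n′} G′ s degrees large = integral-tiling (Bχ (suc q) a b) G′ (4 ℕ.* R) ρ (proj₁ perfect) Qρ≤1 (proj₂ perfect)
      where
      approximation : IsApproximation μ μ G′ G s
      approximation = (λ v → deficit (4 ℕ.* R) _ _ n μ (ℕ.s≤s ℕ.z≤n) 1≤Qμ (degrees v)) ,
        ≤-trans (≤-reflexive (solve 2 (λ μ n → (con 1ℚ :- μ) :* n := n :- μ :* n) refl μ (ℕ→ℚ n)))
          (deficit (4 ℕ.* R) n n′ n μ (ℕ.s≤s ℕ.z≤n) 1≤Qμ large)
      perfect = proj₁ (robust n′ G′ s approximation)
    go : ∀ q (φ : Fin m → Fin (suc q)) → ProperColouring H (suc q) φ → (a ℕ.+ q ℕ.* b) ℕ.* S₀ φ ℕ.≤ a ℕ.* m →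
      RobustlyTileable (4 ℕ.* R) (Bχ (suc q) a b) G → SubgraphOf H G
    -- With a single part a proper colouring leaves H without edges, and m ≤ n is enough.
    go zero φ proper _ _ = edgeless-⊆ H G (ℕₚ.*-cancelˡ-≤ R (ℕₚ.≤-trans (ℕₚ.m≤m+n (R ℕ.* m) n) Rm+n≤Rn)) λ u v uv → proper u v uv (same (φ u) (φ v))
      where
      same : ∀ (i j : Fin 1) → i ≡ j
      same Fin.zero Fin.zero = refl
    go (suc q) φ proper skew tile = embed r Δ (suc q) a b 1≤Δ (ℕ.s≤s ℕ.z≤n) 1≤a 1≤b G 1≤n tile H deg≤Δ Rm+n≤Rn φ proper
      (balance a b φ (ℕ.s≤s ℕ.z≤n) (ℕ.s≤s ℕ.z≤n) a≤b skew) (proj₁ (components H)) (proj₂ (proj₂ (components H))) small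

open import Defs
open import Data.Nat as ℕ using (ℕ)
open import Data.Nat.Coprimality using (Coprime)
open import Data.Product using (Σ; _×_; _,_; proj₁; proj₂)
open import Data.Rational using (ℚ; 0ℚ; 1ℚ; _+_; _-_; _*_; _≤_; _<_)
open import Data.Rational.Properties using (≤-trans; ≤-reflexive; <⇒≤)
open Rationals using (*-monoˡ; 0≤ℕ→ℚ)
open Core using (module Constants)
open Main using (archimedean₂; reciprocal; embed-in-robust)

theorem10p1 : ∀ (k a b Δ : ℕ) → 1 ℕ.≤ k → 1 ℕ.≤ a → 1 ℕ.≤ b → 1 ℕ.≤ Δ →
    a ℕ.≤ b → Coprime a b →
    ∀ (μ ρ' : ℚ) → 0ℚ < μ → μ ≤ 1ℚ → 0ℚ < ρ' → ρ' ≤ 1ℚ →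
    Σ ℚ λ ρ₀ → 0ℚ < ρ₀ × (∀ (ρ : ℚ) → 0ℚ < ρ → ρ ≤ ρ₀ →
    Σ ℚ λ ξ₀ → 0ℚ < ξ₀ × (∀ (ξ : ℚ) → 0ℚ < ξ → ξ ≤ ξ₀ →
    Σ ℕ λ n₀ → ∀ (n : ℕ) → n₀ ℕ.≤ n → ∀ (ℓ t : ℕ) (G : Graph n) →
    RobustTilingFramework μ k a b ρ t ℓ G →
    ∀ (m : ℕ) (H : Graph m) →
    InB ((1ℚ - ρ') * ℕ→ℚ n) (ξ * ℕ→ℚ n) Δ H →
    InJ ((ℕ→ℚ k - 1ℚ) + (ℕ→ℚ a ÷₀ ℕ→ℚ b)) H →
    H ⊆G G))
theorem10p1 (ℕ.suc q) a b Δ _ 1≤a 1≤b 1≤Δ a≤b _ μ ρ' 0<μ _ 0<ρ' _ =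
  proj₁ ρ-bound , proj₁ (proj₂ ρ-bound) , λ ρ _ ρ≤ρ₀ →
  proj₁ ξ-bound , proj₁ (proj₂ ξ-bound) , λ ξ _ ξ≤ξ₀ →
  -- The bounds are uniform in n: for n below `Z` the component bound ξn is less than 1 and H is
  -- empty. n ≥ 1 allows division by n.
  1 , λ n 1≤n ℓ t G robust m H →
    embed-in-robust (proj₁ scale) q a b Δ μ ρ ρ' ξ (proj₁ ξ-bound) 1≤a 1≤b 1≤Δ a≤b
      (proj₁ (proj₂ scale)) (<⇒≤ 0<μ) (proj₂ (proj₂ scale))
      (≤-trans (*-monoˡ (ℕ→ℚ (4 ℕ.* R)) (0≤ℕ→ℚ (4 ℕ.* R)) ρ≤ρ₀) (≤-reflexive (proj₂ (proj₂ ρ-bound))))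
      (proj₂ (proj₂ ξ-bound)) ξ≤ξ₀ n 1≤n ℓ t G robust m H
  where
  scale = archimedean₂ μ ρ' 0<μ 0<ρ'
  open Constants (proj₁ scale) Δ using (R; Z; 1≤Z)
  -- ρ₀ = 1/(4`R`) keeps the uncovered fraction within one unit of slack; ξ₀ = 1/`Z` depends only on
  -- `R` and Δ.
  ρ-bound = reciprocal (4 ℕ.* R) (ℕ.s≤s ℕ.z≤n)
  ξ-bound = reciprocal Z 1≤Z
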